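{- Let $P_r^{(k)}$ be a $k$-uniform hyperpath with the hyperedge set $\{e_1^{(k)},\dots,e_r^{(k)}\}$. Let the $k$-uniform hypergraph $\mathcal{H}$ be the coalescence of the hyperpath $P_r^{(k)}$ at a cored vertex on the hyperedge $e_l^{(k)}$ with a $k$-uniform hypergraph $\mathcal{H}_0$ at its vertex $v_0$, where $2\le l\le\lceil\frac r2\rceil$ and $r\ge3$. Let the $k$-uniform hypergraph $\mathcal{H}_2$ be obtained by moving $\mathcal{H}_0$ to a cored vertex on $e_{l-1}^{(k)}$, i.e. $\mathcal{H}_2$ is the coalescence of $P_r^{(k)}$ at a cored vertex on $e_{l-1}^{(k)}$ with $\mathcal{H}_0$ at $v_0$ ($\mathcal{H}_2$ is said to be the second path-sliding transformation of $\mathcal{H}$). Then $\mathcal{H}_2\prec_\alpha\mathcal{H}$ for $k\ge3$ and $0<\alpha<1$.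
   Context: Hypergraphs are finite; $k$-uniform means every hyperedge has exactly $k$ vertices. The hyperpath $P_r^{(k)}$ is obtained from the path graph with consecutive edges $e_1,\dots,e_r$ by inserting $k-2$ new vertices (of degree one) into each edge, giving consecutive hyperedges $e_1^{(k)},\dots,e_r^{(k)}$. A cored vertex is a vertex of degree one; here it refers to degrees in the hyperpath. The coalescence of two disjoint hypergraphs at vertices $x$ and $y$ is obtained by identifying $x$ with $y$. For a $k$-uniform hypergraph $\mathcal{H}$ on $[n]$, $\mathcal{A}(\mathcal{H})$ is the $k$-order $n$-dimensional tensor with entry $\frac1{(k-1)!}$ at $(i_1,\dots,i_k)$ if $\{i_1,\dots,i_k\}\in E(\mathcal{H})$ and $0$ otherwise; $\mathcal{D}(\mathcal{H})$ is the diagonal tensor of vertex degrees; $\mathcal{A}_\alpha(\mathcal{H})=\alpha\mathcal{D}(\mathcal{H})+(1-\alpha)\mathcal{A}(\mathcal{H})$. For a tensor $\mathcal{T}$, $\mathrm{Tr}_d(\mathcal{T})$ is the sum of the $d$-th powers of all $n(k-1)^{n-1}$ eigenvalues of $\mathcal{T}$; in particular $\mathrm{Tr}_0(\mathcal{T})=n(k-1)^{n-1}$, and for $d\ge1$ $$\mathrm{Tr}_{d}(\mathcal{T})=(k-1)^{n-1}\sum_{d_1+\cdots+d_n=d}\ \prod_{i=1}^{n}\frac{1}{(d_i(k-1))!}\Big(\sum_{\gamma\in[n]^{k-1}}(\mathcal{T})_{i\gamma}\frac{\partial}{\partial a_{i\gamma}}\Big)^{d_i}\mathrm{tr}\big(A^{d(k-1)}\big),$$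 with $A=(a_{ij})$ an $n\times n$ matrix of indeterminates, $d_i\ge0$ integers, $\frac{\partial}{\partial a_{i\gamma}}=\frac{\partial}{\partial a_{i i_2}}\cdots\frac{\partial}{\partial a_{i i_k}}$ for $\gamma=i_2\cdots i_k$. $S_\alpha$-order: for $k$-uniform hypergraphs $\mathcal{G}_1,\mathcal{G}_2$ with $n$ vertices, $\mathcal{G}_1\prec_\alpha\mathcal{G}_2$ if there is $d\in\{1,\dots,n(k-1)^{n-1}-1\}$ with $\mathrm{Tr}_t(\mathcal{A}_\alpha(\mathcal{G}_1))=\mathrm{Tr}_t(\mathcal{A}_\alpha(\mathcal{G}_2))$ for $t=0,\dots,d-1$ and $\mathrm{Tr}_d(\mathcal{A}_\alpha(\mathcal{G}_1))<\mathrm{Tr}_d(\mathcal{A}_\alpha(\mathcal{G}_2))$.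
   Formalization: The formal statement adds that v_0 lies on at least one hyperedge of H_0; if v_0 is isolated in H_0, then H and H_2 are isomorphic, all traces agree, and the claim fails. -}

module Defs where

open import Algebra.Apartness.Bundles using (HeytingField)
open import Algebra.Bundles using (CommutativeRing)
open import Data.Bool.Base using (if_then_else_; _∧_)
open import Data.Fin.Base using (Fin; suc; inject₁; _↑ˡ_; _↑ʳ_; punchOut)
open import Data.Fin.Properties using (_≟_; any?)
open import Data.Fin.Subset using (Subset; inside; outside; _∈_; _∪_; ⁅_⁆; ⊤; ⊥; ⋃; ∣_∣)
open import Data.Fin.Subset.Properties using (_∈?_; anySubset?)
open import Data.List.Base using (List; []; _∷_; length; filter; allFin; upTo; cartesianProductWith; concatMap)
import Data.List.Base as List
open import Data.Nat.Base using (ℕ; zero; suc; _!; NonZero)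
import Data.Nat.Base as ℕ
open import Data.Nat.GeneralisedArithmetic using (fold)
open import Data.Nat.Properties using (_!≢0)
open import Data.Product.Base using (∃-syntax; _×_; _,_; proj₁)
open import Data.Sum.Base using (_⊎_; inj₁; inj₂)
open import Data.Vec.Base using (Vec; []; _∷_; _++_; concat; replicate; _[_]≔_; tabulate; toList; lookup)
import Data.Vec.Base as Vec
open import Data.Vec.Properties using (≡-dec)
open import Data.Vec.Relation.Unary.All using (all?)
import Data.Bool.Properties as Bool
open import Function.Bundles using (_⇔_; module Equivalence)
open import Level using (Level; 0ℓ) renaming (suc to lsuc; _⊔_ to _⊔ˡ_)
open import Relation.Binary.Core using (Rel)
open import Relation.Binary.PropositionalEquality.Core using (_≡_)
open import Relation.Binary.Structures using (IsStrictPartialOrder)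
open import Relation.Nullary.Decidable.Core using (Dec; does; yes; no; _×-dec_; _⊎-dec_)
open import Relation.Unary using (Pred; Decidable)

------------------------------------------------------------------------
-- Ordered fields

-- No decidability or totality of the order is assumed, so that the real
-- numbers are an instance constructively as well as classically.
record OrderedField c ℓ₁ ℓ₂ ℓ₃ : Set (lsuc (c ⊔ˡ ℓ₁ ⊔ˡ ℓ₂ ⊔ˡ ℓ₃)) where
  infix 4 _<_
  field
    heytingField : HeytingField c ℓ₁ ℓ₂
  open HeytingField heytingField public
    renaming (_+_ to infixl 6 _+_; _*_ to infixl 7 _*_; _-_ to infixl 6 _-_)
  field
    _<_                  : Rel Carrier ℓ₃
    isStrictPartialOrder : IsStrictPartialOrder _≈_ _<_
    #⇔<⊎>                : ∀ {x y} → x # y ⇔ (x < y ⊎ y < x)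
    +-monoˡ-<            : ∀ z {x y} → x < y → x + z < y + z
    *-pos                : ∀ {x y} → 0# < x → 0# < y → 0# < x * y

module FieldNumerals {c ℓ₁ ℓ₂ ℓ₃} (F : OrderedField c ℓ₁ ℓ₂ ℓ₃) where
  open OrderedField F
  private
    R : CommutativeRing c ℓ₁
    R = record { isCommutativeRing = isCommutativeRing }
    module < = IsStrictPartialOrder isStrictPartialOrder
  open import Algebra.Definitions.RawMonoid (CommutativeRing.+-rawMonoid R)
    using () renaming (_×_ to _×#_)
  open import Algebra.Properties.Ring (CommutativeRing.ring R)
    using (-‿distribˡ-*; -‿distribʳ-*; -‿involutive)
  open import Algebra.Apartness.Properties.HeytingCommutativeRing
    (HeytingField.heytingCommutativeRing heytingField) using (1#0)

  fromℕ : ℕ → Carrier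
  fromℕ n = n ×# 1#

  private
    <-resp : ∀ {x x′ y y′} → x ≈ x′ → y ≈ y′ → x < y → x′ < y′
    <-resp x≈x′ y≈y′ x<y = <.<-respʳ-≈ y≈y′ (<.<-respˡ-≈ x≈x′ x<y)

    0<1 : 0# < 1#
    0<1 with Equivalence.to #⇔<⊎> 1#0
    ... | inj₂ 0<1 = 0<1
    ... | inj₁ 1<0 = <-resp refl -1*-1≈1 (*-pos 0<-1 0<-1)
      where
      0<-1 : 0# < - 1#
      0<-1 = <-resp (-‿inverseʳ 1#) (+-identityˡ _) (+-monoˡ-< (- 1#) 1<0)
      -1*-1≈1 : - 1# * - 1# ≈ 1#
      -1*-1≈1 = trans (sym (-‿distribˡ-* 1# (- 1#)))
                 (trans (-‿cong (*-identityˡ (- 1#))) (-‿involutive 1#))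

    0<1+ : ∀ n → 0# < fromℕ (suc n)
    0<1+ zero    = <-resp refl (sym (+-identityʳ 1#)) 0<1
    0<1+ (suc n) = <.trans 0<1 (<-resp (+-identityˡ 1#) (+-comm _ 1#) (+-monoˡ-< 1# (0<1+ n)))

    fromℕ#0 : ∀ n → .{{NonZero n}} → fromℕ n # 0#
    fromℕ#0 (suc n) = Equivalence.from #⇔<⊎> (inj₂ (0<1+ n))

  1/_! : ℕ → Carrier
  1/ m ! = proj₁ (#⇒invertible (fromℕ#0 (m !) {{ m !≢0 }}))

------------------------------------------------------------------------
-- Finite enumerations

open import Data.Nat.Base using (_+_; _*_; _∸_; _^_; _≤_)

vecs : ∀ {a} {A : Set a} → List A → ∀ m → List (Vec A m)
vecs xs zero    = [] ∷ []
vecs xs (suc m) = cartesianProductWith _∷_ xs (vecs xs m)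

subsets : ∀ n → List (Subset n)
subsets = vecs (inside ∷ outside ∷ [])

-- All (d₁ , … , dₙ) with dᵢ ≥ 0 and d₁ + ⋯ + dₙ = d.
compositions : ∀ n → ℕ → List (Vec ℕ n)
compositions zero    zero    = [] ∷ []
compositions zero    (suc d) = []
compositions (suc n) d       =
  concatMap (λ d₁ → List.map (d₁ ∷_) (compositions n (d ∸ d₁))) (upTo (suc d))

------------------------------------------------------------------------
-- Hypergraphs on the vertex set Fin n

record Hypergraph (n : ℕ) : Set₁ where
  field
    Edge  : Pred (Subset n) 0ℓ
    edge? : Decidable Edge

open Hypergraph public

private variable
  m n : ℕ

Uniform : ℕ → Hypergraph n → Set
Uniform k H = ∀ {e} → Edge H e → ∣ e ∣ ≡ k

degree : Hypergraph n → Fin n → ℕ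
degree {n} H v = length (filter (λ e → edge? H e ×-dec v ∈? e) (subsets n))

_≟ˢ_ : (s t : Subset n) → Dec (s ≡ t)
_≟ˢ_ = ≡-dec Bool._≟_

image : (Fin n → Fin m) → Subset n → Subset m
image f s = tabulate λ v → does (any? λ u → u ∈? s ×-dec f u ≟ v)

-- The vertices of the hyperpath are the r + 1 vertices of the path graph,
-- followed by r blocks of k - 2 inserted vertices, the i-th block belonging
-- to the i-th edge.
hyperpathSize : ℕ → ℕ → ℕ
hyperpathSize k r = suc r + r * (k ∸ 2)

-- Indices start at zero: i : Fin r stands for the (i + 1)-st hyperedge.
hyperpathEdge : ∀ k r → Fin r → Subset (hyperpathSize k r)
hyperpathEdge k r i = (⁅ inject₁ i ⁆ ∪ ⁅ suc i ⁆) ++ concat (replicate r ⊥ [ i ]≔ ⊤)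

hyperpath : ∀ k r → Hypergraph (hyperpathSize k r)
hyperpath k r .Edge  e = ∃[ i ] e ≡ hyperpathEdge k r i
hyperpath k r .edge? e = any? λ i → e ≟ˢ hyperpathEdge k r i

-- In the coalescence the vertices of G keep their numbers, y becomes x, and
-- the vertices of H other than y are appended in order.
glueˡ : Fin n → Fin (n + m)
glueˡ {m = m} u = u ↑ˡ m

glueʳ : Fin n → Fin (suc m) → Fin (suc m) → Fin (n + m)
glueʳ {n = n} x y w with y ≟ w
... | yes _   = glueˡ x
... | no  y≢w = n ↑ʳ punchOut y≢w

coalescence : Hypergraph n → Fin n → Hypergraph (suc m) → Fin (suc m) → Hypergraph (n + m)
coalescence G x H y .Edge e =
  (∃[ s ] Edge G s × e ≡ image glueˡ s) ⊎ (∃[ s ] Edge H s × e ≡ image (glueʳ x y) s)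
coalescence G x H y .edge? e =
  anySubset? (λ s → edge? G s ×-dec e ≟ˢ image glueˡ s) ⊎-dec
  anySubset? (λ s → edge? H s ×-dec e ≟ˢ image (glueʳ x y) s)

------------------------------------------------------------------------
-- Tensors, traces and the order of k-uniform hypergraphs

module Spectral {c ℓ₁ ℓ₂ ℓ₃} (F : OrderedField c ℓ₁ ℓ₂ ℓ₃) where
  open OrderedField F renaming (_+_ to _+#_; _*_ to _*#_)
  open FieldNumerals F

  -- Order k, dimension n; the first index is separated from the others.
  Tensor : ℕ → ℕ → Set c
  Tensor k n = Fin n → Vec (Fin n) (k ∸ 1) → Carrier

  -- Polynomials in the entries a i j of an n × n matrix of indeterminates.
  infixl 6 _:+_
  infixl 7 _:*_
  data Poly (n : ℕ) : Set c where
    con       : Carrier → Poly n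
    var       : Fin n → Fin n → Poly n
    _:+_ _:*_ : Poly n → Poly n → Poly n

  ∂ : Fin n → Fin n → Poly n → Poly n
  ∂ i j (con _)     = con 0#
  ∂ i j (var i′ j′) = if does (i ≟ i′) ∧ does (j ≟ j′) then con 1# else con 0#
  ∂ i j (p :+ q)    = ∂ i j p :+ ∂ i j q
  ∂ i j (p :* q)    = ∂ i j p :* q :+ p :* ∂ i j q

  ∂* : Fin n → Vec (Fin n) m → Poly n → Poly n
  ∂* i γ p = Vec.foldr′ (∂ i) p γ

  constantTerm : Poly n → Carrier
  constantTerm (con a)   = a
  constantTerm (var _ _) = 0#
  constantTerm (p :+ q)  = constantTerm p +# constantTerm q
  constantTerm (p :* q)  = constantTerm p *# constantTerm q

  ∑ : ∀ {a} {A : Set a} → List A → (A → Carrier) → Carrier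
  ∑ xs f = List.foldr (λ x s → f x +# s) 0# xs

  ∑ₚ : ∀ {a} {A : Set a} → List A → (A → Poly n) → Poly n
  ∑ₚ xs f = List.foldr (λ x s → f x :+ s) (con 0#) xs

  matrixPower : ℕ → Fin n → Fin n → Poly n
  matrixPower         zero    i j = if does (i ≟ j) then con 1# else con 0#
  matrixPower {n = n} (suc s) i j = ∑ₚ (allFin n) λ l → var i l :* matrixPower s l j

  trPower : ∀ n → ℕ → Poly n
  trPower n s = ∑ₚ (allFin n) λ i → matrixPower s i i

  module _ (k : ℕ) where

    rowOperator : Tensor k n → Fin n → Poly n → Poly n
    rowOperator {n} T i p = ∑ₚ (vecs (allFin n) (k ∸ 1)) λ γ → con (T i γ) :* ∂* i γ p

    operator : Tensor k n → Vec ℕ n → Poly n → Poly n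
    operator {n} T ds p = List.foldr apply p (allFin n)
      where
      apply : Fin n → Poly n → Poly n
      apply i q = con (1/ (lookup ds i * (k ∸ 1)) !) :* fold q (rowOperator T i) (lookup ds i)

    -- In degree d ≥ 1 the operators have total order d (k - 1), which is the
    -- degree of the homogeneous polynomial tr (A ^ (d (k - 1))); the result
    -- is therefore a constant, and constantTerm reads it off.
    Tr : ℕ → Tensor k n → Carrier
    Tr {n} zero      T = fromℕ (n * (k ∸ 1) ^ (n ∸ 1))
    Tr {n} d@(suc _) T = fromℕ ((k ∸ 1) ^ (n ∸ 1)) *#
      ∑ (compositions n d) λ ds → constantTerm (operator T ds (trPower n (d * (k ∸ 1))))

    adjacencyTensor : Hypergraph n → Tensor k n
    adjacencyTensor H i γ =
      if does (edge? H (⋃ (List.map ⁅_⁆ (i ∷ toList γ)))) then 1/ (k ∸ 1) ! else 0#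

    degreeTensor : Hypergraph n → Tensor k n
    degreeTensor H i γ = if does (all? (i ≟_) γ) then fromℕ (degree H i) else 0#

    Aα : Carrier → Hypergraph n → Tensor k n
    Aα α H i γ = α *# degreeTensor H i γ +# (1# - α) *# adjacencyTensor H i γ

    SαLess : Carrier → Hypergraph n → Hypergraph n → Set (ℓ₁ ⊔ˡ ℓ₃)
    SαLess {n} α G₁ G₂ = ∃[ d ]
      1 ≤ d × d ≤ n * (k ∸ 1) ^ (n ∸ 1) ∸ 1 ×
      (∀ t → t ℕ.< d → Tr t (Aα α G₁) ≈ Tr t (Aα α G₂)) ×
      Tr d (Aα α G₁) < Tr d (Aα α G₂)

{-# OPTIONS --safe #-}

-- The trace Tr_d is a sum over words of d tensor entries, each entry (i , γ)
-- contributing the arcs from i to the vertices of γ; a word counts only if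
-- its arcs can be ordered into a closed walk, and it then counts positively.
-- The tensor A_α is a sum over the edges e of an edge part (the entries with
-- vertex set e) and of loops at the vertices of e.
--
-- Both hypergraphs split into the hyperpath minus an end edge, that end edge
-- (pendant; the first one for H, the last one for H₂) and the edges of H₀
-- (host).  By inclusion-exclusion Tr_d is determined by the path alone, the
-- shortened path with and without H₀, and the words using both pendant and
-- host entries.  The first contributions agree, because a rotation of the
-- vertices carries the shortened path and H₀ of H₂ to those of H.  In a
-- mixed word every edge f on the way from the pendant edge to H₀ is a cut
-- whose near side contains one vertex of f, so balancing the arcs across
-- the cut forces at least k entries from f.  With s edges on the way, mixed
-- words have length at least s k + 2, and this length is attained by an
-- Euler circuit with one loop at either end.  As s is l - 1 for H and
-- r - l + 1 > l - 1 for H₂, the traces first differ at d = (l - 1) k + 2.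
module Submission where

open import Defs
open import Algebra.Bundles using (CommutativeRing)
open import Data.Bool.Base using (Bool; true; false; if_then_else_; _∧_; not)
open import Data.Bool.ListAction using (all)
open import Data.Bool.Properties using (∧-zeroʳ)
open import Data.Empty using (⊥-elim)
open import Data.Fin.Base using (Fin; zero; suc; toℕ; inject₁; opposite; pred; punchIn; punchOut; splitAt; _↑ˡ_; _↑ʳ_)
import Data.Fin.Base as Fin
open import Data.Fin.Permutation using (Permutation′; _⟨$⟩ʳ_; _⟨$⟩ˡ_; inverseˡ; inverseʳ; insert; insert-punchIn; transpose; _∘ₚ_)
import Data.Fin.Permutation as Perm
import Data.Fin.Properties as Fin
open import Data.Fin.Subset using (Subset; _∈_; _∉_; ⁅_⁆; ⋃)
import Data.Fin.Subset as Subset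
open import Data.Fin.Subset.Properties using (_∈?_; x∈⁅x⁆; x∈⁅y⁆⇒x≡y; x∈p∪q⁻; x∈p∪q⁺; ∉⊥; ∈⊤; ⊆-antisym)
open import Data.List.Base using (List; []; _∷_; _++_; length; filter; allFin; concatMap; upTo)
import Data.List.Base as List
open import Data.List.Membership.Propositional using (find; lose) renaming (_∈_ to _∈ₗ_)
open import Data.List.Membership.Propositional.Properties using
  (∈-map⁻; ∈-map⁺; ∈-allFin; ∈-concatMap⁺; ∈-concatMap⁻; ∈-upTo⁺; ∈-upTo⁻; ∈-cartesianProductWith⁺;
   ∈-∃++; ∈-++⁺ˡ; ∈-++⁺ʳ; ∈-++⁻; ∈-tabulate⁺; ∈-tabulate⁻; ∈-filter⁺; ∈-filter⁻)
open import Data.List.Membership.Propositional.Properties.WithK using (unique∧set⇒bag)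
import Data.List.Properties as List
open import Data.List.Relation.Binary.BagAndSetEquality using (∼bag⇒↭)
open import Data.List.Relation.Binary.Permutation.Propositional using (_↭_; ↭-refl; ↭-sym; ↭-trans; ↭-reflexive; prep; swap)
import Data.List.Relation.Binary.Permutation.Propositional as ↭
import Data.List.Relation.Binary.Permutation.Propositional.Properties as ↭
open import Data.List.Relation.Unary.All using (All; []; _∷_)
import Data.List.Relation.Unary.All as All
import Data.List.Relation.Unary.All.Properties as All
open import Data.List.Relation.Unary.AllPairs using ([]; _∷_)
import Data.List.Relation.Unary.AllPairs as AllPairs
import Data.List.Relation.Unary.AllPairs.Properties as AllPairs
open import Data.List.Relation.Unary.Any using (Any; here; there)
import Data.List.Relation.Unary.Any as Any
import Data.List.Relation.Unary.Any.Properties as Any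
open import Data.List.Relation.Unary.Unique.Propositional using (Unique)
open import Data.List.Relation.Unary.Unique.Propositional.Properties using (allFin⁺)
import Data.List.Relation.Unary.Unique.Propositional.Properties as Unique
open import Data.Nat.Base using (ℕ; zero; suc; _+_; _*_; _∸_; _^_; _≤_; z≤n; s≤s; ⌈_/2⌉)
import Data.Nat.Base as ℕ
open import Data.Nat.GeneralisedArithmetic using (fold)
open import Data.Nat.ListAction using (sum)
open import Data.Nat.ListAction.Properties using (sum-↭; sum-++)
import Data.Nat.Properties as ℕ
open import Data.Nat.Solver using (module +-*-Solver)
open import Algebra.Properties.CommutativeSemigroup ℕ.+-commutativeSemigroup using () renaming (interchange to +-interchange)
open import Data.Product.Base using (∃-syntax; _×_; _,_; proj₁; proj₂; map₂)
open import Data.Product.Function.NonDependent.Propositional using (_×-↔_)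
open import Data.Sum.Base using (_⊎_; inj₁; inj₂)
open import Data.Sum.Function.Propositional using (_⊎-↔_)
open import Data.Vec.Base using (Vec; []; _∷_; toList; lookup; tabulate)
import Data.Vec.Base as Vec
import Data.Vec.Properties as Vec
open import Data.Vec.Relation.Unary.All using (all?)
import Data.Vec.Relation.Unary.All as VecAll
import Data.Vec.Relation.Unary.All.Properties as VecAll
open import Function.Base using (_∘_; id)
open import Function.Bundles using (module Equivalence; mk⇔)
open import Function.Properties.Inverse using (↔-sym; ↔-trans)
open import Relation.Binary.PropositionalEquality as ≡ using (_≡_; _≢_; refl; cong; cong₂; subst)
open import Relation.Binary.Structures using (IsStrictPartialOrder)
open import Relation.Nullary.Decidable using (does-⇔; dec-true; dec-false)
open import Relation.Nullary.Decidable.Core using (Dec; does; yes; no; _×-dec_)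
open import Relation.Nullary.Negation using (¬_; contradiction)

-- No trace is evaluated. A closed formula would require counting Euler circuits, whereas only the
-- sign of the mixed contribution matters, and it can be read off because all weights and walk
-- counts are nonnegative. Subtraction is avoided: inclusion-exclusion is an equality of sums, from
-- which common terms are cancelled at the end.
--
-- The two pendant edges lie at opposite ends for a reason. Without its first edge the path of H
-- carries H₀ on its (l - 1)-st remaining edge; without its last edge so does the path of H₂. This
-- is what makes the shortened hypergraphs isomorphic.
--
-- The bound k per cut reflects an asymmetry. An entry of f whose source is the near vertex leaves
-- the near side k - 1 times; any other entry of f returns only once. Hence every exit is paid for
-- by k - 1 returns.
--
-- The two further entries are loops, which are available since 0 < α; the edge parts are positive
-- since α < 1. The bound on l enters through l - 1 < r - l + 1, and it also keeps d below the
-- number of vertices.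

private variable
  m n : ℕ

-- Ordered fields and finite sums

module FieldLemmas {c ℓ₁ ℓ₂ ℓ₃} (F : OrderedField c ℓ₁ ℓ₂ ℓ₃) where
  open OrderedField F
    hiding (_-_)
    renaming (_+_ to _+#_; _*_ to _*#_; refl to ≈-refl; sym to ≈-sym; trans to ≈-trans)
  open FieldNumerals F
  open Spectral F using (∑)

  commutativeRing : CommutativeRing c ℓ₁
  commutativeRing = record { isCommutativeRing = isCommutativeRing }

  private
    module < = IsStrictPartialOrder isStrictPartialOrder

  open CommutativeRing commutativeRing using (ring)
  open import Algebra.Properties.Ring ring using (-‿distribˡ-*; -‿distribʳ-*; -‿involutive; -0#≈0#)
  open import Algebra.Properties.CommutativeSemigroup
    (CommutativeRing.+-commutativeSemigroup commutativeRing) using () renaming (interchange to +#-interchange; x∙yz≈y∙xz to x+yz≈y+xz)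
  open import Algebra.Apartness.Properties.HeytingCommutativeRing heytingCommutativeRing using (1#0)

  <-resp : ∀ {x x′ y y′} → x ≈ x′ → y ≈ y′ → x < y → x′ < y′
  <-resp x≈x′ y≈y′ x<y = <.<-respʳ-≈ y≈y′ (<.<-respˡ-≈ x≈x′ x<y)

  pos-resp : ∀ {x y} → x ≈ y → 0# < x → 0# < y
  pos-resp = <-resp ≈-refl

  +-pos : ∀ {x y} → 0# < x → 0# < y → 0# < x +# y
  +-pos {x} {y} 0<x 0<y = <.trans 0<y (<-resp (+-identityˡ y) ≈-refl (+-monoˡ-< y 0<x))

  neg-pos : ∀ {x} → x < 0# → 0# < - x
  neg-pos {x} x<0 = <-resp (-‿inverseʳ x) (+-identityˡ (- x)) (+-monoˡ-< (- x) x<0)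

  0<1 : 0# < 1#
  0<1 with Equivalence.to #⇔<⊎> 1#0
  ... | inj₂ 0<1 = 0<1
  ... | inj₁ 1<0 = pos-resp -1*-1≈1 (*-pos (neg-pos 1<0) (neg-pos 1<0))
    where
    -1*-1≈1 : - 1# *# - 1# ≈ 1#
    -1*-1≈1 = ≈-trans (≈-sym (-‿distribˡ-* 1# (- 1#)))
              (≈-trans (-‿cong (*-identityˡ (- 1#))) (-‿involutive 1#))

  fromℕ-pos : ∀ {n} → 1 ≤ n → 0# < fromℕ n
  fromℕ-pos {suc zero}    _ = pos-resp (≈-sym (+-identityʳ 1#)) 0<1
  fromℕ-pos {suc (suc n)} _ = +-pos 0<1 (fromℕ-pos {suc n} (s≤s z≤n))

  -- The order need not be total, so the sign of the inverse comes from apartness: being invertible,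
  -- it is apart from `0#`, hence positive or negative, and a negative inverse would make `- 1#`
  -- positive. The conversions arise because `#⇒invertible` inverts the difference of x and `0#`.
  inverse-pos : ∀ {x} (x#0 : x # 0#) → 0# < x → 0# < proj₁ (#⇒invertible x#0)
  inverse-pos {x} x#0 0<x
    with b , b*x≈1 , x*b≈1 ← #⇒invertible x#0
    with Equivalence.to #⇔<⊎> (invertible⇒# {b} {0#}
           ( x -# 0#
           , ≈-trans (*-congˡ (x-0≈x b)) x*b≈1
           , ≈-trans (*-congʳ (x-0≈x b)) b*x≈1))
      where
      _-#_ = OrderedField._-_ F
      x-0≈x : ∀ x → x -# 0# ≈ x
      x-0≈x x = ≈-trans (+-congˡ -0#≈0#) (+-identityʳ x)
  ... | inj₂ 0<b = 0<b
  ... | inj₁ b<0 = contradiction (pos-resp 1+-1≈0 (+-pos 0<1 0<-1)) (<.irrefl ≈-refl)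
    where
    1+-1≈0 = -‿inverseʳ 1#
    0<x-0 = pos-resp (≈-sym (≈-trans (+-congˡ -0#≈0#) (+-identityʳ x))) 0<x
    0<-1 : 0# < - 1#
    0<-1 = pos-resp (≈-trans (≈-sym (-‿distribʳ-* _ b)) (-‿cong x*b≈1)) (*-pos 0<x-0 (neg-pos b<0))

  1/!-pos : ∀ m → 0# < 1/ m !
  1/!-pos m = inverse-pos _ (fromℕ-pos (ℕ.n≢0⇒n>0 (ℕ.≢-nonZero⁻¹ _ {{ m ℕ.!≢0 }})))

  -- The disjunction replaces a decision procedure for the order. Carried along with every sum and
  -- product, it allows a positive sum to be traced back to a positive summand and a positive
  -- product to positive factors.
  Nonneg : Carrier → Set _
  Nonneg x = x ≈ 0# ⊎ 0# < x

  nonneg-resp : ∀ {x y} → x ≈ y → Nonneg x → Nonneg y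
  nonneg-resp x≈y (inj₁ x≈0) = inj₁ (≈-trans (≈-sym x≈y) x≈0)
  nonneg-resp x≈y (inj₂ 0<x) = inj₂ (pos-resp x≈y 0<x)

  0≮0 : ∀ {x} → x ≈ 0# → ¬ 0# < x
  0≮0 x≈0 0<x = <.irrefl ≈-refl (pos-resp x≈0 0<x)

  pos+nonneg : ∀ {x y} → 0# < x → Nonneg y → 0# < x +# y
  pos+nonneg 0<x (inj₁ y≈0) = pos-resp (≈-sym (≈-trans (+-congˡ y≈0) (+-identityʳ _))) 0<x
  pos+nonneg 0<x (inj₂ 0<y) = +-pos 0<x 0<y

  nonneg+pos : ∀ {x y} → Nonneg x → 0# < y → 0# < x +# y
  nonneg+pos x≥0 0<y = pos-resp (+-comm _ _) (pos+nonneg 0<y x≥0)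

  +-nonneg : ∀ {x y} → Nonneg x → Nonneg y → Nonneg (x +# y)
  +-nonneg (inj₁ x≈0) y≥0 = nonneg-resp (≈-sym (≈-trans (+-congʳ x≈0) (+-identityˡ _))) y≥0
  +-nonneg (inj₂ 0<x) y≥0 = inj₂ (pos+nonneg 0<x y≥0)

  *-zeroˡ : ∀ {x y} → x ≈ 0# → x *# y ≈ 0#
  *-zeroˡ x≈0 = ≈-trans (*-congʳ x≈0) (zeroˡ _)

  *-zeroʳ : ∀ {x y} → y ≈ 0# → x *# y ≈ 0#
  *-zeroʳ y≈0 = ≈-trans (*-congˡ y≈0) (zeroʳ _)

  *-nonneg : ∀ {x y} → Nonneg x → Nonneg y → Nonneg (x *# y)
  *-nonneg (inj₁ x≈0) _          = inj₁ (*-zeroˡ x≈0)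
  *-nonneg (inj₂ _)   (inj₁ y≈0) = inj₁ (*-zeroʳ y≈0)
  *-nonneg (inj₂ 0<x) (inj₂ 0<y) = inj₂ (*-pos 0<x 0<y)

  *-pos⁻¹ : ∀ {x y} → Nonneg x → Nonneg y → 0# < x *# y → 0# < x × 0# < y
  *-pos⁻¹ (inj₂ 0<x) (inj₂ 0<y) _ = 0<x , 0<y
  *-pos⁻¹ (inj₁ x≈0) _          p = ⊥-elim (0≮0 (*-zeroˡ x≈0) p)
  *-pos⁻¹ (inj₂ 0<x) (inj₁ y≈0) p = ⊥-elim (0≮0 (*-zeroʳ y≈0) p)

  +-pos⁻¹ : ∀ {x y} → Nonneg x → Nonneg y → 0# < x +# y → 0# < x ⊎ 0# < y
  +-pos⁻¹ (inj₂ 0<x) _          _ = inj₁ 0<x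
  +-pos⁻¹ (inj₁ _)   (inj₂ 0<y) _ = inj₂ 0<y
  +-pos⁻¹ (inj₁ x≈0) (inj₁ y≈0) p = ⊥-elim (0≮0 (≈-trans (+-cong x≈0 y≈0) (+-identityˡ _)) p)

  when : Bool → Carrier → Carrier
  when b x = if b then x else 0#

  when-congʳ : ∀ b {x y} → x ≈ y → when b x ≈ when b y
  when-congʳ true  x≈y = x≈y
  when-congʳ false _   = ≈-refl

  when-nonneg : ∀ b {x} → Nonneg x → Nonneg (when b x)
  when-nonneg true  x≥0 = x≥0
  when-nonneg false _   = inj₁ ≈-refl

  module _ {a} {A : Set a} where

    ∑-congₗ : ∀ (xs : List A) {f g : A → Carrier} → (∀ x → x ∈ₗ xs → f x ≈ g x) → ∑ xs f ≈ ∑ xs g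
    ∑-congₗ []       _ = ≈-refl
    ∑-congₗ (x ∷ xs) h = +-cong (h x (here refl)) (∑-congₗ xs λ y y∈ → h y (there y∈))

    ∑-cong : ∀ (xs : List A) {f g : A → Carrier} → (∀ x → f x ≈ g x) → ∑ xs f ≈ ∑ xs g
    ∑-cong xs h = ∑-congₗ xs λ x _ → h x

    ∑-++ : ∀ (xs ys : List A) (f : A → Carrier) → ∑ (xs ++ ys) f ≈ ∑ xs f +# ∑ ys f
    ∑-++ []       ys f = ≈-sym (+-identityˡ _)
    ∑-++ (x ∷ xs) ys f = ≈-trans (+-congˡ (∑-++ xs ys f)) (≈-sym (+-assoc _ _ _))

    ∑-0 : ∀ (xs : List A) {f : A → Carrier} → (∀ x → x ∈ₗ xs → f x ≈ 0#) → ∑ xs f ≈ 0#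
    ∑-0 []       _ = ≈-refl
    ∑-0 (x ∷ xs) h = ≈-trans (+-cong (h x (here refl)) (∑-0 xs λ y y∈ → h y (there y∈))) (+-identityˡ _)

    ∑-distrib-+ : ∀ (xs : List A) (f g : A → Carrier) → ∑ xs (λ x → f x +# g x) ≈ ∑ xs f +# ∑ xs g
    ∑-distrib-+ []       f g = ≈-sym (+-identityˡ _)
    ∑-distrib-+ (x ∷ xs) f g = ≈-trans (+-congˡ (∑-distrib-+ xs f g)) (+#-interchange _ _ _ _)

    *-distribˡ-∑ : ∀ a (xs : List A) (f : A → Carrier) → a *# ∑ xs f ≈ ∑ xs (λ x → a *# f x)
    *-distribˡ-∑ a []       f = zeroʳ a
    *-distribˡ-∑ a (x ∷ xs) f = ≈-trans (distribˡ a _ _) (+-congˡ (*-distribˡ-∑ a xs f))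

    ∑-↭ : ∀ {xs ys : List A} (f : A → Carrier) → xs ↭ ys → ∑ xs f ≈ ∑ ys f
    ∑-↭ f ↭.refl         = ≈-refl
    ∑-↭ f (prep x p)     = +-congˡ (∑-↭ f p)
    ∑-↭ f (swap x y p)   = ≈-trans (x+yz≈y+xz _ _ _) (+-congˡ (+-congˡ (∑-↭ f p)))
    ∑-↭ f (↭.trans p q)  = ≈-trans (∑-↭ f p) (∑-↭ f q)

    ∑-nonneg : ∀ (xs : List A) {f : A → Carrier} → (∀ x → Nonneg (f x)) → Nonneg (∑ xs f)
    ∑-nonneg []       _ = inj₁ ≈-refl
    ∑-nonneg (x ∷ xs) h = +-nonneg (h x) (∑-nonneg xs h)

    ∑-pos : ∀ (xs : List A) {f : A → Carrier} → (∀ x → Nonneg (f x)) → ∀ {x} → x ∈ₗ xs → 0# < f x → 0# < ∑ xs f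
    ∑-pos (_ ∷ xs) h (here refl) 0<fx = pos+nonneg 0<fx (∑-nonneg xs h)
    ∑-pos (_ ∷ xs) h (there x∈)  0<fx = nonneg+pos (h _) (∑-pos xs h x∈ 0<fx)

    ∑-pos⁻¹ : ∀ (xs : List A) {f : A → Carrier} → (∀ x → Nonneg (f x)) → 0# < ∑ xs f → ∃[ x ] x ∈ₗ xs × 0# < f x
    ∑-pos⁻¹ []       h p = ⊥-elim (0≮0 ≈-refl p)
    ∑-pos⁻¹ (x ∷ xs) h p with +-pos⁻¹ (h x) (∑-nonneg xs h) p
    ... | inj₁ q = x , here refl , q
    ... | inj₂ q with y , y∈ , r ← ∑-pos⁻¹ xs h q = y , there y∈ , r

    ∑-when-unique : ∀ (xs : List A) {P : A → Set} (P? : ∀ x → Dec (P x)) (f : A → Carrier) →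
      Unique xs → ∀ {x} → x ∈ₗ xs → P x → (∀ {y} → P y → y ≡ x) →
      ∑ xs (λ y → when (does (P? y)) (f y)) ≈ f x
    ∑-when-unique (z ∷ xs) P? f (z∉ ∷ u) {x} x∈ Px uniq with P? z
    ... | yes Pz with refl ← uniq Pz = ≈-trans (+-congˡ (∑-0 xs λ y y∈ → vanish y y∈)) (+-identityʳ _)
      where
      vanish : ∀ y → y ∈ₗ xs → when (does (P? y)) (f y) ≈ 0#
      vanish y y∈ with P? y
      ... | yes Py = contradiction (≡.sym (uniq Py)) (All.lookup z∉ y∈)
      ... | no _   = ≈-refl
    ∑-when-unique (z ∷ xs) P? f (z∉ ∷ u) (here refl) Px uniq | no ¬Pz = contradiction Px ¬Pz
    ∑-when-unique (z ∷ xs) P? f (z∉ ∷ u) (there x∈) Px uniq | no ¬Pz =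
      ≈-trans (+-identityˡ _) (∑-when-unique xs P? f u x∈ Px uniq)

  module _ {a b} {A : Set a} {B : Set b} where

    ∑-map : ∀ (h : A → B) (xs : List A) (f : B → Carrier) → ∑ (List.map h xs) f ≡ ∑ xs (f ∘ h)
    ∑-map h []       f = refl
    ∑-map h (x ∷ xs) f = cong (_ +#_) (∑-map h xs f)

    ∑-concatMap : ∀ (h : A → List B) (xs : List A) (f : B → Carrier) → ∑ (concatMap h xs) f ≈ ∑ xs (λ x → ∑ (h x) f)
    ∑-concatMap h []       f = ≈-refl
    ∑-concatMap h (x ∷ xs) f = ≈-trans (∑-++ (h x) _ f) (+-congˡ (∑-concatMap h xs f))

    ∑-swap : ∀ (xs : List A) (ys : List B) (f : A → B → Carrier) →
      ∑ xs (λ x → ∑ ys (f x)) ≈ ∑ ys (λ y → ∑ xs (λ x → f x y))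
    ∑-swap []       ys f = ≈-sym (∑-0 ys λ _ _ → ≈-refl)
    ∑-swap (x ∷ xs) ys f = ≈-trans (+-congˡ (∑-swap xs ys f)) (≈-sym (∑-distrib-+ ys _ _))

-- Expansion of the traces over words

Arc : ℕ → Set
Arc n = Fin n × Fin n

-- Equal elements are singled out once per occurrence, which is the multiplicity that the product
-- rule demands.
select : ∀ {a} {A : Set a} → List A → List (A × List A)
select []       = []
select (x ∷ xs) = (x , xs) ∷ List.map (map₂ (x ∷_)) (select xs)

select-map : ∀ {a b} {A : Set a} {B : Set b} (h : A → B) (xs : List A) →
  select (List.map h xs) ≡ List.map (λ (x , ys) → h x , List.map h ys) (select xs)
select-map h []       = refl
select-map h (x ∷ xs) = cong ((h x , List.map h xs) ∷_) (≡.trans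
  (cong (List.map (map₂ (h x ∷_))) (select-map h xs))
  (≡.trans (≡.sym (List.map-∘ (select xs))) (List.map-∘ (select xs))))

select-↭ : ∀ {a} {A : Set a} (xs : List A) {y ys} → (y , ys) ∈ₗ select xs → xs ↭ y ∷ ys
select-↭ (x ∷ xs) (here refl) = ↭-refl
select-↭ (x ∷ xs) (there p) with (y , ys) , q , refl ← ∈-map⁻ _ p =
  ↭-trans (prep x (select-↭ xs q)) (swap x y ↭-refl)

data Walk {n} : Fin n → Fin n → List (Arc n) → Set where
  []  : ∀ {i} → Walk i i []
  _∷_ : ∀ {i j as} v → Walk v j as → Walk i j ((i , v) ∷ as)

-- An Euler trail of the directed multigraph with arc list `as`: each listed arc is used exactly
-- once, in some order.
Trail : Fin n → Fin n → List (Arc n) → Set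
Trail i j as = ∃[ bs ] as ↭ bs × Walk i j bs

Item : ℕ → ℕ → Set
Item n m = Fin n × Vec (Fin n) m

arcs : Item n m → List (Arc n)
arcs (i , γ) = List.map (i ,_) (toList γ)

arcs* : List (Item n m) → List (Arc n)
arcs* = concatMap arcs

sources : Vec ℕ n → List (Fin n)
sources ds = concatMap (λ i → List.replicate (lookup ds i) i) (allFin _)

words : ∀ n m → List (Fin n) → List (List (Item n m))
words n m []       = [] ∷ []
words n m (i ∷ is) = concatMap (λ γ → List.map ((i , γ) ∷_) (words n m is)) (vecs (allFin n) m)

-- Mirrors the order in which the nested derivatives in `∂*` reach a polynomial, so that `⟦∂*⟧`
-- follows by computation; the order itself is irrelevant by `push-↭`.
push : Fin n → Vec (Fin n) m → List (Arc n) → List (Arc n)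
push i []      as = as
push i (j ∷ γ) as = push i γ ((i , j) ∷ as)

push* : List (Item n m) → List (Arc n) → List (Arc n)
push* []            as = as
push* ((i , γ) ∷ w) as = push* w (push i γ as)

push-↭ : ∀ (i : Fin n) (γ : Vec (Fin n) m) as → push i γ as ↭ List.map (i ,_) (toList γ) ++ as
push-↭ i []      as = ↭-refl
push-↭ i (j ∷ γ) as = ↭-trans (push-↭ i γ _) (↭.shift (i , j) (List.map (i ,_) (toList γ)) as)

push*-↭ : ∀ (w : List (Item n m)) as → push* w as ↭ arcs* w ++ as
push*-↭ []            as = ↭-refl
push*-↭ ((i , γ) ∷ w) as =
  ↭-trans (push*-↭ w _)
 (↭-trans (↭.++⁺ˡ (arcs* w) (push-↭ i γ as))
 (↭-trans (↭-reflexive (≡.sym (List.++-assoc (arcs* w) _ as)))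
          (↭.++⁺ʳ as (↭.++-comm (arcs* w) (List.map (i ,_) (toList γ))))))

push*-++ : ∀ (u w : List (Item n m)) as → push* (u ++ w) as ≡ push* w (push* u as)
push*-++ []      w as = refl
push*-++ (_ ∷ u) w as = push*-++ u w _

module TraceExpansion {c ℓ₁ ℓ₂ ℓ₃} (F : OrderedField c ℓ₁ ℓ₂ ℓ₃) where
  open OrderedField F
    hiding (_-_)
    renaming (_+_ to _+#_; _*_ to _*#_; refl to ≈-refl; sym to ≈-sym; trans to ≈-trans)
  open FieldNumerals F
  open Spectral F
  open FieldLemmas F
  open import Algebra.Properties.CommutativeSemigroup
    (CommutativeRing.+-commutativeSemigroup commutativeRing) using () renaming (x∙yz≈y∙xz to x+yz≈y+xz)
  open import Algebra.Properties.CommutativeSemigroup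
    (CommutativeRing.*-commutativeSemigroup commutativeRing) using () renaming (x∙yz≈y∙xz to x*yz≈y*xz)
  open import Relation.Binary.Reasoning.Setoid setoid

  ∂s : List (Arc n) → Poly n → Poly n
  ∂s []             p = p
  ∂s ((i , j) ∷ as) p = ∂s as (∂ i j p)

  -- The coefficients of p in the exponential normalisation: a product of
  -- polynomials becomes a sum over the ways to deal out the arcs.
  ⟦_⟧ : Poly n → List (Arc n) → Carrier
  ⟦ p ⟧ as = constantTerm (∂s as p)

  ⟦0⟧ : ∀ (as : List (Arc n)) → ⟦ con 0# ⟧ as ≈ 0#
  ⟦0⟧ []       = ≈-refl
  ⟦0⟧ (_ ∷ as) = ⟦0⟧ as

  ⟦+⟧ : ∀ (p q : Poly n) as → ⟦ p :+ q ⟧ as ≡ ⟦ p ⟧ as +# ⟦ q ⟧ as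
  ⟦+⟧ p q []             = refl
  ⟦+⟧ p q ((i , j) ∷ as) = ⟦+⟧ (∂ i j p) (∂ i j q) as

  ⟦∑⟧ : ∀ {a} {A : Set a} (xs : List A) (f : A → Poly n) as → ⟦ ∑ₚ xs f ⟧ as ≈ ∑ xs (λ x → ⟦ f x ⟧ as)
  ⟦∑⟧ []       f as = ⟦0⟧ as
  ⟦∑⟧ (x ∷ xs) f as = ≈-trans (reflexive (⟦+⟧ (f x) _ as)) (+-congˡ (⟦∑⟧ xs f as))

  ⟦con*⟧ : ∀ a (p : Poly n) as → ⟦ con a :* p ⟧ as ≈ a *# ⟦ p ⟧ as
  ⟦con*⟧ a p []             = ≈-refl
  ⟦con*⟧ a p ((i , j) ∷ as) = begin
    ⟦ con 0# :* p :+ con a :* ∂ i j p ⟧ as             ≡⟨ ⟦+⟧ (con 0# :* p) _ as ⟩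
    ⟦ con 0# :* p ⟧ as +# ⟦ con a :* ∂ i j p ⟧ as      ≈⟨ +-cong (⟦con*⟧ 0# p as) (⟦con*⟧ a (∂ i j p) as) ⟩
    0# *# ⟦ p ⟧ as +# a *# ⟦ ∂ i j p ⟧ as              ≈⟨ +-congʳ (zeroˡ _) ⟩
    0# +# a *# ⟦ ∂ i j p ⟧ as                          ≈⟨ +-identityˡ _ ⟩
    a *# ⟦ ∂ i j p ⟧ as                                ∎

  ⟦if*⟧ : ∀ b (p : Poly n) as → ⟦ (if b then con 1# else con 0#) :* p ⟧ as ≈ when b (⟦ p ⟧ as)
  ⟦if*⟧ true  p as = ≈-trans (⟦con*⟧ 1# p as) (*-identityˡ _)
  ⟦if*⟧ false p as = ≈-trans (⟦con*⟧ 0# p as) (zeroˡ _)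

  -- The product rule: exactly one of the derivatives must hit the variable, since an untouched
  -- variable has constant term zero; all others act on p.
  ⟦var*⟧ : ∀ i l (p : Poly n) as → ⟦ var i l :* p ⟧ as ≈
    ∑ (select as) λ ((u , v) , bs) → when (does (u Fin.≟ i) ∧ does (v Fin.≟ l)) (⟦ p ⟧ bs)
  ⟦var*⟧ i l p []             = zeroˡ _
  ⟦var*⟧ i l p ((u , v) ∷ as) = ≈-trans (reflexive (⟦+⟧ (∂ u v (var i l) :* p) _ as))
    (+-cong (⟦if*⟧ (does (u Fin.≟ i) ∧ does (v Fin.≟ l)) p as)
            (≈-trans (⟦var*⟧ i l (∂ u v p) as) (≈-sym (reflexive (∑-map _ (select as) _)))))

  -- The number of ways to order the occurrences in `as` into a walk of length s, as a field
  -- element. Repeated arcs count as distinct, matching the exponential normalisation of the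
  -- coefficients.
  walks : ℕ → Fin n → Fin n → List (Arc n) → Carrier
  walks zero    i j []      = when (does (i Fin.≟ j)) 1#
  walks zero    i j (_ ∷ _) = 0#
  walks (suc s) i j as      = ∑ (select as) λ ((u , v) , bs) → when (does (u Fin.≟ i)) (walks s v j bs)

  ⟦matrixPower⟧ : ∀ s (i j : Fin n) as → ⟦ matrixPower s i j ⟧ as ≈ walks s i j as
  ⟦matrixPower⟧ zero i j [] with does (i Fin.≟ j)
  ... | true  = ≈-refl
  ... | false = ≈-refl
  ⟦matrixPower⟧ zero i j (_ ∷ as) with does (i Fin.≟ j)
  ... | true  = ⟦0⟧ as
  ... | false = ⟦0⟧ as
  ⟦matrixPower⟧ {n} (suc s) i j as = begin
    ⟦ matrixPower (suc s) i j ⟧ as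
      ≈⟨ ⟦∑⟧ (allFin n) _ as ⟩
    ∑ (allFin n) (λ l → ⟦ var i l :* matrixPower s l j ⟧ as)
      ≈⟨ ∑-cong (allFin n) (λ l → ≈-trans (⟦var*⟧ i l (matrixPower s l j) as)
           (∑-cong (select as) λ ((u , v) , bs) →
             when-congʳ (does (u Fin.≟ i) ∧ does (v Fin.≟ l)) (⟦matrixPower⟧ s l j bs))) ⟩
    ∑ (allFin n) (λ l → ∑ (select as) λ ((u , v) , bs) →
      when (does (u Fin.≟ i) ∧ does (v Fin.≟ l)) (walks s l j bs))
      ≈⟨ ∑-swap (allFin n) (select as) _ ⟩
    ∑ (select as) (λ ((u , v) , bs) → ∑ (allFin n) λ l →
      when (does (u Fin.≟ i) ∧ does (v Fin.≟ l)) (walks s l j bs))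
      ≈⟨ ∑-cong (select as) (λ ((u , v) , bs) → delta (does (u Fin.≟ i)) v (λ l → walks s l j bs)) ⟩
    walks (suc s) i j as ∎
    where
    delta : ∀ b v (g : Fin n → Carrier) → ∑ (allFin n) (λ l → when (b ∧ does (v Fin.≟ l)) (g l)) ≈ when b (g v)
    delta true  v g = ∑-when-unique (allFin n) (v Fin.≟_) g (allFin⁺ n) (∈-allFin v) refl ≡.sym
    delta false v g = ∑-0 (allFin n) λ _ _ → ≈-refl

  closedWalks : ℕ → List (Arc n) → Carrier
  closedWalks {n} s as = ∑ (allFin n) λ i → walks s i i as

  ⟦trPower⟧ : ∀ s (as : List (Arc n)) → ⟦ trPower n s ⟧ as ≈ closedWalks s as
  ⟦trPower⟧ {n} s as = ≈-trans (⟦∑⟧ (allFin n) _ as) (∑-cong (allFin n) λ i → ⟦matrixPower⟧ s i i as)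

  ∑-select-↭ : ∀ {a} {A : Set a} {xs ys : List A} (f : A × List A → Carrier) →
    (∀ x {us vs} → us ↭ vs → f (x , us) ≈ f (x , vs)) → xs ↭ ys → ∑ (select xs) f ≈ ∑ (select ys) f
  ∑-select-↭ f resp ↭.refl = ≈-refl
  ∑-select-↭ {xs = _ ∷ xs} {_ ∷ ys} f resp (prep x p) = +-cong (resp x p)
    (≈-trans (reflexive (∑-map _ (select xs) f))
    (≈-trans (∑-select-↭ _ (λ y q → resp y (prep x q)) p)
             (≈-sym (reflexive (∑-map _ (select ys) f)))))
  ∑-select-↭ {xs = _ ∷ _ ∷ xs} {_ ∷ _ ∷ ys} f resp (swap x y p) =
    ≈-trans (x+yz≈y+xz _ _ _)
    (+-cong (resp y (prep x p)) (+-cong (resp x (prep y p))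
      (≈-trans (reflexive (≡.trans (∑-map _ (List.map _ (select xs)) f) (∑-map _ (select xs) _)))
      (≈-trans (≈-trans (∑-select-↭ _ (λ z q → resp z (prep x (prep y q))) p)
                        (∑-cong (select ys) λ (z , zs) → resp z (swap x y ↭-refl)))
               (≈-sym (reflexive (≡.trans (∑-map _ (List.map _ (select ys)) f) (∑-map _ (select ys) _))))))))
  ∑-select-↭ f resp (↭.trans p q) = ≈-trans (∑-select-↭ f resp p) (∑-select-↭ f resp q)

  walks-↭ : ∀ s (i j : Fin n) {as bs} → as ↭ bs → walks s i j as ≈ walks s i j bs
  walks-↭ zero i j {[]}    {[]}    p = ≈-refl
  walks-↭ zero i j {[]}    {_ ∷ _} p = contradiction (↭-sym p) ↭.¬x∷xs↭[]
  walks-↭ zero i j {_ ∷ _} {[]}    p = contradiction p ↭.¬x∷xs↭[]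
  walks-↭ zero i j {_ ∷ _} {_ ∷ _} p = ≈-refl
  walks-↭ (suc s) i j p = ∑-select-↭ _ (λ (u , v) q → when-congʳ (does (u Fin.≟ i)) (walks-↭ s v j q)) p

  closedWalks-↭ : ∀ s {as bs : List (Arc n)} → as ↭ bs → closedWalks s as ≈ closedWalks s bs
  closedWalks-↭ {n} s p = ∑-cong (allFin n) λ i → walks-↭ s i i p

  walks-nonneg : ∀ s (i j : Fin n) as → Nonneg (walks s i j as)
  walks-nonneg zero    i j []      = when-nonneg (does (i Fin.≟ j)) (inj₂ 0<1)
  walks-nonneg zero    i j (_ ∷ _) = inj₁ ≈-refl
  walks-nonneg (suc s) i j as      =
    ∑-nonneg (select as) λ ((u , v) , bs) → when-nonneg (does (u Fin.≟ i)) (walks-nonneg s v j bs)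

  walks-pos⇒trail : ∀ s (i j : Fin n) as → 0# < walks s i j as → Trail i j as
  walks-pos⇒trail zero i j [] p with i Fin.≟ j
  ... | yes refl = [] , ↭-refl , []
  ... | no  _    = ⊥-elim (0≮0 ≈-refl p)
  walks-pos⇒trail zero i j (_ ∷ _) p = ⊥-elim (0≮0 ≈-refl p)
  walks-pos⇒trail (suc s) i j as p
    with ((u , v) , bs) , b∈ , q ← ∑-pos⁻¹ (select as)
           (λ ((u , v) , bs) → when-nonneg (does (u Fin.≟ i)) (walks-nonneg s v j bs)) p
    with u Fin.≟ i
  ... | no  _    = ⊥-elim (0≮0 ≈-refl q)
  ... | yes refl with cs , bs↭cs , walk ← walks-pos⇒trail s v j bs q =
    (i , v) ∷ cs , ↭-trans (select-↭ as b∈) (prep _ bs↭cs) , v ∷ walk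

  walk⇒walks-pos : ∀ {i j : Fin n} {as} → Walk i j as → 0# < walks (length as) i j as
  walk⇒walks-pos {i = i} [] with i Fin.≟ i
  ... | yes _  = 0<1
  ... | no i≢i = contradiction refl i≢i
  walk⇒walks-pos {i = i} {j} {_ ∷ as} (v ∷ walk) = ∑-pos (select ((i , v) ∷ as))
    (λ ((u , v) , bs) → when-nonneg (does (u Fin.≟ i)) (walks-nonneg (length as) v j bs)) (here refl) first
    where
    first : 0# < when (does (i Fin.≟ i)) (walks (length as) v j as)
    first with i Fin.≟ i
    ... | yes _  = walk⇒walks-pos walk
    ... | no i≢i = contradiction refl i≢i

  closedWalks-nonneg : ∀ s (as : List (Arc n)) → Nonneg (closedWalks s as)
  closedWalks-nonneg {n} s as = ∑-nonneg (allFin n) λ i → walks-nonneg s i i as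

  closedWalks-pos⇒trail : ∀ s (as : List (Arc n)) → 0# < closedWalks s as → ∃[ i ] Trail i i as
  closedWalks-pos⇒trail {n} s as p
    with i , _ , q ← ∑-pos⁻¹ (allFin n) (λ i → walks-nonneg s i i as) p = i , walks-pos⇒trail s i i as q

  trail⇒closedWalks-pos : ∀ {s} {i : Fin n} {as} → Trail i i as → length as ≡ s → 0# < closedWalks s as
  trail⇒closedWalks-pos {n} {i = i} {as} (bs , as↭bs , walk) refl =
    ∑-pos (allFin n) (λ i → walks-nonneg (length as) i i as) (∈-allFin i)
      (pos-resp (≈-sym (walks-↭ (length as) i i as↭bs))
        (subst (λ s → 0# < walks s i i bs) (≡.sym (↭.↭-length as↭bs)) (walk⇒walks-pos walk)))

  walks-map : ∀ (φ : Fin n → Fin n) → (∀ {u v} → φ u ≡ φ v → u ≡ v) → ∀ s i j as →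
    walks s (φ i) (φ j) (List.map (λ (u , v) → φ u , φ v) as) ≈ walks s i j as
  walks-map φ inj zero i j [] = reflexive (cong (λ b → when b 1#)
    (does-⇔ (mk⇔ inj (cong φ)) (φ i Fin.≟ φ j) (i Fin.≟ j)))
  walks-map φ inj zero i j (_ ∷ as) = ≈-refl
  walks-map φ inj (suc s) i j as = begin
    walks (suc s) (φ i) (φ j) (List.map φ² as)
      ≡⟨ cong (λ xs → ∑ xs _) (select-map φ² as) ⟩
    _ ≡⟨ ∑-map _ (select as) _ ⟩
    ∑ (select as) (λ ((u , v) , bs) → when (does (φ u Fin.≟ φ i)) (walks s (φ v) (φ j) (List.map φ² bs)))
      ≈⟨ ∑-cong (select as) (λ ((u , v) , bs) → ≈-trans
           (reflexive (cong (λ b → when b _) (does-⇔ (mk⇔ inj (cong φ)) (φ u Fin.≟ φ i) (u Fin.≟ i))))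
           (when-congʳ (does (u Fin.≟ i)) (walks-map φ inj s v j bs))) ⟩
    walks (suc s) i j as ∎
    where
    φ² : Arc _ → Arc _
    φ² (u , v) = φ u , φ v

  ∑-words-∷ : ∀ m (i : Fin n) is f → ∑ (words n m (i ∷ is)) f ≈
    ∑ (vecs (allFin n) m) λ γ → ∑ (words n m is) λ w → f ((i , γ) ∷ w)
  ∑-words-∷ {n} m i is f = ≈-trans (∑-concatMap _ (vecs (allFin n) m) f)
    (∑-cong (vecs (allFin n) m) λ γ → reflexive (∑-map _ (words n m is) f))

  ∑-words-++ : ∀ m (is js : List (Fin n)) f → ∑ (words n m (is ++ js)) f ≈
    ∑ (words n m is) λ u → ∑ (words n m js) λ w → f (u ++ w)
  ∑-words-++     m []       js f = ≈-sym (+-identityʳ _)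
  ∑-words-++ {n} m (i ∷ is) js f = ≈-trans (∑-words-∷ m i (is ++ js) f)
    (≈-trans (∑-cong (vecs (allFin n) m) λ γ → ∑-words-++ m is js _) (≈-sym (∑-words-∷ m i is _)))

  weight : ∀ {a} {A : Set a} → (A → Carrier) → List A → Carrier
  weight f = List.foldr (λ x s → f x *# s) 1#

  weight-++ : ∀ {a} {A : Set a} (f : A → Carrier) xs ys → weight f (xs ++ ys) ≈ weight f xs *# weight f ys
  weight-++ f []       ys = ≈-sym (*-identityˡ _)
  weight-++ f (x ∷ xs) ys = ≈-trans (*-congˡ (weight-++ f xs ys)) (≈-sym (*-assoc _ _ _))

  module _ (k : ℕ) where

    ⟦∂*⟧ : ∀ (i : Fin n) (γ : Vec (Fin n) m) p as → ⟦ ∂* i γ p ⟧ as ≡ ⟦ p ⟧ (push i γ as)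
    ⟦∂*⟧ i []      p as = refl
    ⟦∂*⟧ i (j ∷ γ) p as = ⟦∂*⟧ i γ p ((i , j) ∷ as)

    tensorWeight : Tensor k n → List (Item n (k ∸ 1)) → Carrier
    tensorWeight T = weight λ (i , γ) → T i γ

    -- Each row operator chooses the remaining indices of one entry, contributing the entry as
    -- weight and its arcs as derivatives. The coefficients G of p stay abstract because p will
    -- itself be the result of the operators of other rows.
    ⟦rowOperators⟧ : ∀ (T : Tensor k n) {p} {G : List (Arc n) → Carrier} → (∀ as → ⟦ p ⟧ as ≈ G as) → ∀ is as →
      ⟦ List.foldr (rowOperator k T) p is ⟧ as ≈ ∑ (words n (k ∸ 1) is) λ w → tensorWeight T w *# G (push* w as)
    ⟦rowOperators⟧ T h [] as = ≈-trans (h as) (≈-sym (≈-trans (+-identityʳ _) (*-identityˡ _)))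
    ⟦rowOperators⟧ {n} T {p} {G} h (i ∷ is) as = begin
      ⟦ rowOperator k T i q ⟧ as
        ≈⟨ ⟦∑⟧ Γ _ as ⟩
      ∑ Γ (λ γ → ⟦ con (T i γ) :* ∂* i γ q ⟧ as)
        ≈⟨ ∑-cong Γ (λ γ → ≈-trans (⟦con*⟧ (T i γ) (∂* i γ q) as) (*-congˡ (≈-trans
             (reflexive (⟦∂*⟧ i γ q as)) (⟦rowOperators⟧ T h is (push i γ as))))) ⟩
      ∑ Γ (λ γ → T i γ *# ∑ (words n (k ∸ 1) is) λ w → tensorWeight T w *# G (push* w (push i γ as)))
        ≈⟨ ∑-cong Γ (λ γ → ≈-trans (*-distribˡ-∑ _ (words n (k ∸ 1) is) _)
             (∑-cong (words n (k ∸ 1) is) λ w → ≈-sym (*-assoc _ _ _))) ⟩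
      ∑ Γ (λ γ → ∑ (words n (k ∸ 1) is) λ w → tensorWeight T ((i , γ) ∷ w) *# G (push* ((i , γ) ∷ w) as))
        ≈⟨ ∑-words-∷ (k ∸ 1) i is _ ⟨
      ∑ (words n (k ∸ 1) (i ∷ is)) (λ w → tensorWeight T w *# G (push* w as)) ∎
      where
      Γ = vecs (allFin n) (k ∸ 1)
      q = List.foldr (rowOperator k T) p is

    module _ (T : Tensor k n) (ds : Vec ℕ n) where

      factor : Fin n → Carrier
      factor i = 1/ (lookup ds i * (k ∸ 1)) !

      coefficient : Carrier
      coefficient = weight factor (allFin n)

      private
        apply : Fin n → Poly n → Poly n
        apply i q = con (factor i) :* fold q (rowOperator k T i) (lookup ds i)

        block : Fin n → List (Fin n)
        block i = List.replicate (lookup ds i) i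

        fold-replicate : ∀ i q m → fold q (rowOperator k T i) m ≡ List.foldr (rowOperator k T) q (List.replicate m i)
        fold-replicate i q zero    = refl
        fold-replicate i q (suc m) = cong (rowOperator k T i) (fold-replicate i q m)

        ⟦apply⟧ : ∀ p is as → ⟦ List.foldr apply p is ⟧ as ≈
          weight factor is *# ∑ (words n (k ∸ 1) (concatMap block is)) λ w → tensorWeight T w *# ⟦ p ⟧ (push* w as)
        ⟦apply⟧ p [] as = ≈-sym (≈-trans (*-identityˡ _) (≈-trans (+-identityʳ _) (*-identityˡ _)))
        ⟦apply⟧ p (i ∷ is) as = begin
          ⟦ con (factor i) :* fold q (rowOperator k T i) (lookup ds i) ⟧ as
            ≈⟨ ⟦con*⟧ (factor i) _ as ⟩
          factor i *# ⟦ fold q (rowOperator k T i) (lookup ds i) ⟧ as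
            ≡⟨ cong (λ q → factor i *# ⟦ q ⟧ as) (fold-replicate i q (lookup ds i)) ⟩
          factor i *# ⟦ List.foldr (rowOperator k T) q (block i) ⟧ as
            ≈⟨ *-congˡ (⟦rowOperators⟧ T (⟦apply⟧ p is) (block i) as) ⟩
          factor i *# ∑ (words n (k ∸ 1) (block i)) (λ u → tensorWeight T u *# (C *# ∑ Ws λ w →
            tensorWeight T w *# ⟦ p ⟧ (push* w (push* u as))))
            ≈⟨ *-congˡ (∑-cong (words n (k ∸ 1) (block i)) λ u → ≈-trans (x*yz≈y*xz _ _ _)
                 (*-congˡ (≈-trans (*-distribˡ-∑ _ Ws _) (∑-cong Ws λ w → merge u w)))) ⟩
          factor i *# ∑ (words n (k ∸ 1) (block i)) (λ u → C *# ∑ Ws λ w →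
            tensorWeight T (u ++ w) *# ⟦ p ⟧ (push* (u ++ w) as))
            ≈⟨ *-congˡ (≈-trans (≈-sym (*-distribˡ-∑ C (words n (k ∸ 1) (block i)) _))
                 (*-congˡ (≈-sym (∑-words-++ (k ∸ 1) (block i) (concatMap block is) _)))) ⟩
          factor i *# (C *# ∑ (words n (k ∸ 1) (block i ++ concatMap block is)) (λ w → tensorWeight T w *# ⟦ p ⟧ (push* w as)))
            ≈⟨ *-assoc _ _ _ ⟨
          factor i *# C *# ∑ (words n (k ∸ 1) (concatMap block (i ∷ is))) (λ w → tensorWeight T w *# ⟦ p ⟧ (push* w as)) ∎
          where
          q = List.foldr apply p is
          C = weight factor is
          Ws = words n (k ∸ 1) (concatMap block is)
          merge : ∀ u w → tensorWeight T u *# (tensorWeight T w *# ⟦ p ⟧ (push* w (push* u as))) ≈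
            tensorWeight T (u ++ w) *# ⟦ p ⟧ (push* (u ++ w) as)
          merge u w = ≈-trans (≈-sym (*-assoc _ _ _)) (*-cong (≈-sym (weight-++ _ u w))
            (reflexive (cong ⟦ p ⟧ (≡.sym (push*-++ u w as)))))

      operator-expansion : ∀ s → constantTerm (operator k T ds (trPower n s)) ≈
        coefficient *# ∑ (words n (k ∸ 1) (sources ds)) λ w → tensorWeight T w *# closedWalks s (arcs* w)
      operator-expansion s = ≈-trans (⟦apply⟧ (trPower n s) (allFin n) [])
        (*-congˡ (∑-cong (words n (k ∸ 1) (sources ds)) λ w → *-congˡ (≈-trans (⟦trPower⟧ s (push* w []))
          (closedWalks-↭ s (↭-trans (push*-↭ w []) (↭-reflexive (List.++-identityʳ _)))))))

    traceSum : ∀ n → ℕ → (List (Item n (k ∸ 1)) → Carrier) → Carrier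
    traceSum n t G = ∑ (compositions n t) λ ds →
      weight (λ i → 1/ (lookup ds i * (k ∸ 1)) !) (allFin n) *# ∑ (words n (k ∸ 1) (sources ds)) G

    -- The factor in front of the sum in `Tr` is left out: it is positive and depends only on k and
    -- n, so it cannot influence a comparison.
    trace : ∀ {n} → ℕ → Tensor k n → Carrier
    trace {n} t T = traceSum n t λ w → tensorWeight T w *# closedWalks (t * (k ∸ 1)) (arcs* w)

    Tr-expansion : ∀ t (T : Tensor k n) → Tr k (suc t) T ≈ fromℕ ((k ∸ 1) ^ (n ∸ 1)) *# trace (suc t) T
    Tr-expansion {n} t T = *-congˡ (∑-cong (compositions n (suc t)) λ ds → operator-expansion T ds (suc t * (k ∸ 1)))

-- Relabelling the vertices

unique-↭ : ∀ {a} {A : Set a} {xs ys : List A} → Unique xs → Unique ys →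
  (∀ {x} → x ∈ₗ xs → x ∈ₗ ys) → (∀ {x} → x ∈ₗ ys → x ∈ₗ xs) → xs ↭ ys
unique-↭ u v f g = ∼bag⇒↭ (unique∧set⇒bag u v (mk⇔ f g))

concatMap-↭ : ∀ {a b} {A : Set a} {B : Set b} (f : A → List B) {xs ys} → xs ↭ ys → concatMap f xs ↭ concatMap f ys
concatMap-↭ f ↭.refl        = ↭-refl
concatMap-↭ f (prep x p)    = ↭.++⁺ˡ (f x) (concatMap-↭ f p)
concatMap-↭ f (swap x y p)  = ↭-trans (↭.shifts (f x) (f y)) (↭.++⁺ˡ (f y) (↭.++⁺ˡ (f x) (concatMap-↭ f p)))
concatMap-↭ f (↭.trans p q) = ↭-trans (concatMap-↭ f p) (concatMap-↭ f q)

∈-compositions⁺ : ∀ (ds : Vec ℕ n) → ds ∈ₗ compositions n (Vec.sum ds)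
∈-compositions⁺ []       = here refl
∈-compositions⁺ (d ∷ ds) = ∈-concatMap⁺ _ (Any.map (λ { refl → ∈-map⁺ (d ∷_)
  (subst (λ t → ds ∈ₗ compositions _ t) (≡.sym (ℕ.m+n∸m≡n d (Vec.sum ds))) (∈-compositions⁺ ds)) })
  (∈-upTo⁺ (s≤s (ℕ.m≤m+n d (Vec.sum ds)))))

∈-compositions⁻ : ∀ n t {ds : Vec ℕ n} → ds ∈ₗ compositions n t → Vec.sum ds ≡ t
∈-compositions⁻ zero    zero    (here refl) = refl
∈-compositions⁻ (suc n) t ds∈
  with d , d∈ , ds∈′ ← find (∈-concatMap⁻ _ {xs = upTo (suc t)} ds∈)
  with ds , ds∈″ , refl ← ∈-map⁻ _ ds∈′ =
  ≡.trans (cong (d +_) (∈-compositions⁻ n (t ∸ d) ds∈″)) (ℕ.m+[n∸m]≡n (ℕ.≤-pred (∈-upTo⁻ d∈)))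

compositions-unique : ∀ n t → Unique (compositions n t)
compositions-unique zero    zero    = [] ∷ []
compositions-unique zero    (suc t) = []
compositions-unique (suc n) t       = Unique.concat⁺
  (All.map⁺ (All.tabulate λ {d} _ → Unique.map⁺ (λ where refl → refl) (compositions-unique n (t ∸ d))))
  (AllPairs.map⁺ (AllPairs.map disjoint (Unique.upTo⁺ (suc t))))
  where
  disjoint : ∀ {d e} → d ≢ e → ∀ {ds} →
    ¬ (ds ∈ₗ List.map (d ∷_) (compositions n (t ∸ d)) × ds ∈ₗ List.map (e ∷_) (compositions n (t ∸ e)))
  disjoint d≢e (p , q) with _ , _ , refl ← ∈-map⁻ _ p | _ , _ , refl ← ∈-map⁻ _ q = d≢e refl

vecSum : ∀ (ds : Vec ℕ n) → Vec.sum ds ≡ sum (List.map (lookup ds) (allFin n))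
vecSum []       = refl
vecSum (d ∷ ds) = cong (d +_) (≡.trans (vecSum ds) (cong sum
  (≡.trans (List.map-tabulate id (lookup ds)) (≡.sym (List.map-tabulate suc (lookup (d ∷ ds)))))))

module _ (σ : Permutation′ n) where

  private
    φ : Fin n → Fin n
    φ = σ ⟨$⟩ʳ_

  permuted-injective : ∀ {u v} → φ u ≡ φ v → u ≡ v
  permuted-injective eq = ≡.trans (≡.sym (inverseˡ σ)) (≡.trans (cong (σ ⟨$⟩ˡ_) eq) (inverseˡ σ))

  allFin-permuted : List.map φ (allFin n) ↭ allFin n
  allFin-permuted = unique-↭ (Unique.map⁺ permuted-injective (allFin⁺ n)) (allFin⁺ n)
    (λ {x} _ → ∈-allFin x)
    (λ {x} _ → subst (_∈ₗ List.map φ (allFin n)) (inverseʳ σ) (∈-map⁺ φ (∈-allFin (σ ⟨$⟩ˡ x))))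

  permuteVec : Vec ℕ n → Vec ℕ n
  permuteVec ds = tabulate λ i → lookup ds (σ ⟨$⟩ˡ i)

  lookup-permuteVec : ∀ ds i → lookup (permuteVec ds) (φ i) ≡ lookup ds i
  lookup-permuteVec ds i = ≡.trans (Vec.lookup∘tabulate _ (φ i)) (cong (lookup ds) (inverseˡ σ))

  sum-permuteVec : ∀ ds → Vec.sum (permuteVec ds) ≡ Vec.sum ds
  sum-permuteVec ds = ≡.trans (vecSum (permuteVec ds)) (≡.trans
    (≡.sym (sum-↭ (↭.map⁺ (lookup (permuteVec ds)) allFin-permuted)))
    (≡.trans (cong sum (≡.trans (≡.sym (List.map-∘ (allFin n))) (List.map-cong (lookup-permuteVec ds) (allFin n))))
    (≡.sym (vecSum ds))))

  permuteVec-injective : ∀ {ds es} → permuteVec ds ≡ permuteVec es → ds ≡ es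
  permuteVec-injective {ds} {es} eq = ≡.trans (≡.sym (Vec.tabulate∘lookup ds)) (≡.trans
    (Vec.tabulate-cong λ i → ≡.trans (≡.sym (lookup-permuteVec ds i))
      (≡.trans (cong (λ v → lookup v (φ i)) eq) (lookup-permuteVec es i)))
    (Vec.tabulate∘lookup es))

  sources-permuteVec : ∀ ds → List.map φ (sources ds) ↭ sources (permuteVec ds)
  sources-permuteVec ds = ↭-trans (↭-reflexive (≡.trans
    (List.map-concatMap φ (block ds) (allFin n))
    (≡.trans (List.concatMap-cong block-permuted (allFin n)) (≡.sym (List.concatMap-map (block (permuteVec ds)) φ (allFin n))))))
    (concatMap-↭ (block (permuteVec ds)) allFin-permuted)
    where
    block : Vec ℕ n → Fin n → List (Fin n)
    block ds i = List.replicate (lookup ds i) i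
    block-permuted : ∀ i → List.map φ (block ds i) ≡ block (permuteVec ds) (φ i)
    block-permuted i = ≡.trans (List.map-replicate φ (lookup ds i) i)
      (cong (λ d → List.replicate d (φ i)) (≡.sym (lookup-permuteVec ds i)))

  compositions-permuted : ∀ t → List.map permuteVec (compositions n t) ↭ compositions n t
  compositions-permuted t = unique-↭ (Unique.map⁺ permuteVec-injective (compositions-unique n t)) (compositions-unique n t)
    (λ ds∈ → forward ds∈)
    (λ {ds} ds∈ → subst (_∈ₗ _) (back ds) (∈-map⁺ permuteVec
      (subst (λ s → original ds ∈ₗ compositions n s)
        (≡.trans (≡.sym (sum-permuteVec (original ds))) (≡.trans (cong Vec.sum (back ds)) (∈-compositions⁻ n t ds∈)))
        (∈-compositions⁺ (original ds)))))
    where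
    forward : ∀ {ds} → ds ∈ₗ List.map permuteVec (compositions n t) → ds ∈ₗ compositions n t
    forward ds∈ with ds , ds∈′ , refl ← ∈-map⁻ _ ds∈ =
      subst (λ s → permuteVec ds ∈ₗ compositions n s)
        (≡.trans (sum-permuteVec ds) (∈-compositions⁻ n t ds∈′)) (∈-compositions⁺ (permuteVec ds))
    original : Vec ℕ n → Vec ℕ n
    original ds = tabulate (lookup ds ∘ φ)
    back : ∀ ds → permuteVec (original ds) ≡ ds
    back ds = ≡.trans (Vec.tabulate-cong λ i → ≡.trans (Vec.lookup∘tabulate _ (σ ⟨$⟩ˡ i)) (cong (lookup ds) (inverseʳ σ)))
      (Vec.tabulate∘lookup ds)

  permuteItem : Item n m → Item n m
  permuteItem (i , γ) = φ i , Vec.map φ γ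

  arcs*-permuted : ∀ (w : List (Item n m)) →
    arcs* (List.map permuteItem w) ≡ List.map (λ (u , v) → φ u , φ v) (arcs* w)
  arcs*-permuted w = ≡.trans (List.concatMap-map arcs permuteItem w)
    (≡.trans (List.concatMap-cong arcs-permuted w) (≡.sym (List.map-concatMap _ arcs w)))
    where
    arcs-permuted : ∀ x → arcs (permuteItem x) ≡ List.map (λ (u , v) → φ u , φ v) (arcs x)
    arcs-permuted (i , γ) = ≡.trans (cong (List.map (φ i ,_)) (Vec.toList-map φ γ))
      (≡.trans (≡.sym (List.map-∘ (toList γ))) (List.map-∘ (toList γ)))

module Relabelling {c ℓ₁ ℓ₂ ℓ₃} (F : OrderedField c ℓ₁ ℓ₂ ℓ₃) where
  open OrderedField F
    hiding (_-_)
    renaming (_+_ to _+#_; _*_ to _*#_; refl to ≈-refl; sym to ≈-sym; trans to ≈-trans)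
  open FieldNumerals F
  open Spectral F
  open FieldLemmas F
  open TraceExpansion F
  open import Algebra.Properties.CommutativeSemigroup
    (CommutativeRing.*-commutativeSemigroup commutativeRing) using () renaming (x∙yz≈y∙xz to x*yz≈y*xz)
  open import Relation.Binary.Reasoning.Setoid setoid

  ∑-vecs : ∀ {a} {A : Set a} (xs : List A) m f →
    ∑ (vecs xs (suc m)) f ≈ ∑ xs λ x → ∑ (vecs xs m) λ v → f (x ∷ v)
  ∑-vecs {A = A} xs m f = go xs
    where
    go : ∀ ys → ∑ (List.cartesianProductWith _∷_ ys (vecs xs m)) f ≈ ∑ ys λ x → ∑ (vecs xs m) λ v → f (x ∷ v)
    go []       = ≈-refl
    go (y ∷ ys) = ≈-trans (∑-++ (List.map (y ∷_) (vecs xs m)) _ f)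
      (+-cong (reflexive (∑-map (y ∷_) (vecs xs m) f)) (go ys))

  ∑-vecs-↭ : ∀ {a} {A : Set a} {xs ys : List A} → xs ↭ ys → ∀ m f → ∑ (vecs xs m) f ≈ ∑ (vecs ys m) f
  ∑-vecs-↭ p zero    f = ≈-refl
  ∑-vecs-↭ {xs = xs} {ys} p (suc m) f = ≈-trans (∑-vecs xs m f) (≈-trans
    (≈-trans (∑-↭ _ p) (∑-cong ys λ y → ∑-vecs-↭ p m _)) (≈-sym (∑-vecs ys m f)))

  ∑-vecs-map : ∀ {a b} {A : Set a} {B : Set b} (h : A → B) xs m f →
    ∑ (vecs (List.map h xs) m) f ≈ ∑ (vecs xs m) (f ∘ Vec.map h)
  ∑-vecs-map h xs zero    f = ≈-refl
  ∑-vecs-map h xs (suc m) f = ≈-trans (∑-vecs (List.map h xs) m f) (≈-trans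
    (≈-trans (reflexive (∑-map h xs _)) (∑-cong xs λ x → ∑-vecs-map h xs m _)) (≈-sym (∑-vecs xs m _)))

  weight-↭ : ∀ {a} {A : Set a} (f : A → Carrier) {xs ys} → xs ↭ ys → weight f xs ≈ weight f ys
  weight-↭ f ↭.refl        = ≈-refl
  weight-↭ f (prep x p)    = *-congˡ (weight-↭ f p)
  weight-↭ f (swap x y p)  = ≈-trans (x*yz≈y*xz _ _ _) (*-congˡ (*-congˡ (weight-↭ f p)))
  weight-↭ f (↭.trans p q) = ≈-trans (weight-↭ f p) (weight-↭ f q)

  weight-cong : ∀ {a} {A : Set a} {f g : A → Carrier} → (∀ x → f x ≈ g x) → ∀ xs → weight f xs ≈ weight g xs
  weight-cong h []       = ≈-refl
  weight-cong h (x ∷ xs) = *-cong (h x) (weight-cong h xs)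

  weight-map : ∀ {a b} {A : Set a} {B : Set b} (h : A → B) (f : B → Carrier) xs →
    weight f (List.map h xs) ≡ weight (f ∘ h) xs
  weight-map h f []       = refl
  weight-map h f (x ∷ xs) = cong (f (h x) *#_) (weight-map h f xs)

  -- Words are enumerated with their sources in increasing order, and a relabelling destroys that
  -- order. A summand insensitive to the order of a word does not notice.
  Symmetric : ∀ {a} {A : Set a} → (List A → Carrier) → Set _
  Symmetric G = ∀ {u w} → u ↭ w → G u ≈ G w

  ∑-words-↭ : ∀ m {is js : List (Fin n)} → is ↭ js → ∀ {G} → Symmetric G → ∑ (words n m is) G ≈ ∑ (words n m js) G
  ∑-words-↭ m ↭.refl sym = ≈-refl
  ∑-words-↭ {n} m {_ ∷ is} {_ ∷ js} (prep i p) sym = ≈-trans (∑-words-∷ m i is _) (≈-trans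
    (∑-cong (vecs (allFin n) m) λ γ → ∑-words-↭ m p λ q → sym (prep _ q)) (≈-sym (∑-words-∷ m i js _)))
  ∑-words-↭ {n} m {_ ∷ _ ∷ is} {_ ∷ _ ∷ js} (swap i j p) {G} sym = begin
    ∑ (words n m (i ∷ j ∷ is)) G
      ≈⟨ ≈-trans (∑-words-∷ m i (j ∷ is) G) (∑-cong Γ λ γ → ∑-words-∷ m j is _) ⟩
    ∑ Γ (λ γ → ∑ Γ λ δ → ∑ (words n m is) λ w → G ((i , γ) ∷ (j , δ) ∷ w))
      ≈⟨ ∑-swap Γ Γ _ ⟩
    ∑ Γ (λ δ → ∑ Γ λ γ → ∑ (words n m is) λ w → G ((i , γ) ∷ (j , δ) ∷ w))
      ≈⟨ ∑-cong Γ (λ δ → ∑-cong Γ λ γ → ≈-trans (∑-cong (words n m is) λ w → sym (swap _ _ ↭-refl))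
           (∑-words-↭ m p λ q → sym (prep _ (prep _ q)))) ⟩
    ∑ Γ (λ δ → ∑ Γ λ γ → ∑ (words n m js) λ w → G ((j , δ) ∷ (i , γ) ∷ w))
      ≈⟨ ≈-trans (∑-words-∷ m j (i ∷ js) G) (∑-cong Γ λ γ → ∑-words-∷ m i js _) ⟨
    ∑ (words n m (j ∷ i ∷ js)) G ∎
    where
    Γ = vecs (allFin n) m
  ∑-words-↭ m (↭.trans p q) sym = ≈-trans (∑-words-↭ m p sym) (∑-words-↭ m q sym)

  module _ (k : ℕ) (σ : Permutation′ n) where

    private
      φ : Fin n → Fin n
      φ = σ ⟨$⟩ʳ_

    ∑-words-permuted : ∀ m is G → ∑ (words n m (List.map φ is)) G ≈ ∑ (words n m is) (G ∘ List.map (permuteItem σ))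
    ∑-words-permuted m []       G = ≈-refl
    ∑-words-permuted m (i ∷ is) G = begin
      ∑ (words n m (φ i ∷ List.map φ is)) G
        ≈⟨ ∑-words-∷ m (φ i) (List.map φ is) G ⟩
      ∑ (vecs (allFin n) m) (λ γ → ∑ (words n m (List.map φ is)) λ w → G ((φ i , γ) ∷ w))
        ≈⟨ ∑-cong (vecs (allFin n) m) (λ γ → ∑-words-permuted m is _) ⟩
      ∑ (vecs (allFin n) m) (λ γ → ∑ (words n m is) λ w → G ((φ i , γ) ∷ List.map (permuteItem σ) w))
        ≈⟨ ∑-vecs-↭ (allFin-permuted σ) m _ ⟨
      ∑ (vecs (List.map φ (allFin n)) m) (λ γ → ∑ (words n m is) λ w → G ((φ i , γ) ∷ List.map (permuteItem σ) w))
        ≈⟨ ∑-vecs-map φ (allFin n) m _ ⟩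
      ∑ (vecs (allFin n) m) (λ γ → ∑ (words n m is) λ w → G (List.map (permuteItem σ) ((i , γ) ∷ w)))
        ≈⟨ ∑-words-∷ m i is _ ⟨
      ∑ (words n m (i ∷ is)) (G ∘ List.map (permuteItem σ)) ∎

    traceSum-permuted : ∀ t G → Symmetric G → traceSum k n t G ≈ traceSum k n t (G ∘ List.map (permuteItem σ))
    traceSum-permuted t G sym = begin
      ∑ (compositions n t) H
        ≈⟨ ∑-↭ H (compositions-permuted σ t) ⟨
      ∑ (List.map (permuteVec σ) (compositions n t)) H
        ≡⟨ ∑-map (permuteVec σ) (compositions n t) H ⟩
      ∑ (compositions n t) (H ∘ permuteVec σ)
        ≈⟨ ∑-cong (compositions n t) (λ ds → *-cong (coefficient-permuted ds) (≈-trans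
             (≈-sym (∑-words-↭ (k ∸ 1) (sources-permuteVec σ ds) sym)) (∑-words-permuted (k ∸ 1) (sources ds) G))) ⟩
      traceSum k n t (G ∘ List.map (permuteItem σ)) ∎
      where
      factors : Vec ℕ n → Fin n → Carrier
      factors ds i = 1/ (lookup ds i * (k ∸ 1)) !
      H : Vec ℕ n → Carrier
      H ds = weight (factors ds) (allFin n) *# ∑ (words n (k ∸ 1) (sources ds)) G
      coefficient-permuted : ∀ ds → weight (factors (permuteVec σ ds)) (allFin n) ≈ weight (factors ds) (allFin n)
      coefficient-permuted ds = ≈-trans (≈-sym (weight-↭ _ (allFin-permuted σ)))
        (≈-trans (reflexive (weight-map φ _ (allFin n)))
        (weight-cong (λ i → reflexive (cong (λ d → 1/ (d * (k ∸ 1)) !) (lookup-permuteVec σ ds i))) (allFin n)))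

    traceSum-cong : ∀ t {G H} → (∀ w → G w ≈ H w) → traceSum k n t G ≈ traceSum k n t H
    traceSum-cong t h = ∑-cong (compositions n t) λ ds → *-congˡ (∑-cong (words n (k ∸ 1) (sources ds)) h)

    closedWalks-permuted : ∀ s as → closedWalks s (List.map (λ (u , v) → φ u , φ v) as) ≈ closedWalks s as
    closedWalks-permuted s as = ≈-trans (≈-sym (∑-↭ _ (allFin-permuted σ)))
      (≈-trans (reflexive (∑-map φ (allFin n) _))
      (∑-cong (allFin n) λ i → walks-map φ (permuted-injective σ) s i i as))

    -- A relabelling permutes the compositions as well as the words of each composition, and it
    -- preserves the number of closed walks; thus isomorphic tensors have equal traces.
    trace-permuted : ∀ t {T U : Tensor k n} → (∀ i γ → T (φ i) (Vec.map φ γ) ≈ U i γ) → trace k t T ≈ trace k t U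
    trace-permuted t {T} {U} h = ≈-trans
      (traceSum-permuted t _ λ p → *-cong (weight-↭ _ p) (closedWalks-↭ (t * (k ∸ 1)) (concatMap-↭ arcs p)))
      (traceSum-cong t λ w → *-cong
        (≈-trans (reflexive (weight-map (permuteItem σ) _ w)) (weight-cong (λ (i , γ) → h i γ) w))
        (≈-trans (reflexive (cong (closedWalks (t * (k ∸ 1))) (arcs*-permuted σ w))) (closedWalks-permuted (t * (k ∸ 1)) (arcs* w))))

-- Words coloured by the parts of a tensor

data Colour : Set where
  chain host pendant : Colour

isHost isPendant isChain : Colour → Bool
isHost host = true
isHost _    = false
isPendant pendant = true
isPendant _       = false
isChain chain = true
isChain _     = false

colours : List Colour
colours = chain ∷ host ∷ pendant ∷ []

∈-colours : ∀ c → c ∈ₗ colours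
∈-colours chain   = here refl
∈-colours host    = there (here refl)
∈-colours pendant = there (there (here refl))

only : ∀ {a} {A : Set a} → (Colour → Bool) → List (A × Colour) → Bool
only p = all (p ∘ proj₂)

only-chain : ∀ {a} {A : Set a} (cw : List (A × Colour)) →
  only isChain cw ≡ only (not ∘ isHost) cw ∧ only (not ∘ isPendant) cw
only-chain []                   = refl
only-chain ((_ , chain)   ∷ cw) = only-chain cw
only-chain ((_ , host)    ∷ cw) = refl
only-chain ((_ , pendant) ∷ cw) = ≡.sym (∧-zeroʳ _)

Uses : ∀ {a} {A : Set a} → Colour → List (A × Colour) → Set a
Uses c = Any λ (_ , c′) → c′ ≡ c

not-only⇒uses : ∀ {a} {A : Set a} {p} {c} → (∀ c′ → p c′ ≡ true → c′ ≡ c) → (cw : List (A × Colour)) →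
  only (not ∘ p) cw ≡ false → Uses c cw
not-only⇒uses {p = p} h ((_ , c′) ∷ cw) eq with p c′ in pc′
... | true  = here (h c′ pc′)
... | false = there (not-only⇒uses h cw eq)

uses⇒not-only : ∀ {a} {A : Set a} {p} {c} → p c ≡ true → {cw : List (A × Colour)} →
  Uses c cw → only (not ∘ p) cw ≡ false
uses⇒not-only {p = p} pc (here refl) rewrite pc = refl
uses⇒not-only {p = p} pc (there u) rewrite uses⇒not-only {p = p} pc u = ∧-zeroʳ _

colourings : ∀ {a} {A : Set a} → List A → List (List (A × Colour))
colourings []       = [] ∷ []
colourings (x ∷ xs) = concatMap (λ c → List.map ((x , c) ∷_) (colourings xs)) colours

∈-colourings : ∀ {a} {A : Set a} (cw : List (A × Colour)) → cw ∈ₗ colourings (List.map proj₁ cw)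
∈-colourings []             = here refl
∈-colourings ((x , c) ∷ cw) = ∈-concatMap⁺ (λ c → List.map ((x , c) ∷_) (colourings (List.map proj₁ cw))) (Any.map
  (λ { refl → ∈-map⁺ ((x , c) ∷_) (∈-colourings cw) }) (∈-colours c))

∈-colourings⁻ : ∀ {a} {A : Set a} (xs : List A) {cw} → cw ∈ₗ colourings xs → List.map proj₁ cw ≡ xs
∈-colourings⁻ []       (here refl) = refl
∈-colourings⁻ (x ∷ xs) cw∈
  with c , _ , cw∈′ ← find (∈-concatMap⁻ (λ c → List.map ((x , c) ∷_) (colourings xs)) {xs = colours} cw∈)
  with _ , cw∈″ , refl ← ∈-map⁻ _ cw∈′ = cong (x ∷_) (∈-colourings⁻ xs cw∈″)

∈-vecs : ∀ {a} {A : Set a} {xs : List A} → (∀ x → x ∈ₗ xs) → (v : Vec A m) → v ∈ₗ vecs xs m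
∈-vecs full []      = here refl
∈-vecs full (x ∷ v) = ∈-cartesianProductWith⁺ _∷_ (full x) (∈-vecs full v)

∈-words : (w : List (Item n m)) → w ∈ₗ words n m (List.map proj₁ w)
∈-words []            = here refl
∈-words ((i , γ) ∷ w) = ∈-concatMap⁺ _ (Any.map
  (λ { refl → ∈-map⁺ ((i , γ) ∷_) (∈-words w) }) (∈-vecs ∈-allFin γ))

∈-words⁻ : ∀ is {w : List (Item n m)} → w ∈ₗ words n m is → List.map proj₁ w ≡ is
∈-words⁻ []       (here refl) = refl
∈-words⁻ {n} {m} (i ∷ is) w∈
  with γ , _ , w∈′ ← find (∈-concatMap⁻ (λ γ → List.map ((i , γ) ∷_) (words n m is)) {xs = vecs (allFin n) m} w∈)
  with _ , w∈″ , refl ← ∈-map⁻ _ w∈′ = cong (i ∷_) (∈-words⁻ is w∈″)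

length-sources : ∀ (ds : Vec ℕ n) → length (sources ds) ≡ Vec.sum ds
length-sources {n} ds = ≡.trans (go (allFin n)) (≡.sym (vecSum ds))
  where
  go : ∀ is → length (concatMap (λ i → List.replicate (lookup ds i) i) is) ≡ sum (List.map (lookup ds) is)
  go []       = refl
  go (i ∷ is) = ≡.trans (List.length-++ (List.replicate (lookup ds i) i))
    (cong₂ _+_ (List.length-replicate (lookup ds i)) (go is))

sources-suc : ∀ (ds : Vec ℕ n) i → sources (Vec.updateAt ds i suc) ↭ i ∷ sources ds
sources-suc {n} ds i = go (allFin n) (allFin⁺ n) (∈-allFin i)
  where
  block : Vec ℕ n → Fin n → List (Fin n)
  block ds j = List.replicate (lookup ds j) j
  ds⁺ = Vec.updateAt ds i suc
  same : ∀ is → All (i ≢_) is → concatMap (block ds⁺) is ≡ concatMap (block ds) is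
  same []       []          = refl
  same (j ∷ is) (i≢j ∷ i∉) = cong₂ _++_
    (cong (λ d → List.replicate d j) (Vec.lookup∘updateAt′ j i (i≢j ∘ ≡.sym) ds)) (same is i∉)
  go : ∀ is → Unique is → i ∈ₗ is → concatMap (block ds⁺) is ↭ i ∷ concatMap (block ds) is
  go (j ∷ is) (i∉ ∷ u) (here refl) = ↭-reflexive
    (cong₂ _++_ (cong (λ d → List.replicate d i) (Vec.lookup∘updateAt i ds)) (same is i∉))
  go (j ∷ is) (j∉ ∷ u) (there i∈) = ↭-trans
    (↭.++⁺ (↭-reflexive (cong (λ d → List.replicate d j)
       (Vec.lookup∘updateAt′ j i (λ { refl → All.lookup j∉ i∈ refl }) ds))) (go is u i∈))
    (↭.shift i (block ds j) (concatMap (block ds) is))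

sort-sources : ∀ (is : List (Fin n)) → ∃[ ds ] is ↭ sources ds
sort-sources {n} [] = Vec.replicate n 0 , ↭-reflexive (≡.sym (go (allFin n)))
  where
  go : ∀ is → concatMap (λ i → List.replicate (lookup (Vec.replicate n 0) i) i) is ≡ []
  go []       = refl
  go (i ∷ is) rewrite Vec.lookup-replicate {n = n} i 0 = go is
sort-sources (i ∷ is) with ds , p ← sort-sources is =
  Vec.updateAt ds i suc , ↭-trans (prep i p) (↭-sym (sources-suc ds i))

module ColouredTraces {c ℓ₁ ℓ₂ ℓ₃} (F : OrderedField c ℓ₁ ℓ₂ ℓ₃) where
  open OrderedField F
    hiding (_-_)
    renaming (_+_ to _+#_; _*_ to _*#_; refl to ≈-refl; sym to ≈-sym; trans to ≈-trans)
  open FieldNumerals F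
  open Spectral F
  open FieldLemmas F
  open TraceExpansion F
  open Relabelling F
  open import Relation.Binary.Reasoning.Setoid setoid

  ∑-*-distribʳ : ∀ {a} {A : Set a} (xs : List A) (f : A → Carrier) b → ∑ xs f *# b ≈ ∑ xs (λ x → f x *# b)
  ∑-*-distribʳ xs f b = ≈-trans (*-comm _ b) (≈-trans (*-distribˡ-∑ b xs f) (∑-cong xs λ x → *-comm b _))

  when-∧-* : ∀ b b′ {x y} → when (b ∧ b′) (x *# y) ≈ when b x *# when b′ y
  when-∧-* true  true  = ≈-refl
  when-∧-* true  false = ≈-sym (zeroʳ _)
  when-∧-* false b′    = ≈-sym (zeroˡ _)

  -- To be read with b for the absence of host entries and b′ for the absence of pendant entries;
  -- the last term keeps the words that use both.
  inclusion-exclusion : ∀ b b′ x → when true x +# when (b ∧ b′) x ≈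
    (when b x +# when b′ x) +# when (not b ∧ not b′) x
  inclusion-exclusion true  true  x = ≈-sym (+-identityʳ _)
  inclusion-exclusion true  false x = ≈-sym (+-identityʳ _)
  inclusion-exclusion false true  x = ≈-trans (+-comm x 0#) (≈-sym (+-identityʳ _))
  inclusion-exclusion false false x = ≈-trans (+-comm x 0#) (+-congʳ (≈-sym (+-identityˡ 0#)))

  weight-nonneg : ∀ {a} {A : Set a} {f : A → Carrier} → (∀ x → Nonneg (f x)) → ∀ xs → Nonneg (weight f xs)
  weight-nonneg h []       = inj₂ 0<1
  weight-nonneg h (x ∷ xs) = *-nonneg (h x) (weight-nonneg h xs)

  weight-pos : ∀ {a} {A : Set a} {f : A → Carrier} {xs} → All (λ x → 0# < f x) xs → 0# < weight f xs
  weight-pos []       = 0<1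
  weight-pos (p ∷ ps) = *-pos p (weight-pos ps)

  weight-pos⁻¹ : ∀ {a} {A : Set a} {f : A → Carrier} → (∀ x → Nonneg (f x)) → ∀ xs →
    0# < weight f xs → All (λ x → 0# < f x) xs
  weight-pos⁻¹ h []       p = []
  weight-pos⁻¹ h (x ∷ xs) p with q , qs ← *-pos⁻¹ (h x) (weight-nonneg h xs) p = q ∷ weight-pos⁻¹ h xs qs

  when-pos⁻¹ : ∀ b {x} → 0# < when b x → b ≡ true × 0# < x
  when-pos⁻¹ true  p = refl , p
  when-pos⁻¹ false p = ⊥-elim (0≮0 ≈-refl p)

  traceSum-+ : ∀ k n t G H → traceSum k n t G +# traceSum k n t H ≈ traceSum k n t (λ w → G w +# H w)
  traceSum-+ k n t G H = ≈-sym (≈-trans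
    (∑-cong (compositions n t) λ ds → ≈-trans (*-congˡ (∑-distrib-+ (words n (k ∸ 1) (sources ds)) G H)) (distribˡ _ _ _))
    (∑-distrib-+ (compositions n t) _ _))

  module Mixed (k : ℕ) {n : ℕ} (part : Colour → Item n (k ∸ 1) → Carrier)
    (part-nonneg : ∀ c x → Nonneg (part c x)) where

    private
      CWord : Set
      CWord = List (Item n (k ∸ 1) × Colour)

      partOf : Item n (k ∸ 1) × Colour → Carrier
      partOf (x , c) = part c x

      length-words : ∀ {t} {ds : Vec ℕ n} → ds ∈ₗ compositions n t → ∀ {w} → w ∈ₗ words n (k ∸ 1) (sources ds) →
        length w ≡ t
      length-words {t} {ds} ds∈ {w} w∈ = ≡.trans (≡.sym (List.length-map proj₁ w))
        (≡.trans (cong length (∈-words⁻ (sources ds) w∈))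
        (≡.trans (length-sources ds) (∈-compositions⁻ n t ds∈)))

    Positive : CWord → Set _
    Positive = All λ (x , c) → 0# < part c x

    restrict : (Colour → Bool) → Item n (k ∸ 1) → Carrier
    restrict p x = ∑ colours λ c → when (p c) (part c x)

    -- The condition says that the colouring uses `host` and uses `pendant`, each expressed as the
    -- failure to avoid the colour. The word itself carries no colours: an entry such as a loop at a
    -- common vertex can receive weight from several parts.
    mixed : List (Item n (k ∸ 1)) → Carrier
    mixed w = ∑ (colourings w) λ cw →
      when (not (only (not ∘ isHost) cw) ∧ not (only (not ∘ isPendant) cw)) (weight partOf cw)

    mixedTrace : ℕ → Carrier
    mixedTrace t = traceSum k n t λ w → mixed w *# closedWalks (t * (k ∸ 1)) (arcs* w)

    restrictedTrace : (Colour → Bool) → ℕ → Carrier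
    restrictedTrace p t = trace k t λ i γ → restrict p (i , γ)

    private
      flag : CWord → Bool
      flag cw = not (only (not ∘ isHost) cw) ∧ not (only (not ∘ isPendant) cw)

      term-nonneg : ∀ cw → Nonneg (when (flag cw) (weight partOf cw))
      term-nonneg cw = when-nonneg (flag cw) (weight-nonneg (λ (x , c) → part-nonneg c x) cw)

    mixed-nonneg : ∀ w → Nonneg (mixed w)
    mixed-nonneg w = ∑-nonneg (colourings w) term-nonneg

    mixed-pos⁻¹ : ∀ w → 0# < mixed w →
      ∃[ cw ] List.map proj₁ cw ≡ w × Positive cw × Uses host cw × Uses pendant cw
    mixed-pos⁻¹ w p
      with cw , cw∈ , q ← ∑-pos⁻¹ (colourings w) term-nonneg p
      with eq , r ← when-pos⁻¹ (flag cw) q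
      with only (not ∘ isHost) cw in eqʰ | only (not ∘ isPendant) cw in eqᵖ
    ... | false | false = cw , ∈-colourings⁻ w cw∈ , weight-pos⁻¹ (λ (x , c) → part-nonneg c x) cw r ,
      not-only⇒uses {p = isHost} (λ { host _ → refl }) cw eqʰ ,
      not-only⇒uses {p = isPendant} (λ { pendant _ → refl }) cw eqᵖ

    mixed-pos : ∀ {cw} → Positive cw → Uses host cw → Uses pendant cw → 0# < mixed (List.map proj₁ cw)
    mixed-pos {cw} pos uʰ uᵖ = ∑-pos (colourings (List.map proj₁ cw)) term-nonneg (∈-colourings cw) term-pos
      where
      term-pos : 0# < when (flag cw) (weight partOf cw)
      term-pos rewrite uses⇒not-only {p = isHost} refl uʰ | uses⇒not-only {p = isPendant} refl uᵖ = weight-pos pos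

    -- Multiplying out a product of sums: a colouring picks one summand in each factor.
    ∑-colourings : ∀ p w → ∑ (colourings w) (λ cw → when (only p cw) (weight partOf cw)) ≈ weight (restrict p) w
    ∑-colourings p []       = +-identityʳ _
    ∑-colourings p (x ∷ xs) = begin
      ∑ (colourings (x ∷ xs)) term
        ≈⟨ ∑-concatMap (λ c → List.map ((x , c) ∷_) (colourings xs)) colours term ⟩
      ∑ colours (λ c → ∑ (List.map ((x , c) ∷_) (colourings xs)) term)
        ≈⟨ ∑-cong colours (λ c → ≈-trans (reflexive (∑-map ((x , c) ∷_) (colourings xs) term))
             (≈-trans (∑-cong (colourings xs) λ cw → when-∧-* (p c) (only p cw) {part c x} {weight partOf cw})
                      (≈-sym (*-distribˡ-∑ (masked c) (colourings xs) term)))) ⟩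
      ∑ colours (λ c → masked c *# ∑ (colourings xs) term)
        ≈⟨ ∑-cong colours (λ c → *-congˡ {masked c} (∑-colourings p xs)) ⟩
      ∑ colours (λ c → masked c *# weight (restrict p) xs)
        ≈⟨ ∑-*-distribʳ colours masked _ ⟨
      restrict p x *# weight (restrict p) xs ∎
      where
      term : CWord → Carrier
      term cw = when (only p cw) (weight partOf cw)
      masked : Colour → Carrier
      masked c = when (p c) (part c x)

    weight-inclusion-exclusion : ∀ w →
      weight (restrict λ _ → true) w +# weight (restrict isChain) w ≈
      (weight (restrict (not ∘ isHost)) w +# weight (restrict (not ∘ isPendant)) w) +# mixed w
    weight-inclusion-exclusion w = begin
      weight (restrict λ _ → true) w +# weight (restrict isChain) w
        ≈⟨ +-cong (∑-colourings (λ _ → true) w) (∑-colourings isChain w) ⟨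
      _ ≈⟨ ∑-distrib-+ (colourings w) _ _ ⟨
      ∑ (colourings w) (λ cw → when (only (λ _ → true) cw) (weight partOf cw) +# when (only isChain cw) (weight partOf cw))
        ≈⟨ ∑-cong (colourings w) (λ cw → ≈-trans
             (+-cong (reflexive (cong (λ b → when b (weight partOf cw)) (only-true cw)))
                     (reflexive (cong (λ b → when b (weight partOf cw)) (only-chain cw))))
             (inclusion-exclusion (only (not ∘ isHost) cw) (only (not ∘ isPendant) cw) _)) ⟩
      ∑ (colourings w) (λ cw → (when (only (not ∘ isHost) cw) (weight partOf cw) +#
        when (only (not ∘ isPendant) cw) (weight partOf cw)) +# when (flag cw) (weight partOf cw))
        ≈⟨ ≈-trans (∑-distrib-+ (colourings w) _ _) (+-congʳ (∑-distrib-+ (colourings w) _ _)) ⟩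
      _ ≈⟨ +-congʳ (+-cong (∑-colourings (not ∘ isHost) w) (∑-colourings (not ∘ isPendant) w)) ⟩
      (weight (restrict (not ∘ isHost)) w +# weight (restrict (not ∘ isPendant)) w) +# mixed w ∎
      where
      only-true : ∀ (cw : CWord) → only (λ _ → true) cw ≡ true
      only-true []       = refl
      only-true (_ ∷ cw) = only-true cw

    -- The trace is not additive in the tensor, but it is additive in the weight function on words,
    -- where inclusion-exclusion holds pointwise.
    trace-inclusion-exclusion : ∀ t →
      restrictedTrace (λ _ → true) t +# restrictedTrace isChain t ≈
      (restrictedTrace (not ∘ isHost) t +# restrictedTrace (not ∘ isPendant) t) +# mixedTrace t
    trace-inclusion-exclusion t = begin
      restrictedTrace (λ _ → true) t +# restrictedTrace isChain t
        ≈⟨ traceSum-+ k n t _ _ ⟩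
      _ ≈⟨ ∑-cong (compositions n t) (λ ds → *-congˡ (∑-cong (words n (k ∸ 1) (sources ds)) λ w →
             ≈-trans (≈-sym (distribʳ _ _ _)) (≈-trans (*-congʳ (weight-inclusion-exclusion w))
             (≈-trans (distribʳ _ _ _) (+-congʳ (distribʳ _ _ _)))))) ⟩
      _ ≈⟨ traceSum-+ k n t _ _ ⟨
      _ ≈⟨ +-congʳ (traceSum-+ k n t _ _) ⟨
      (restrictedTrace (not ∘ isHost) t +# restrictedTrace (not ∘ isPendant) t) +# mixedTrace t ∎

    -- No cancellation has to be controlled: a summand that is not zero has two positive factors,
    -- which yield a coloured word and a closed trail excluded by assumption.
    mixedTrace-zero : ∀ t →
      (∀ cw → length cw ≡ t → Positive cw → Uses host cw → Uses pendant cw →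
        ∀ {i} → ¬ Trail i i (arcs* (List.map proj₁ cw))) →
      mixedTrace t ≈ 0#
    mixedTrace-zero t h = ∑-0 (compositions n t) λ ds ds∈ →
      *-zeroʳ (∑-0 (words n (k ∸ 1) (sources ds)) λ w w∈ → vanish w (length-words ds∈ w∈))
      where
      vanish : ∀ w → length w ≡ t → mixed w *# closedWalks (t * (k ∸ 1)) (arcs* w) ≈ 0#
      vanish w |w|≡t with mixed-nonneg w | closedWalks-nonneg (t * (k ∸ 1)) (arcs* w)
      ... | inj₁ z | _      = *-zeroˡ z
      ... | _      | inj₁ z = *-zeroʳ z
      ... | inj₂ p | inj₂ q
        with cw , refl , pos , uʰ , uᵖ ← mixed-pos⁻¹ w p
        with i , trail ← closedWalks-pos⇒trail (t * (k ∸ 1)) (arcs* w) q =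
        contradiction trail (h cw (≡.trans (≡.sym (List.length-map proj₁ cw)) |w|≡t) pos uʰ uᵖ)

    length-arcs* : ∀ (w : List (Item n (k ∸ 1))) → length (arcs* w) ≡ length w * (k ∸ 1)
    length-arcs* []            = refl
    length-arcs* ((i , γ) ∷ w) = ≡.trans (List.length-++ (arcs (i , γ))) (cong₂ _+_
      (≡.trans (List.length-map (i ,_) (toList γ)) (Vec.length-toList γ)) (length-arcs* w))

    mixedTrace-pos : ∀ {cw} → Positive cw → Uses host cw → Uses pendant cw →
      ∀ {i} → Trail i i (arcs* (List.map proj₁ cw)) → 0# < mixedTrace (length cw)
    mixedTrace-pos {cw} pos uʰ uᵖ (bs , as↭bs , walk)
      -- The given word is replaced by a rearrangement `cu` with sorted sources; its colours and its
      -- trail are carried along. Its term is positive and the others are nonnegative.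
      with ds , p ← sort-sources (List.map (proj₁ ∘ proj₁) cw)
      with cu , eq , cw↭cu ← ↭.↭-map-inv (proj₁ ∘ proj₁) p =
      ∑-pos (compositions n t) ds-nonneg ds∈ (*-pos (weight-pos {xs = allFin n} (All.tabulate λ {i} _ → 1/!-pos (lookup ds i * (k ∸ 1))))
        (∑-pos (words n (k ∸ 1) (sources ds)) w-nonneg u∈
          (*-pos (mixed-pos (↭.All-resp-↭ cw↭cu pos) (↭.Any-resp-↭ cw↭cu uʰ) (↭.Any-resp-↭ cw↭cu uᵖ))
                 (trail⇒closedWalks-pos (bs , ↭-trans (↭-sym (concatMap-↭ arcs (↭.map⁺ proj₁ cw↭cu))) as↭bs , walk)
                   (≡.trans (length-arcs* u) (cong (_* (k ∸ 1))
                     (≡.trans (List.length-map proj₁ cu) (≡.sym (↭.↭-length cw↭cu)))))))))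
      where
      t = length cw
      u = List.map proj₁ cu
      w-nonneg : ∀ w → Nonneg (mixed w *# closedWalks (t * (k ∸ 1)) (arcs* w))
      w-nonneg w = *-nonneg (mixed-nonneg w) (closedWalks-nonneg (t * (k ∸ 1)) (arcs* w))
      ds-nonneg : ∀ ds → Nonneg (weight (λ i → 1/ (lookup ds i * (k ∸ 1)) !) (allFin n) *#
        ∑ (words n (k ∸ 1) (sources ds)) λ w → mixed w *# closedWalks (t * (k ∸ 1)) (arcs* w))
      ds-nonneg ds = *-nonneg (weight-nonneg (λ i → inj₂ (1/!-pos (lookup ds i * (k ∸ 1)))) (allFin n))
        (∑-nonneg (words n (k ∸ 1) (sources ds)) w-nonneg)
      u-sources : List.map proj₁ u ≡ sources ds
      u-sources = ≡.trans (≡.sym (List.map-∘ cu)) (≡.sym eq)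
      u∈ : u ∈ₗ words n (k ∸ 1) (sources ds)
      u∈ = subst (λ is → u ∈ₗ words n (k ∸ 1) is) u-sources (∈-words u)
      ds∈ : ds ∈ₗ compositions n t
      ds∈ = subst (λ s → ds ∈ₗ compositions n s) (≡.trans (≡.sym (length-sources ds))
        (≡.trans (cong length eq) (≡.trans (List.length-map _ cu) (≡.sym (↭.↭-length cw↭cu))))) (∈-compositions⁺ ds)

-- Cuts

𝟙 : Bool → ℕ
𝟙 b = if b then 1 else 0

module _ (S : Fin n → Bool) where

  exits entries : List (Arc n) → ℕ
  exits   as = sum (List.map (λ (u , v) → 𝟙 (S u ∧ not (S v))) as)
  entries as = sum (List.map (λ (u , v) → 𝟙 (not (S u) ∧ S v)) as)

  -- Exits minus entries telescopes to the indicator at i minus the indicator at j. Open walks are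
  -- needed for the induction; closed ones then balance exactly.
  walk-balance : ∀ {i j as} → Walk i j as → exits as + 𝟙 (S j) ≡ entries as + 𝟙 (S i)
  walk-balance [] = refl
  walk-balance {i} {j} (_∷_ {as = as} v walk) with S i | S v | walk-balance walk
  ... | true  | true  | eq = eq
  ... | true  | false | eq = ≡.trans (cong suc eq) (≡.trans (cong suc (ℕ.+-identityʳ _)) (ℕ.+-comm 1 (entries as)))
  ... | false | true  | eq = ≡.trans eq (≡.trans (ℕ.+-suc (entries as) 0) refl)
  ... | false | false | eq = eq

  exits-↭ : ∀ {as bs} → as ↭ bs → exits as ≡ exits bs
  exits-↭ p = sum-↭ (↭.map⁺ _ p)

  entries-↭ : ∀ {as bs} → as ↭ bs → entries as ≡ entries bs
  entries-↭ p = sum-↭ (↭.map⁺ _ p)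

  trail-balance : ∀ {i as} → Trail i i as → exits as ≡ entries as
  trail-balance {i} (bs , as↭bs , walk) = ≡.trans (exits-↭ as↭bs)
    (≡.trans (ℕ.+-cancelʳ-≡ (𝟙 (S i)) _ _ (walk-balance walk)) (≡.sym (entries-↭ as↭bs)))

  walk-one-sided : ∀ {i j as} → Walk i j as → exits as ≡ 0 → entries as ≡ 0 → All (λ (u , _) → S u ≡ S i) as
  walk-one-sided [] _ _ = []
  walk-one-sided {i} (v ∷ walk) eq₁ eq₂ with S i in Si | S v in Sv
  ... | true  | true  = Si ∷ All.map (λ e → ≡.trans e Sv) (walk-one-sided walk eq₁ eq₂)
  ... | false | false = Si ∷ All.map (λ e → ≡.trans e Sv) (walk-one-sided walk eq₁ eq₂)

  -- Truncation at 1 makes sums count crossing items instead of crossing arcs, since the goal is a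
  -- bound on the length of the word.
  crossing : Item n m → ℕ
  crossing x = 1 ℕ.⊓ (exits (arcs x) + entries (arcs x))

  -- An item that crosses has a single vertex in S, and its position decides the count: as source it
  -- makes every arc an exit, as target it makes one arc an entry.
  data Thin : Item n m → Set where
    inside-or-outside : ∀ {i} {γ : Vec (Fin n) m} → All (λ v → S v ≡ S i) (toList γ) → Thin (i , γ)
    exit  : ∀ {i} {γ : Vec (Fin n) m} → S i ≡ true → All (λ v → S v ≡ false) (toList γ) → Thin (i , γ)
    entry : ∀ {i} {γ : Vec (Fin n) m} {u us} → S i ≡ false → S u ≡ true → All (λ v → S v ≡ false) us →
      toList γ ↭ u ∷ us → Thin (i , γ)

  private
    exits* entries* : Fin n → List (Fin n) → ℕ
    exits*   i vs = exits (List.map (i ,_) vs)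
    entries* i vs = entries (List.map (i ,_) vs)

    same-side : ∀ i vs → All (λ v → S v ≡ S i) vs → exits* i vs ≡ 0 × entries* i vs ≡ 0
    same-side i []       []       = refl , refl
    same-side i (v ∷ vs) (p ∷ ps) rewrite p with S i | same-side i vs ps
    ... | true  | e = e
    ... | false | e = e

    all-exit : ∀ i vs → S i ≡ true → All (λ v → S v ≡ false) vs → exits* i vs ≡ length vs × entries* i vs ≡ 0
    all-exit i []       Si []       = refl , refl
    all-exit i (v ∷ vs) Si (p ∷ ps) rewrite Si | p with e₁ , e₂ ← all-exit i vs Si ps = cong suc e₁ , e₂

    one-entry : ∀ i u us → S i ≡ false → S u ≡ true → All (λ v → S v ≡ false) us →
      exits* i (u ∷ us) ≡ 0 × entries* i (u ∷ us) ≡ 1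
    one-entry i u us Si Su ps rewrite Si | Su
      with e₁ , e₂ ← same-side i us (All.map (λ e → ≡.trans e (≡.sym Si)) ps) = e₁ , cong suc e₂

  crossing-same-side : (x : Item n m) → All (λ v → S v ≡ S (proj₁ x)) (toList (proj₂ x)) → crossing x ≡ 0
  crossing-same-side (i , γ) ps with e₁ , e₂ ← same-side i (toList γ) ps rewrite e₁ | e₂ = refl

  -- An item with one vertex in S either leaves S along all of its m arcs or
  -- enters it along exactly one of them.
  crossing-counts : 1 ≤ m → (w : List (Item n m)) → All Thin w →
    ∃[ a ] ∃[ b ] sum (List.map crossing w) ≡ a + b × exits (arcs* w) ≡ a * m × entries (arcs* w) ≡ b
  crossing-counts 1≤m [] [] = 0 , 0 , refl , refl , refl
  crossing-counts {m} 1≤m ((i , γ) ∷ w) (t ∷ ts)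
    with a , b , e , e₁ , e₂ ← crossing-counts 1≤m w ts
    rewrite List.map-++ (λ (u , v) → 𝟙 (S u ∧ not (S v))) (arcs (i , γ)) (arcs* w)
          | List.map-++ (λ (u , v) → 𝟙 (not (S u) ∧ S v)) (arcs (i , γ)) (arcs* w)
          | sum-++ (List.map (λ (u , v) → 𝟙 (S u ∧ not (S v))) (arcs (i , γ))) (List.map (λ (u , v) → 𝟙 (S u ∧ not (S v))) (arcs* w))
          | sum-++ (List.map (λ (u , v) → 𝟙 (not (S u) ∧ S v)) (arcs (i , γ))) (List.map (λ (u , v) → 𝟙 (not (S u) ∧ S v)) (arcs* w))
    with t
  ... | inside-or-outside ps with f₁ , f₂ ← same-side i (toList γ) ps rewrite f₁ | f₂ = a , b , e , e₁ , e₂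
  ... | exit Si ps with f₁ , f₂ ← all-exit i (toList γ) Si ps rewrite f₁ | f₂ | Vec.length-toList γ =
    suc a , b , cong₂ _+_ (ℕ.m≤n⇒m⊓n≡m (subst (1 ≤_) (≡.sym (ℕ.+-identityʳ m)) 1≤m)) e , cong (m +_) e₁ , e₂
  ... | entry {u = u} {us} Si Su ps p
    with f₁ , f₂ ← one-entry i u us Si Su ps
    rewrite exits-↭ (↭.map⁺ (i ,_) p) | entries-↭ (↭.map⁺ (i ,_) p) | f₁ | f₂ =
    a , suc b , ≡.trans (cong suc e) (≡.sym (ℕ.+-suc a b)) , e₁ , cong suc e₂

  private
    source : 1 ≤ m → ∀ {P : Fin n → Set} {w : List (Item n m)} → All (P ∘ proj₁) (arcs* w) → All (P ∘ proj₁) w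
    source 1≤m {w = []} ps = []
    source 1≤m@(s≤s _) {w = (i , γ@(_ ∷ _)) ∷ w} ps with p ∷ qs ← ps = p ∷ source 1≤m (All.++⁻ʳ (arcs (i , γ)) ps)

  -- If a items exit and b items enter, balance gives a * m = b, so a * (m + 1) items cross. Here a
  -- is positive: otherwise no arc crosses and the trail stays on one side, although the word has
  -- sources on both sides.
  cut : 1 ≤ m → {w : List (Item n m)} → All Thin w → ∀ {i} → Trail i i (arcs* w) →
    Any (λ (u , _) → S u ≡ true) w → Any (λ (u , _) → S u ≡ false) w → suc m ≤ sum (List.map crossing w)
  cut {m} 1≤m {w} thin {i} trail@(bs , as↭bs , walk) in-S out-S
    with a , b , e , e₁ , e₂ ← crossing-counts 1≤m w thin
    with refl ← ≡.trans (≡.sym e₁) (≡.trans (trail-balance trail) e₂)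
    with a
  ... | suc a = subst (suc m ≤_) (≡.sym e) (s≤s (ℕ.≤-trans (ℕ.m≤m+n m (a * m)) (ℕ.m≤n+m (m + a * m) a)))
  ... | zero  = contradiction (≡.trans (≡.sym true≡) false≡) λ ()
    where
    one-sided : All (λ (u , _) → S u ≡ S i) w
    one-sided = source 1≤m {P = λ u → S u ≡ S i} (↭.All-resp-↭ (↭-sym as↭bs)
      (walk-one-sided walk (≡.trans (≡.sym (exits-↭ as↭bs)) e₁) (≡.trans (≡.sym (entries-↭ as↭bs)) e₂)))
    true≡ : S i ≡ true
    true≡ with _ , p , q ← find in-S = ≡.trans (≡.sym (All.lookup one-sided p)) q
    false≡ : S i ≡ false
    false≡ with _ , p , q ← find out-S = ≡.trans (≡.sym (All.lookup one-sided p)) q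

-- Summation over a family of cuts

sumBelow : ℕ → (ℕ → ℕ) → ℕ
sumBelow zero    f = 0
sumBelow (suc s) f = sumBelow s f + f s

sumBelow-swap : ∀ {a} {A : Set a} s (f : ℕ → A → ℕ) xs →
  sumBelow s (λ j → sum (List.map (f j) xs)) ≡ sum (List.map (λ x → sumBelow s λ j → f j x) xs)
sumBelow-swap zero    f []       = refl
sumBelow-swap zero    f (x ∷ xs) = sumBelow-swap zero f xs
sumBelow-swap (suc s) f xs = ≡.trans (cong (_+ sum (List.map (f s) xs)) (sumBelow-swap s f xs)) (sum-map-+ xs)
  where
  sum-map-+ : ∀ xs → sum (List.map (λ x → sumBelow s λ j → f j x) xs) + sum (List.map (f s) xs) ≡
    sum (List.map (λ x → sumBelow (suc s) λ j → f j x) xs)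
  sum-map-+ []       = refl
  sum-map-+ (x ∷ xs) = ≡.trans (+-interchange (sumBelow s λ j → f j x) _ (f s x) _)
    (cong (sumBelow (suc s) (λ j → f j x) +_) (sum-map-+ xs))

sumBelow-≥ : ∀ s {f c} → (∀ j → j ℕ.< s → c ≤ f j) → s * c ≤ sumBelow s f
sumBelow-≥ zero    h = z≤n
sumBelow-≥ (suc s) {f} {c} h = subst (_≤ sumBelow (suc s) f) (ℕ.+-comm (s * c) c)
  (ℕ.+-mono-≤ (sumBelow-≥ s λ j j<s → h j (ℕ.m≤n⇒m≤1+n j<s)) (h s ℕ.≤-refl))

sumBelow-zero : ∀ s {f} → (∀ j → j ℕ.< s → f j ≡ 0) → sumBelow s f ≡ 0
sumBelow-zero zero    h = refl
sumBelow-zero (suc s) h = cong₂ _+_ (sumBelow-zero s λ j j<s → h j (ℕ.m≤n⇒m≤1+n j<s)) (h s ℕ.≤-refl)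

sumBelow-single : ∀ s {f} i → (∀ j → j ℕ.< s → j ≢ i → f j ≡ 0) → f i ≤ 1 → sumBelow s f ≤ 1
sumBelow-single zero    i h fi≤1 = z≤n
sumBelow-single (suc s) {f} i h fi≤1 with s ℕ.≟ i
... | yes refl rewrite sumBelow-zero s {f} (λ j j<s → h j (ℕ.m≤n⇒m≤1+n j<s) (ℕ.<⇒≢ j<s)) = fi≤1
... | no  s≢i  rewrite h s ℕ.≤-refl s≢i | ℕ.+-identityʳ (sumBelow s f) =
  sumBelow-single s i (λ j j<s → h j (ℕ.m≤n⇒m≤1+n j<s)) fi≤1

-- If every item crosses at most one of s cuts, and host and pendant items
-- cross none, then each cut accounts for m + 1 items of its own.
long-word : ∀ {cw : List (Item n m × Colour)} s (S : ℕ → Fin n → Bool) → 1 ≤ m →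
  (∀ {x c} → (x , c) ∈ₗ cw → sumBelow s (λ j → crossing (S j) x) ≤ 𝟙 (isChain c)) →
  (∀ j → j ℕ.< s → All (λ (x , _) → Thin (S j) x) cw) →
  (∀ j → j ℕ.< s → ∀ {i γ c} → ((i , γ) , c) ∈ₗ cw → (c ≡ pendant → S j i ≡ true) × (c ≡ host → S j i ≡ false)) →
  Uses host cw → Uses pendant cw → ∀ {i} → Trail i i (arcs* (List.map proj₁ cw)) → s * suc m + 2 ≤ length cw
long-word {n} {m} {cw} s S 1≤m disjoint thin sides uʰ uᵖ trail = begin
  s * suc m + 2
    ≤⟨ ℕ.+-monoˡ-≤ 2 (sumBelow-≥ s λ j j<s → cut (S j) 1≤m (All.map⁺ (thin j j<s)) trail
         (Any.map⁺ (side j j<s uᵖ λ x∈ → proj₁ (sides j j<s x∈)))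
         (Any.map⁺ (side j j<s uʰ λ x∈ → proj₂ (sides j j<s x∈)))) ⟩
  sumBelow s (λ j → sum (List.map (crossing (S j)) (List.map proj₁ cw))) + 2
    ≡⟨ cong (_+ 2) (sumBelow-swap s (λ j → crossing (S j)) (List.map proj₁ cw)) ⟩
  sum (List.map (λ x → sumBelow s λ j → crossing (S j) x) (List.map proj₁ cw)) + 2
    ≤⟨ ℕ.+-monoˡ-≤ 2 (bounded cw disjoint) ⟩
  sum (List.map (𝟙 ∘ isChain ∘ proj₂) cw) + 2
    ≤⟨ two-unused uʰ uᵖ ⟩
  length cw ∎
  where
  open ℕ.≤-Reasoning
  side : ∀ {c b} j → j ℕ.< s → Uses c cw →
    (∀ {i γ c′} → ((i , γ) , c′) ∈ₗ cw → c′ ≡ c → S j i ≡ b) → Any (λ ((i , _) , _) → S j i ≡ b) cw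
  side j j<s u h with x , x∈ , eq ← find u = lose x∈ (h x∈ eq)
  bounded : ∀ cw → (∀ {x c} → (x , c) ∈ₗ cw → sumBelow s (λ j → crossing (S j) x) ≤ 𝟙 (isChain c)) →
    sum (List.map (λ x → sumBelow s λ j → crossing (S j) x) (List.map proj₁ cw)) ≤ sum (List.map (𝟙 ∘ isChain ∘ proj₂) cw)
  bounded []       h = z≤n
  bounded (x ∷ cw) h = ℕ.+-mono-≤ (h (here refl)) (bounded cw (h ∘ there))
  𝟙≤1 : ∀ b → 𝟙 b ≤ 1
  𝟙≤1 true  = s≤s z≤n
  𝟙≤1 false = z≤n
  one-unused : ∀ {c} → isChain c ≡ false → ∀ {cw : List (Item n m × Colour)} → Uses c cw →
    sum (List.map (𝟙 ∘ isChain ∘ proj₂) cw) + 1 ≤ length cw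
  one-unused nc {_ ∷ cw} (here refl) rewrite nc = subst (_≤ suc (length cw)) (ℕ.+-comm 1 _) (s≤s (at-most cw))
    where
    at-most : ∀ (cw : List (Item n m × Colour)) → sum (List.map (𝟙 ∘ isChain ∘ proj₂) cw) ≤ length cw
    at-most []             = z≤n
    at-most ((_ , c) ∷ cw) = ℕ.+-mono-≤ (𝟙≤1 (isChain c)) (at-most cw)
  one-unused nc {(_ , c) ∷ cw} (there u) rewrite ℕ.+-assoc (𝟙 (isChain c)) (sum (List.map (𝟙 ∘ isChain ∘ proj₂) cw)) 1 =
    ℕ.+-mono-≤ (𝟙≤1 (isChain c)) (one-unused nc u)
  two-unused : ∀ {cw : List (Item n m × Colour)} → Uses host cw → Uses pendant cw →
    sum (List.map (𝟙 ∘ isChain ∘ proj₂) cw) + 2 ≤ length cw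
  two-unused {_ ∷ cw} (here refl) (there u) = subst (_≤ suc (length cw)) (≡.sym (ℕ.+-suc _ 1)) (s≤s (one-unused refl u))
  two-unused {_ ∷ cw} (there u) (here refl) = subst (_≤ suc (length cw)) (≡.sym (ℕ.+-suc _ 1)) (s≤s (one-unused refl u))
  two-unused {(_ , c) ∷ cw} (there u) (there v) rewrite ℕ.+-assoc (𝟙 (isChain c)) (sum (List.map (𝟙 ∘ isChain ∘ proj₂) cw)) 2 =
    ℕ.+-mono-≤ (𝟙≤1 (isChain c)) (two-unused u v)

-- Euler circuits

trail-↭ : ∀ {i j : Fin n} {as bs} → as ↭ bs → Trail i j as → Trail i j bs
trail-↭ p (cs , as↭cs , walk) = cs , ↭-trans (↭-sym p) as↭cs , walk

walk-++ : ∀ {i j l : Fin n} {as bs} → Walk i j as → Walk j l bs → Walk i l (as ++ bs)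
walk-++ []       q = q
walk-++ (v ∷ p) q = v ∷ walk-++ p q

trail-++ : ∀ {i j l : Fin n} {as bs} → Trail i j as → Trail j l bs → Trail i l (as ++ bs)
trail-++ (as′ , p , walk) (bs′ , q , walk′) = as′ ++ bs′ , ↭.++⁺ p q , walk-++ walk walk′

walk-split : ∀ {i j u : Fin n} {as} → Walk i j as → u ∈ₗ List.map proj₁ as →
  ∃[ bs ] ∃[ cs ] as ≡ bs ++ cs × Walk i u bs × Walk u j cs
walk-split (v ∷ walk) (here refl) = [] , _ , refl , [] , v ∷ walk
walk-split (v ∷ walk) (there u∈) with bs , cs , refl , p , q ← walk-split walk u∈ = _ ∷ bs , cs , refl , v ∷ p , q

rotate : ∀ {i u : Fin n} {as} → Trail i i as → u ∈ₗ List.map proj₁ as → Trail u u as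
rotate (bs , as↭bs , walk) u∈
  with cs , ds , refl , p , q ← walk-split walk (↭.∈-resp-↭ (↭.map⁺ proj₁ as↭bs) u∈) =
  ds ++ cs , ↭-trans as↭bs (↭.++-comm cs ds) , walk-++ q p

completeArcs : List (Fin n) → List (Arc n)
completeArcs vs = concatMap (λ (v , rest) → List.map (v ,_) rest) (select vs)

map-proj₁-select : ∀ {a} {A : Set a} (xs : List A) → List.map proj₁ (select xs) ≡ xs
map-proj₁-select []       = refl
map-proj₁-select (x ∷ xs) = cong (x ∷_) (≡.trans (≡.sym (List.map-∘ (select xs))) (map-proj₁-select xs))

completeArcs-∷ : ∀ (v : Fin n) vs → completeArcs (v ∷ vs) ↭ List.map (v ,_) vs ++ List.map (_, v) vs ++ completeArcs vs
completeArcs-∷ v vs = ↭.++⁺ˡ (List.map (v ,_) vs) (↭-trans (go (select vs))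
  (↭-reflexive (cong (_++ completeArcs vs) (≡.trans (List.map-∘ (select vs)) (cong (List.map (_, v)) (map-proj₁-select vs))))))
  where
  star : Fin _ × List (Fin _) → List (Arc _)
  star (u , rest) = List.map (u ,_) rest
  go : ∀ ss → concatMap star (List.map (map₂ (v ∷_)) ss) ↭ List.map (λ (u , _) → u , v) ss ++ concatMap star ss
  go []             = ↭-refl
  go ((u , r) ∷ ss) = prep (u , v) (↭-trans (↭.++⁺ˡ (List.map (u ,_) r) (go ss))
    (↭.shifts (List.map (u ,_) r) (List.map (λ (u , _) → u , v) ss)))

back-and-forth : ∀ (v : Fin n) us → Trail v v (List.map (v ,_) us ++ List.map (_, v) us)
back-and-forth v []       = [] , ↭-refl , []
back-and-forth v (u ∷ us) with bs , p , walk ← back-and-forth v us =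
  (v , u) ∷ (u , v) ∷ bs ,
  prep (v , u) (↭-trans (↭.shift (u , v) (List.map (v ,_) us) (List.map (_, v) us)) (prep (u , v) p)) ,
  u ∷ v ∷ walk

-- The complete digraph on v, w and `ws` is a circuit of the complete digraph on w and `ws`, entered
-- along v to w and left along w to v, followed by excursions from v to each vertex of `ws` and
-- back.
complete-circuit : ∀ (v : Fin n) vs → Trail v v (completeArcs (v ∷ vs))
complete-circuit v []       = [] , ↭-refl , []
complete-circuit v (w ∷ ws) = trail-↭ (↭-sym (↭-trans (completeArcs-∷ v (w ∷ ws)) (prep (v , w) shuffle)))
  (trail-++ (step v w) (trail-++ (complete-circuit w ws) (trail-++ (step w v) (back-and-forth v ws))))
  where
  step : ∀ (i j : Fin _) → Trail i j ((i , j) ∷ [])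
  step i j = _ , ↭-refl , j ∷ []
  A = List.map (v ,_) ws
  B = List.map (_, v) ws
  K = completeArcs (w ∷ ws)
  shuffle : A ++ (w , v) ∷ B ++ K ↭ K ++ (w , v) ∷ A ++ B
  shuffle = ↭-trans (↭.shift (w , v) A (B ++ K)) (↭-trans (prep (w , v)
    (↭-reflexive (≡.sym (List.++-assoc A B K)))) (↭.++-comm ((w , v) ∷ A ++ B) K))

completeArcs-source : ∀ {v : Fin n} {vs} → 2 ≤ length vs → v ∈ₗ vs → v ∈ₗ List.map proj₁ (completeArcs vs)
completeArcs-source {v = v} {vs} 2≤ v∈
  with (_ , rest) , s∈ , refl ← ∈-map⁻ proj₁ (subst (v ∈ₗ_) (≡.sym (map-proj₁-select vs)) v∈) =
  ∈-map⁺ proj₁ (∈-concatMap⁺ _ (lose s∈ (∈-map⁺ (v ,_) (proj₂ (nonempty rest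
    (subst (2 ≤_) (↭.↭-length (select-↭ vs s∈)) 2≤))))))
  where
  nonempty : ∀ us → 2 ≤ suc (length us) → ∃[ u ] u ∈ₗ us
  nonempty (u ∷ _) _ = u , here refl
  nonempty []      (s≤s ())

complete-trail : ∀ {v : Fin n} {vs} → 2 ≤ length vs → v ∈ₗ vs → Trail v v (completeArcs vs)
complete-trail {vs = w ∷ ws} 2≤ v∈ = rotate (complete-circuit w ws) (completeArcs-source 2≤ v∈)

vertices : Item n m → List (Fin n)
vertices (i , γ) = i ∷ toList γ

private
  star : Fin n × List (Fin n) → List (Arc n)
  star (v , rest) = List.map (v ,_) rest

  itemRow : Item n m → Fin n × List (Fin n)
  itemRow (i , γ) = i , toList γ

  toList-surjective : ∀ {a} {A : Set a} m {xs : List A} → length xs ≡ m → ∃[ γ ] toList {n = m} γ ≡ xs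
  toList-surjective m {xs} refl = Vec.fromList xs , Vec.toList∘fromList xs

  rows⇒items : ∀ {vs : List (Fin n)} → length vs ≡ suc m → ∀ ss → All (λ (v , rest) → v ∷ rest ↭ vs) ss →
    ∃[ w ] List.map (itemRow {m = m}) w ≡ ss × All (λ x → vertices x ↭ vs) w
  rows⇒items eq []                []       = [] , refl , []
  rows⇒items {m = m} eq ((v , rest) ∷ ss) (p ∷ ps)
    with w , refl , qs ← rows⇒items {m = m} eq ss ps
    with γ , refl ← toList-surjective m {rest} (ℕ.suc-injective (≡.trans (↭.↭-length p) eq)) =
    (v , γ) ∷ w , refl , p ∷ qs

-- Taking each vertex of an edge once as source, with the other vertices as targets, produces every
-- ordered pair once. These k = m + 1 entries attain the lower bound of `cut` and admit an Euler
-- circuit.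
star-items : ∀ {vs : List (Fin n)} → length vs ≡ suc m →
  ∃[ w ] arcs* {m = m} w ≡ completeArcs vs × length w ≡ suc m × All (λ x → vertices x ↭ vs) w
star-items {m = m} {vs} eq
  with w , row≡ , ps ← rows⇒items {m = m} eq (select vs) (All.tabulate λ s∈ → ↭-sym (select-↭ vs s∈)) =
  w ,
  ≡.trans (≡.sym (List.concatMap-map star itemRow w)) (cong (concatMap star) row≡) ,
  ≡.trans (≡.trans (≡.sym (List.length-map itemRow w)) (cong length row≡))
    (≡.trans (≡.sym (List.length-map proj₁ (select vs))) (≡.trans (cong length (map-proj₁-select vs)) eq)) ,
  ps

loop : Fin n → Item n m
loop {m = m} v = v , Vec.replicate m v

loop-trail : ∀ m (v : Fin n) → Trail v v (arcs {m = m} (loop v))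
loop-trail zero    v = [] , ↭-refl , []
loop-trail (suc m) v with bs , p , walk ← loop-trail m v = (v , v) ∷ bs , prep (v , v) p , v ∷ walk

-- Vertex lists of consecutive edges leading from p to q, the last edge first.
data Chain {n} (m : ℕ) (p : Fin n) : Fin n → List (List (Fin n)) → Set where
  []    : Chain m p p []
  extend : ∀ {q q′ vs vss} → Chain m p q vss → q ∈ₗ vs → q′ ∈ₗ vs → length vs ≡ suc m → Chain m p q′ (vs ∷ vss)

-- The circuits of consecutive edges are joined at their common vertex. Knowing that q is the source
-- of some arc is what allows `rotate` to start the old circuit there at the next step; the loop at
-- p provides this for the empty chain.
chain-circuit : ∀ {p q : Fin n} {vss} → Chain (suc m) p q vss →
  ∃[ w ] length w ≡ length vss * suc (suc m) × All (λ x → Any (vertices x ↭_) vss) w ×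
    (let as = arcs* (loop {m = suc m} p ∷ w) in (∃[ i ] Trail i i as) × q ∈ₗ List.map proj₁ as)
chain-circuit {m = m} {p} [] = [] , refl , [] ,
  (p , trail-↭ (↭-reflexive (≡.sym (List.++-identityʳ _))) (loop-trail (suc m) p)) , here refl
chain-circuit {m = m} {p} {q} (extend {q = u} {vs = vs} ch u∈ q∈ eq)
  with w , |w| , ps , (i , trail) , src ← chain-circuit ch
  with w′ , arcs≡ , |w′| , ps′ ← star-items {m = suc m} eq =
  w′ ++ w ,
  ≡.trans (List.length-++ w′) (cong₂ _+_ |w′| |w|) ,
  All.++⁺ (All.map here ps′) (All.map there ps) ,
  (u , trail-↭ (↭-sym split-arcs) (trail-++ (complete-trail 2≤ u∈) (rotate trail src))) ,
  ↭.∈-resp-↭ (↭.map⁺ proj₁ (↭-sym split-arcs))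
    (subst (q ∈ₗ_) (≡.sym (List.map-++ proj₁ (completeArcs vs) _)) (Any.++⁺ˡ (completeArcs-source 2≤ q∈)))
  where
  2≤ : 2 ≤ length vs
  2≤ = subst (2 ≤_) (≡.sym eq) (s≤s (s≤s z≤n))
  l = arcs {m = suc m} (loop p)
  split-arcs : arcs* (loop p ∷ w′ ++ w) ↭ completeArcs vs ++ arcs* (loop p ∷ w)
  split-arcs = ↭-trans (↭-reflexive (cong (l ++_) (≡.trans (List.concatMap-++ arcs w′ w) (cong (_++ arcs* w) arcs≡))))
    (↭.shifts l (completeArcs vs))

chain-word : ∀ {p q : Fin n} {vss} → Chain (suc m) p q vss →
  ∃[ w ] length w ≡ length vss * suc (suc m) × All (λ x → Any (vertices x ↭_) vss) w ×
    ∃[ i ] Trail i i (arcs* (loop {m = suc m} q ∷ loop p ∷ w))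
chain-word {m = m} {q = q} ch with w , |w| , ps , (i , trail) , src ← chain-circuit ch =
  w , |w| , ps , q , trail-++ (loop-trail (suc m) q) (rotate trail src)

-- Path systems

support : Item n m → Subset n
support x = ⋃ (List.map ⁅_⁆ (vertices x))

∈-⋃-singletons⁺ : ∀ {v : Fin n} {vs} → v ∈ₗ vs → v ∈ ⋃ (List.map ⁅_⁆ vs)
∈-⋃-singletons⁺ {v = v} (here refl) = x∈p∪q⁺ (inj₁ (x∈⁅x⁆ v))
∈-⋃-singletons⁺ (there v∈) = x∈p∪q⁺ (inj₂ (∈-⋃-singletons⁺ v∈))

∈-⋃-singletons⁻ : ∀ {v : Fin n} vs → v ∈ ⋃ (List.map ⁅_⁆ vs) → v ∈ₗ vs
∈-⋃-singletons⁻ []       v∈ = contradiction v∈ ∉⊥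
∈-⋃-singletons⁻ (u ∷ us) v∈ with x∈p∪q⁻ ⁅ u ⁆ _ v∈
... | inj₁ p = here (x∈⁅y⁆⇒x≡y u p)
... | inj₂ p = there (∈-⋃-singletons⁻ us p)

record Enumeration (k : ℕ) {n} (e : Subset n) : Set where
  field
    elements : List (Fin n)
    unique   : Unique elements
    size     : length elements ≡ k
    complete : ∀ {v} → v ∈ e → v ∈ₗ elements
    sound    : ∀ {v} → v ∈ₗ elements → v ∈ e

-- Pigeonhole: a duplicate-free list contained in a list of the same length exhausts it.
unique-⊆-↭ : ∀ {a} {A : Set a} {xs ys : List A} → Unique xs → (∀ {x} → x ∈ₗ xs → x ∈ₗ ys) →
  length xs ≡ length ys → xs ↭ ys
unique-⊆-↭ {ys = []}     []      _ _  = ↭-refl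
unique-⊆-↭ {xs = x ∷ xs} (x∉ ∷ u) h eq with us , vs , refl ← ∈-∃++ (h (here refl)) =
  ↭-trans (prep x (unique-⊆-↭ u smaller
    (ℕ.suc-injective (≡.trans eq (↭.↭-length (↭.shift x us vs)))))) (↭-sym (↭.shift x us vs))
  where
  smaller : ∀ {y} → y ∈ₗ xs → y ∈ₗ us ++ vs
  smaller y∈ with ↭.∈-resp-↭ (↭.shift x us vs) (h (there y∈))
  ... | here refl = contradiction refl (All.lookup x∉ y∈)
  ... | there y∈′ = y∈′

unique-resp-↭ : ∀ {a} {A : Set a} {xs ys : List A} → xs ↭ ys → Unique xs → Unique ys
unique-resp-↭ ↭.refl         u                       = u
unique-resp-↭ (prep x p)     (x∉ ∷ u)                = ↭.All-resp-↭ p x∉ ∷ unique-resp-↭ p u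
unique-resp-↭ (swap x y p)   ((x≢y ∷ x∉) ∷ (y∉ ∷ u)) =
  ((x≢y ∘ ≡.sym) ∷ ↭.All-resp-↭ p y∉) ∷ (↭.All-resp-↭ p x∉ ∷ unique-resp-↭ p u)
unique-resp-↭ (↭.trans p q)  u                       = unique-resp-↭ q (unique-resp-↭ p u)

-- An item has exactly as many positions as the edge has vertices, so it can cover the edge only by
-- listing each vertex once.
support-vertices : ∀ {e : Subset n} (en : Enumeration (suc m) e) (x : Item n m) → support x ≡ e →
  Enumeration.elements en ↭ vertices x
support-vertices en (i , γ) refl = unique-⊆-↭ (Enumeration.unique en)
  (λ v∈ → ∈-⋃-singletons⁻ (vertices (i , γ)) (Enumeration.sound en v∈))
  (≡.trans (Enumeration.size en) (cong suc (≡.sym (Vec.length-toList γ))))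

vertices-support : ∀ {e : Subset n} {k} (en : Enumeration k e) (x : Item n m) → vertices x ↭ Enumeration.elements en →
  support x ≡ e
vertices-support en x p = ⊆-antisym
  (λ v∈ → Enumeration.sound en (↭.∈-resp-↭ p (∈-⋃-singletons⁻ (vertices x) v∈)))
  (λ v∈ → ∈-⋃-singletons⁺ (↭.∈-resp-↭ (↭-sym p) (Enumeration.complete en v∈)))

-- What the cut argument uses of a hyperpath. The properties survive injective renaming and
-- reversal, so one argument serves both hypergraphs, each read from its own pendant edge. Applying
-- `near` in both orders shows that intersecting edges have indices at distance at most one.
record PathSystem (k : ℕ) {n r} (f : Fin r → Subset n) : Set where
  field
    near      : ∀ i j {v} → v ∈ f i → v ∈ f j → toℕ i ≤ suc (toℕ j)
    joint     : ∀ i j → toℕ j ≡ suc (toℕ i) → ∃[ p ] p ∈ f i × p ∈ f j × (∀ {v} → v ∈ f i → v ∈ f j → v ≡ p)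
    enumerate : ∀ i → Enumeration k (f i)

module Cuts {κ n r : ℕ} {f : Fin (suc r) → Subset n} (path : PathSystem (suc (suc κ)) f) where
  open PathSystem path

  initialSegment? : ∀ j v → Dec (∃[ i ] toℕ i ≤ j × v ∈ f i)
  initialSegment? j v = Fin.any? λ i → toℕ i ℕ.≤? j ×-dec v ∈? f i

  -- The near side of the j-th cut. It contains the common vertex of `f j` and its successor, so the
  -- edge with index j + 1 is the one that crosses.
  initialSegment : ℕ → Fin n → Bool
  initialSegment j v = does (initialSegment? j v)

  inside-segment : ∀ {j v i} → toℕ i ≤ j → v ∈ f i → initialSegment j v ≡ true
  inside-segment {j} {v} {i} i≤j v∈ = dec-true (initialSegment? j v) (i , i≤j , v∈)

  outside-segment : ∀ {j v} → (∀ i → toℕ i ≤ j → v ∉ f i) → initialSegment j v ≡ false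
  outside-segment {j} {v} h = dec-false (initialSegment? j v) λ (i , i≤j , v∈) → h i i≤j v∈

  module _ {j : ℕ} {i : Fin (suc r)} {x : Item n (suc κ)} (supp : support x ≡ f i) where

    private
      v∈⇒v∈f : ∀ {v} → v ∈ₗ vertices x → v ∈ f i
      v∈⇒v∈f v∈ = subst (_ ∈_) supp (∈-⋃-singletons⁺ v∈)

    -- An edge of index at most j lies inside. One of index above j + 1 is too far from the segment,
    -- by `near`, to share a vertex with it.
    edge-same-side : suc j ≢ toℕ i → All (λ v → initialSegment j v ≡ initialSegment j (proj₁ x)) (toList (proj₂ x))
    edge-same-side j+1≢i with toℕ i ℕ.≤? j
    ... | yes i≤j = All.tabulate λ v∈ → ≡.trans (inside-segment i≤j (v∈⇒v∈f (there v∈)))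
      (≡.sym (inside-segment i≤j (v∈⇒v∈f (here refl))))
    ... | no  i≰j = All.tabulate λ v∈ → ≡.trans (out (v∈⇒v∈f (there v∈))) (≡.sym (out (v∈⇒v∈f (here refl))))
      where
      out : ∀ {v} → v ∈ f i → initialSegment j v ≡ false
      out v∈ = outside-segment λ i′ i′≤j v∈′ →
        j+1≢i (ℕ.≤-antisym (ℕ.≰⇒> i≰j) (ℕ.≤-trans (near i i′ v∈ v∈′) (s≤s i′≤j)))

    -- Of all edges in the segment only the last can meet its successor, and it does so only in p.
    beyond-joint : ∀ {i⁻ : Fin (suc r)} {p} → toℕ i⁻ ≡ j → toℕ i ≡ suc j → (∀ {v} → v ∈ f i⁻ → v ∈ f i → v ≡ p) →
      ∀ {v} → v ∈ₗ vertices x → v ≢ p → initialSegment j v ≡ false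
    beyond-joint refl i≡ only-p v∈ v≢p = outside-segment λ i′ i′≤j v∈′ → v≢p (only-p (subst (λ l → _ ∈ f l)
      (Fin.toℕ-injective (ℕ.≤-antisym i′≤j (ℕ.≤-pred (subst (_≤ suc (toℕ i′)) i≡ (near i i′ (v∈⇒v∈f v∈) v∈′))))) v∈′)
      (v∈⇒v∈f v∈))

    edge-thin : ∀ {i⁻ : Fin (suc r)} → toℕ i⁻ ≡ j → toℕ i ≡ suc j → Thin (initialSegment j) x
    edge-thin {i⁻} refl i≡
      with p , p∈⁻ , p∈ , only-p ← joint i⁻ i i≡
      with uniq ← unique-resp-↭ (support-vertices (enumerate i) x supp) (Enumeration.unique (enumerate i))
      with ∈-⋃-singletons⁻ (vertices x) (subst (p ∈_) (≡.sym supp) p∈) | uniq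
    ... | here refl | i∉ ∷ _ = exit (inside-segment ℕ.≤-refl p∈⁻)
      (All.tabulate λ v∈ → beyond-joint refl i≡ only-p (there v∈) λ eq → All.lookup i∉ v∈ (≡.sym eq))
    ... | there p∈γ | i∉ ∷ u
      with us , vs , eq ← ∈-∃++ p∈γ
      with γ↭ ← ↭-trans (↭-reflexive eq) (↭.shift p us vs)
      with p∉ ∷ _ ← unique-resp-↭ γ↭ u =
      entry (beyond-joint refl i≡ only-p (here refl) (All.lookup i∉ p∈γ)) (inside-segment ℕ.≤-refl p∈⁻)
        (All.tabulate λ v∈ → beyond-joint refl i≡ only-p (there (↭.∈-resp-↭ (↭-sym γ↭) (there v∈))) λ eq → All.lookup p∉ v∈ (≡.sym eq)) γ↭

  -- The chain omits edge zero, which is pendant, and starts at the vertex p of the first later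
  -- edge. That edge is described by `toℕ b ≡ 0` because `Fin r` has no visible element.
  chain-to : ∀ {p} → (∀ b → toℕ b ≡ 0 → p ∈ f (suc b)) → ∀ d a → toℕ a ≡ d → ∀ {q} → q ∈ f (suc a) →
    ∃[ vss ] Chain (suc κ) p q vss × length vss ≡ suc d ×
      All (λ vs → ∃[ b ] vs ≡ Enumeration.elements (enumerate (suc b))) vss
  chain-to p∈ zero a a≡0 q∈ = _ ∷ [] ,
    extend [] (complete (p∈ a a≡0)) (complete q∈) size , refl , (a , refl) ∷ []
    where open Enumeration (enumerate (suc a))
  chain-to p∈ (suc d) (suc a) eq q∈
    with u , u∈⁻ , u∈ , _ ← joint (suc (inject₁ a)) (suc (suc a)) (cong (λ d → suc (suc d)) (≡.sym (Fin.toℕ-inject₁ a)))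
    with vss , ch , |vss| , es ← chain-to p∈ d (inject₁ a) (≡.trans (Fin.toℕ-inject₁ a) (ℕ.suc-injective eq)) u∈⁻ =
    _ ∷ vss , extend ch (complete u∈) (complete q∈) size , cong suc |vss| , (suc a , refl) ∷ es
    where open Enumeration (enumerate (suc (suc a)))

-- Tensors of edge lists

module EdgeTensors {c ℓ₁ ℓ₂ ℓ₃} (F : OrderedField c ℓ₁ ℓ₂ ℓ₃) where
  open OrderedField F
    hiding (zero)
    renaming (_+_ to _+#_; _*_ to _*#_; refl to ≈-refl; sym to ≈-sym; trans to ≈-trans)
  open FieldNumerals F
  open Spectral F
  open FieldLemmas F
  open TraceExpansion F
  open Relabelling F
  open ColouredTraces F

  trace-cong : ∀ k {n} t {T U : Tensor k n} → (∀ i γ → T i γ ≈ U i γ) → trace k t T ≈ trace k t U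
  trace-cong k {n} t h = ∑-cong (compositions n t) λ ds → *-congˡ (∑-cong (words n (k ∸ 1) (sources ds)) λ w →
    *-congʳ (weight-cong (λ (i , γ) → h i γ) w))

  module _ (α : Carrier) (k : ℕ) where

    -- The degree on the diagonal is distributed over the incident edges. This makes the tensor
    -- additive in the list of edges, as the colouring by parts requires.
    edgeEntry : ∀ {n} → Subset n → Item n (k ∸ 1) → Carrier
    edgeEntry e (i , γ) = α *# when (does (all? (i Fin.≟_) γ)) (when (does (i ∈? e)) 1#) +#
      (1# - α) *# when (does (support (i , γ) ≟ˢ e)) (1/ (k ∸ 1) !)

    edgeTensor : ∀ {n} → List (Subset n) → Item n (k ∸ 1) → Carrier
    edgeTensor es x = ∑ es λ e → edgeEntry e x

    tensorOf : ∀ {n} → List (Subset n) → Tensor k n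
    tensorOf es i γ = edgeTensor es (i , γ)

  module _ (α : Carrier) (0<α : 0# < α) (α<1 : α < 1#) (κ : ℕ) where

    private
      k : ℕ
      k = suc (suc κ)

    when-dec-pos⁻¹ : ∀ {p} {P : Set p} (P? : Dec P) {x} → 0# < when (does P?) x → P × 0# < x
    when-dec-pos⁻¹ (yes p) q = p , q
    when-dec-pos⁻¹ (no _)  q = ⊥-elim (0≮0 ≈-refl q)

    0<1-α : 0# < 1# - α
    0<1-α = <-resp (-‿inverseʳ α) ≈-refl (+-monoˡ-< (- α) α<1)

    module _ {n : ℕ} (e : Subset n) where

      private
        loop-nonneg : ∀ i (γ : Vec (Fin n) (suc κ)) →
          Nonneg (α *# when (does (all? (i Fin.≟_) γ)) (when (does (i ∈? e)) 1#))
        loop-nonneg i γ = *-nonneg (inj₂ 0<α)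
          (when-nonneg (does (all? (i Fin.≟_) γ)) (when-nonneg (does (i ∈? e)) (inj₂ 0<1)))

        edge-nonneg : ∀ (x : Item n (suc κ)) → Nonneg ((1# - α) *# when (does (support x ≟ˢ e)) (1/ (suc κ) !))
        edge-nonneg x = *-nonneg (inj₂ 0<1-α) (when-nonneg (does (support x ≟ˢ e)) (inj₂ (1/!-pos (suc κ))))

      edgeEntry-nonneg : ∀ (x : Item n (suc κ)) → Nonneg (edgeEntry α k e x)
      edgeEntry-nonneg (i , γ) = +-nonneg (loop-nonneg i γ) (edge-nonneg (i , γ))

      edgeEntry-pos⁻¹ : ∀ (x : Item n (suc κ)) → 0# < edgeEntry α k e x →
        (All (_≡ proj₁ x) (toList (proj₂ x)) × proj₁ x ∈ e) ⊎ support x ≡ e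
      edgeEntry-pos⁻¹ (i , γ) p with +-pos⁻¹ (loop-nonneg i γ) (edge-nonneg (i , γ)) p
      ... | inj₂ q = inj₂ (proj₁ (when-dec-pos⁻¹ (support (i , γ) ≟ˢ e) (proj₂ (*-pos⁻¹ (inj₂ 0<1-α)
        (when-nonneg (does (support (i , γ) ≟ˢ e)) (inj₂ (1/!-pos (suc κ)))) q))))
      ... | inj₁ q
        with all≡ , r ← when-dec-pos⁻¹ (all? (i Fin.≟_) γ) (proj₂ (*-pos⁻¹ (inj₂ 0<α)
               (when-nonneg (does (all? (i Fin.≟_) γ)) (when-nonneg (does (i ∈? e)) (inj₂ 0<1))) q)) =
        inj₁ (VecAll.toList⁺ (VecAll.map ≡.sym all≡) , proj₁ (when-dec-pos⁻¹ (i ∈? e) r))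

      edgeEntry-source : ∀ (x : Item n (suc κ)) → 0# < edgeEntry α k e x → proj₁ x ∈ e
      edgeEntry-source x p with edgeEntry-pos⁻¹ x p
      ... | inj₁ (_ , i∈) = i∈
      ... | inj₂ eq       = subst (proj₁ x ∈_) eq (∈-⋃-singletons⁺ {vs = vertices x} (here refl))

      edgeEntry-loop : ∀ {v} → v ∈ e → 0# < edgeEntry α k e (loop v)
      edgeEntry-loop {v} v∈ = pos+nonneg loop-pos (edge-nonneg (loop v))
        where
        replicate≡ : ∀ m → VecAll.All (v ≡_) (Vec.replicate m v)
        replicate≡ zero    = VecAll.[]
        replicate≡ (suc m) = refl VecAll.∷ replicate≡ m
        loop-pos : 0# < α *# when (does (all? (v Fin.≟_) (Vec.replicate (suc κ) v))) (when (does (v ∈? e)) 1#)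
        loop-pos rewrite dec-true (all? (v Fin.≟_) (Vec.replicate (suc κ) v)) (replicate≡ (suc κ)) | dec-true (v ∈? e) v∈ =
          *-pos 0<α 0<1

      edgeEntry-edge : ∀ (x : Item n (suc κ)) → support x ≡ e → 0# < edgeEntry α k e x
      edgeEntry-edge x@(i , γ) eq = nonneg+pos (loop-nonneg i γ) edge-pos
        where
        edge-pos : 0# < (1# - α) *# when (does (support x ≟ˢ e)) (1/ (suc κ) !)
        edge-pos rewrite dec-true (support x ≟ˢ e) eq = *-pos 0<1-α (1/!-pos (suc κ))

    -- The pendant edge has index zero, so `toℕ a` is the number of edges after it up to the edge
    -- carrying the hosts, and thus the number of cuts separating the two.
    module PathTraces {n r : ℕ} {f : Fin (suc r) → Subset n} (path : PathSystem k f)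
      (hosts : List (Subset n)) (a : Fin (suc r))
      (attached : ∀ {q} → q ∈ₗ hosts → ∀ {v i} → v ∈ q → v ∈ f i → i ≡ a) where

      open PathSystem path
      open Cuts path

      edges later : List (Subset n)
      edges = List.map f (allFin (suc r))
      later = List.map f (List.tabulate suc)

      part : Colour → Item n (suc κ) → Carrier
      part chain   = edgeTensor α k later
      part host    = edgeTensor α k hosts
      part pendant = edgeEntry α k (f zero)

      part-nonneg : ∀ c x → Nonneg (part c x)
      part-nonneg chain   x = ∑-nonneg later λ e → edgeEntry-nonneg e x
      part-nonneg host    x = ∑-nonneg hosts λ e → edgeEntry-nonneg e x
      part-nonneg pendant x = edgeEntry-nonneg (f zero) x

      open Mixed k part part-nonneg public using (mixedTrace)
      open Mixed k part part-nonneg hiding (mixedTrace)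

      trace-split : ∀ t →
        trace k t (tensorOf α k (edges ++ hosts)) +# trace k t (tensorOf α k later) ≈
        (trace k t (tensorOf α k edges) +# trace k t (tensorOf α k (later ++ hosts))) +# mixedTrace t
      trace-split t = ≈-trans
        (+-cong (trace-cong k t λ i γ → all-parts (i , γ)) (trace-cong k t λ i γ → chain-part (i , γ)))
        (≈-trans (trace-inclusion-exclusion t) (+-congʳ
          (+-cong (trace-cong k t λ i γ → ≈-sym (no-host (i , γ))) (trace-cong k t λ i γ → ≈-sym (no-pendant (i , γ))))))
        where
        drop-0 : ∀ {x} → x +# 0# ≈ x
        drop-0 = +-identityʳ _
        rotate-sum : ∀ x y z → x +# (y +# z) ≈ y +# (z +# x)
        rotate-sum x y z = ≈-trans (+-comm x _) (+-assoc y z x)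
        all-parts : ∀ x → edgeTensor α k (edges ++ hosts) x ≈ restrict (λ _ → true) x
        all-parts x = ≈-trans (+-congˡ (∑-++ later hosts _)) (≈-trans (rotate-sum _ _ _)
          (+-congˡ (+-congˡ (≈-sym drop-0))))
        chain-part : ∀ x → edgeTensor α k later x ≈ restrict isChain x
        chain-part x = ≈-sym (≈-trans (+-congˡ (≈-trans (+-identityˡ _) (+-identityˡ _))) drop-0)
        no-host : ∀ x → edgeTensor α k edges x ≈ restrict (not ∘ isHost) x
        no-host x = ≈-trans (+-comm _ _) (+-congˡ (≈-sym (≈-trans (+-identityˡ _) drop-0)))
        no-pendant : ∀ x → edgeTensor α k (later ++ hosts) x ≈ restrict (not ∘ isPendant) x
        no-pendant x = ≈-trans (∑-++ later hosts _) (+-congˡ (≈-sym (≈-trans (+-congˡ (+-identityˡ 0#)) drop-0)))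

      private
        Stays : ℕ → Item n (suc κ) → Set
        Stays j x = All (λ v → initialSegment j v ≡ initialSegment j (proj₁ x)) (toList (proj₂ x))

        stays-if : ∀ {e x j b} → 0# < edgeEntry α k e x → (∀ {v} → v ∈ e → initialSegment j v ≡ b) → Stays j x
        stays-if {e} {x} {j} p h with edgeEntry-pos⁻¹ e x p
        ... | inj₁ (loops , _) = All.map (cong (initialSegment j)) loops
        ... | inj₂ eq = All.tabulate λ v∈ → ≡.trans (h (in-edge (there v∈))) (≡.sym (h (in-edge (here refl))))
          where
          in-edge : ∀ {v} → v ∈ₗ vertices x → v ∈ e
          in-edge v∈ = subst (_ ∈_) eq (∈-⋃-singletons⁺ v∈)

        outside-host : ∀ {q j} → q ∈ₗ hosts → j ℕ.< toℕ a → ∀ {v} → v ∈ q → initialSegment j v ≡ false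
        outside-host q∈ j<a v∈q = outside-segment λ i i≤j v∈f →
          ℕ.<-irrefl (cong toℕ (attached q∈ v∈q v∈f)) (ℕ.≤-<-trans i≤j j<a)

        -- Only entries supported on a whole later edge can cross a cut: loops do not move, the
        -- pendant edge lies inside every segment, and host edges lie outside every segment that
        -- ends before `f a`.
        classify : ∀ {x} c → 0# < part c x →
          (∃[ i ] c ≡ chain × support x ≡ f (suc i)) ⊎ (∀ j → j ℕ.< toℕ a → Stays j x)
        classify {x} chain p
          with e , e∈ , q ← ∑-pos⁻¹ later (λ e → edgeEntry-nonneg e x) p
          with i′ , i∈ , refl ← ∈-map⁻ f e∈
          with i , refl ← ∈-tabulate⁻ {f = suc} i∈
          with edgeEntry-pos⁻¹ (f (suc i)) x q
        ... | inj₁ (loops , _) = inj₂ λ j _ → All.map (cong (initialSegment j)) loops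
        ... | inj₂ supp        = inj₁ (i , refl , supp)
        classify {x} host p
          with q , q∈ , r ← ∑-pos⁻¹ hosts (λ e → edgeEntry-nonneg e x) p =
          inj₂ λ j j<a → stays-if {q} {x} r (outside-host q∈ j<a)
        classify {x} pendant p = inj₂ λ j _ → stays-if {f zero} {x} p (inside-segment z≤n)

        thin : ∀ {x} c → 0# < part c x → ∀ j → j ℕ.< toℕ a → Thin (initialSegment j) x
        thin {x} c p j j<a with classify c p
        ... | inj₂ stays = inside-or-outside (stays j j<a)
        ... | inj₁ (i , _ , supp) with suc j ℕ.≟ toℕ (Fin.suc i)
        ...   | no ≢    = inside-or-outside (edge-same-side {x = x} supp ≢)
        ...   | yes eq  = edge-thin {x = x} supp {inject₁ i} (≡.trans (Fin.toℕ-inject₁ i) (≡.sym (ℕ.suc-injective eq))) (≡.sym eq)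

        one-crossing : ∀ {x} c → 0# < part c x → sumBelow (toℕ a) (λ j → crossing (initialSegment j) x) ≤ 𝟙 (isChain c)
        one-crossing {x} c p with classify c p
        ... | inj₂ stays rewrite sumBelow-zero (toℕ a) {λ j → crossing (initialSegment j) x}
          (λ j j<a → crossing-same-side (initialSegment j) x (stays j j<a)) = z≤n
        -- Edge `suc i` is crossed by cut i alone. If i is not among the cuts considered, the sum is
        -- zero and the bound still holds.
        ... | inj₁ (i , refl , supp) = sumBelow-single (toℕ a) (toℕ i)
          (λ j _ j≢i → crossing-same-side (initialSegment j) x (edge-same-side {x = x} supp (j≢i ∘ ℕ.suc-injective)))
          (ℕ.m⊓n≤m 1 _)

        sides : ∀ {x} c → 0# < part c x → ∀ j → j ℕ.< toℕ a →
          (c ≡ pendant → initialSegment j (proj₁ x) ≡ true) × (c ≡ host → initialSegment j (proj₁ x) ≡ false)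
        sides chain   p j j<a = (λ ()) , λ ()
        sides {x} pendant p j j<a = (λ _ → inside-segment z≤n (edgeEntry-source (f zero) x p)) , λ ()
        sides {x} host p j j<a with q , q∈ , r ← ∑-pos⁻¹ hosts (λ e → edgeEntry-nonneg e x) p =
          (λ ()) , λ _ → outside-host q∈ j<a (edgeEntry-source q x r)

      mixedTrace-short : ∀ t → t ℕ.< toℕ a * k + 2 → mixedTrace t ≈ 0#
      mixedTrace-short t t< = mixedTrace-zero t λ cw |cw| pos uʰ uᵖ trail → ℕ.<⇒≱ t< (subst (toℕ a * k + 2 ≤_) |cw|
        (long-word (toℕ a) initialSegment (s≤s z≤n)
          (λ {_} {c} x∈ → one-crossing c (All.lookup pos x∈))
          (λ j j<a → All.map (λ {(_ , c)} p → thin c p j j<a) pos)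
          (λ j j<a {_} {_} {c} x∈ → sides c (All.lookup pos x∈) j j<a)
          uʰ uᵖ trail))

      -- The extremal word takes k entries from each of the `toℕ a` edges on the way, one loop at x
      -- counted for a host edge, and one loop at the joint p counted for the pendant edge.
      mixedTrace-first : ∀ a′ → a ≡ suc a′ → ∀ {x q} → x ∈ f a → q ∈ₗ hosts → x ∈ q → 0# < mixedTrace (toℕ a * k + 2)
      mixedTrace-first a′ refl {x} {q} x∈ q∈ x∈q = subst (λ t → 0# < mixedTrace t) (≡.trans
        (cong (2 +_) (≡.trans (List.length-map (_, chain) w) |w|)) (ℕ.+-comm 2 (toℕ a * k)))
        (mixedTrace-pos {cw = cw} positive (here refl) (there (here refl))
          (subst (λ w → Trail _ _ (arcs* (loop x ∷ loop p ∷ w))) (≡.sym (≡.trans (≡.sym (List.map-∘ w)) (List.map-id w))) trail))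
        where
        -- The existence of a′ shows that `Fin r` is inhabited, so the pendant edge has a successor.
        second : Fin r
        second = Fin.fromℕ< (ℕ.≤-<-trans z≤n (Fin.toℕ<n a′))
        second≡0 : toℕ second ≡ 0
        second≡0 = Fin.toℕ-fromℕ< _
        joint₀ = joint zero (suc second) (cong suc second≡0)
        p = proj₁ joint₀
        chain₀ = chain-to (λ b b≡0 → subst (λ b → p ∈ f (suc b)) (Fin.toℕ-injective (≡.trans second≡0 (≡.sym b≡0)))
          (proj₁ (proj₂ (proj₂ joint₀)))) (toℕ a′) a′ refl x∈
        vss = proj₁ chain₀
        word = chain-word (proj₁ (proj₂ chain₀))
        w = proj₁ word
        |w| : length w ≡ toℕ a * k
        |w| = ≡.trans (proj₁ (proj₂ word)) (cong (_* k) (proj₁ (proj₂ (proj₂ chain₀))))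
        trail = proj₂ (proj₂ (proj₂ (proj₂ word)))
        cw = (loop x , host) ∷ (loop p , pendant) ∷ List.map (_, chain) w
        chain-pos : ∀ {y} → Any (vertices y ↭_) vss → 0# < part chain y
        chain-pos {y} any with vs , vs∈ , y↭ ← find any
          with b , refl ← All.lookup (proj₂ (proj₂ (proj₂ chain₀))) vs∈ =
          ∑-pos later (λ e → edgeEntry-nonneg e y) (∈-map⁺ f (∈-tabulate⁺ b))
            (edgeEntry-edge (f (suc b)) y (vertices-support (enumerate (suc b)) y y↭))
        positive : Positive cw
        positive = ∑-pos hosts (λ e → edgeEntry-nonneg e (loop x)) q∈ (edgeEntry-loop q x∈q) ∷
          edgeEntry-loop (f zero) (proj₁ (proj₂ joint₀)) ∷
          All.map⁺ (All.map chain-pos (proj₁ (proj₂ (proj₂ word))))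

-- Comparison of two hypergraphs with a common path

subsets-unique : ∀ n → Unique (subsets n)
subsets-unique zero    = [] ∷ []
subsets-unique (suc n) = Unique.cartesianProductWith⁺ _∷_ (λ { refl → refl , refl })
  (((λ ()) ∷ []) ∷ [] ∷ []) (subsets-unique n)

∈-subsets : ∀ (e : Subset n) → e ∈ₗ subsets n
∈-subsets = ∈-vecs λ where
  true  → here refl
  false → there (here refl)

-- A hypergraph is given by a predicate; a duplicate-free listing turns degrees and adjacency into
-- sums over edges.
record EdgeList (H : Hypergraph n) (es : List (Subset n)) : Set where
  field
    unique   : Unique es
    complete : ∀ {e} → Edge H e → e ∈ₗ es
    sound    : ∀ {e} → e ∈ₗ es → Edge H e

module _ (σ : Permutation′ n) where

  vertices-permuted : ∀ {m} (x : Item n m) → vertices (permuteItem σ x) ≡ List.map (σ ⟨$⟩ʳ_) (vertices x)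
  vertices-permuted (i , γ) = cong ((σ ⟨$⟩ʳ i) ∷_) (Vec.toList-map (σ ⟨$⟩ʳ_) γ)

  private
    ∈-permuted⁺ : ∀ {m} (x : Item n m) {v} → v ∈ₗ vertices x → (σ ⟨$⟩ʳ v) ∈ₗ vertices (permuteItem σ x)
    ∈-permuted⁺ x {v} v∈ = subst ((σ ⟨$⟩ʳ v) ∈ₗ_) (≡.sym (vertices-permuted x)) (∈-map⁺ (σ ⟨$⟩ʳ_) v∈)

    ∈-permuted⁻ : ∀ {m} (x : Item n m) {v} → v ∈ₗ vertices (permuteItem σ x) → ∃[ u ] u ∈ₗ vertices x × v ≡ (σ ⟨$⟩ʳ u)
    ∈-permuted⁻ x {v} v∈ = ∈-map⁻ (σ ⟨$⟩ʳ_) (subst (v ∈ₗ_) (vertices-permuted x) v∈)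

  module _ {e e′ : Subset n} (to : ∀ {v} → v ∈ e → (σ ⟨$⟩ʳ v) ∈ e′) (from : ∀ {v} → (σ ⟨$⟩ʳ v) ∈ e′ → v ∈ e) where

    support-permuted : ∀ {m} (x : Item n m) → support (permuteItem σ x) ≡ e′ → support x ≡ e
    support-permuted x refl = ⊆-antisym
      (λ v∈ → from (∈-⋃-singletons⁺ (∈-permuted⁺ x (∈-⋃-singletons⁻ (vertices x) v∈))))
      (λ {v} v∈ → ∈-⋃-singletons⁺ (back (∈-permuted⁻ x (∈-⋃-singletons⁻ (vertices (permuteItem σ x)) (to v∈)))))
      where
      back : ∀ {v} → ∃[ u ] u ∈ₗ vertices x × (σ ⟨$⟩ʳ v) ≡ (σ ⟨$⟩ʳ u) → v ∈ₗ vertices x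
      back (u , u∈ , eq) = subst (_∈ₗ vertices x) (≡.sym (permuted-injective σ eq)) u∈

    support-permuted⁻ : ∀ {m} (x : Item n m) → support x ≡ e → support (permuteItem σ x) ≡ e′
    support-permuted⁻ x refl = ⊆-antisym
      (λ {v} v∈ → forth (∈-permuted⁻ x (∈-⋃-singletons⁻ (vertices (permuteItem σ x)) v∈)))
      (λ {v} v∈ → subst (_∈ support (permuteItem σ x)) (inverseʳ σ) (∈-⋃-singletons⁺ (∈-permuted⁺ x
        (∈-⋃-singletons⁻ (vertices x) (from (subst (_∈ e′) (≡.sym (inverseʳ σ)) v∈))))))
      where
      forth : ∀ {v} → ∃[ u ] u ∈ₗ vertices x × v ≡ (σ ⟨$⟩ʳ u) → v ∈ e′
      forth (u , u∈ , refl) = to (∈-⋃-singletons⁺ u∈)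

module Comparison {c ℓ₁ ℓ₂ ℓ₃} (F : OrderedField c ℓ₁ ℓ₂ ℓ₃) where
  open OrderedField F
    hiding (zero)
    renaming (_+_ to _+#_; _*_ to _*#_; refl to ≈-refl; sym to ≈-sym; trans to ≈-trans)
  open FieldNumerals F
  open Spectral F
  open FieldLemmas F
  open TraceExpansion F
  open Relabelling F
  open ColouredTraces F
  open EdgeTensors F
  open import Relation.Binary.Reasoning.Setoid setoid
  open import Algebra.Properties.AbelianGroup (CommutativeRing.+-abelianGroup commutativeRing) using (∙-cancelʳ)

  ∑-indicator : ∀ {a} {A : Set a} {P : A → Set} (P? : ∀ x → Dec (P x)) xs →
    ∑ xs (λ x → when (does (P? x)) 1#) ≈ fromℕ (length (filter P? xs))
  ∑-indicator P? []       = ≈-refl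
  ∑-indicator P? (x ∷ xs) with does (P? x)
  ... | true  = +-congˡ (∑-indicator P? xs)
  ... | false = ≈-trans (+-identityˡ _) (∑-indicator P? xs)

  ∑-when : ∀ {a} {A : Set a} b (xs : List A) (f : A → Carrier) → ∑ xs (λ x → when b (f x)) ≈ when b (∑ xs f)
  ∑-when true  xs f = ≈-refl
  ∑-when false xs f = ∑-0 xs λ _ _ → ≈-refl

  module _ (α : Carrier) (k : ℕ) where

    -- On the diagonal, summing the incidences over the edges gives the degree. In the adjacency
    -- part at most one edge equals the support, by uniqueness of the list.
    Aα-edgeTensor : ∀ {H : Hypergraph n} {es} → EdgeList H es → ∀ i γ → Aα k α H i γ ≈ tensorOf α k es i γ
    Aα-edgeTensor {n} {H} {es} edgeList i γ = ≈-sym (≈-trans (∑-distrib-+ es _ _) (+-cong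
      (≈-trans (≈-sym (*-distribˡ-∑ α es _)) (*-congˡ (≈-trans (∑-when (does (all? (i Fin.≟_) γ)) es _)
        (when-congʳ (does (all? (i Fin.≟_) γ)) (≈-trans (∑-indicator (i ∈?_) es) (reflexive (cong fromℕ degree≡)))))))
      (≈-trans (≈-sym (*-distribˡ-∑ (1# - α) es _)) (*-congˡ adjacency))))
      where
      open EdgeList edgeList
      degree≡ : length (filter (i ∈?_) es) ≡ degree H i
      degree≡ = ↭.↭-length (unique-↭ (Unique.filter⁺ (i ∈?_) unique)
        (Unique.filter⁺ (λ e → edge? H e ×-dec i ∈? e) (subsets-unique n))
        (λ e∈ → let e∈es , i∈ = ∈-filter⁻ (i ∈?_) {xs = es} e∈ in
          ∈-filter⁺ (λ e → edge? H e ×-dec i ∈? e) (∈-subsets _) (sound e∈es , i∈))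
        (λ e∈ → let _ , edge , i∈ = ∈-filter⁻ (λ e → edge? H e ×-dec i ∈? e) {xs = subsets n} e∈ in
          ∈-filter⁺ (i ∈?_) (complete edge) i∈))
      adjacency : ∑ es (λ e → when (does (support (i , γ) ≟ˢ e)) (1/ (k ∸ 1) !)) ≈ adjacencyTensor k H i γ
      adjacency with edge? H (support (i , γ))
      ... | yes edge = ∑-when-unique es (support (i , γ) ≟ˢ_) (λ _ → 1/ (k ∸ 1) !) unique (complete edge) refl ≡.sym
      ... | no ¬edge = ∑-0 es λ e e∈ → reflexive (cong (λ b → when b (1/ (k ∸ 1) !))
        (dec-false (support (i , γ) ≟ˢ e) λ { refl → ¬edge (sound e∈) }))

    module _ (σ : Permutation′ n) {e e′ : Subset n}
      (to : ∀ {v} → v ∈ e → (σ ⟨$⟩ʳ v) ∈ e′) (from : ∀ {v} → (σ ⟨$⟩ʳ v) ∈ e′ → v ∈ e) where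

      edgeEntry-permuted : ∀ x → edgeEntry α k e′ (permuteItem σ x) ≈ edgeEntry α k e x
      edgeEntry-permuted x@(i , γ) = reflexive (cong₂ _+#_
        (cong (α *#_) (cong₂ (λ b b′ → when b (when b′ 1#))
          (does-⇔ (mk⇔ (VecAll.map (permuted-injective σ) ∘ VecAll.map⁻) (VecAll.map⁺ ∘ VecAll.map (cong (σ ⟨$⟩ʳ_))))
            (all? ((σ ⟨$⟩ʳ i) Fin.≟_) (Vec.map (σ ⟨$⟩ʳ_) γ)) (all? (i Fin.≟_) γ))
          (does-⇔ (mk⇔ from to) ((σ ⟨$⟩ʳ i) ∈? e′) (i ∈? e))))
        (cong ((1# - α) *#_) (cong (λ b → when b (1/ (k ∸ 1) !))
          (does-⇔ (mk⇔ (support-permuted σ to from x) (support-permuted⁻ σ to from x))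
            (support (permuteItem σ x) ≟ˢ e′) (support x ≟ˢ e)))))

    edgeTensor-permuted : ∀ (σ : Permutation′ n) {a} {A : Set a} (as : List A) {g g′ : A → Subset n} →
      (∀ a {v} → v ∈ g a → (σ ⟨$⟩ʳ v) ∈ g′ a) → (∀ a {v} → (σ ⟨$⟩ʳ v) ∈ g′ a → v ∈ g a) → ∀ x →
      edgeTensor α k (List.map g′ as) (permuteItem σ x) ≈ edgeTensor α k (List.map g as) x
    edgeTensor-permuted σ as to from x = ≈-trans (reflexive (∑-map _ as _))
      (≈-trans (∑-cong as λ a → edgeEntry-permuted σ (to a) (from a) x) (≈-sym (reflexive (∑-map _ as _))))

  *-pos-monoˡ-< : ∀ {a x y} → 0# < a → x < y → a *# x < a *# y
  *-pos-monoˡ-< {a} {x} {y} 0<a x<y = <-resp (+-identityˡ _)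
    (≈-trans (≈-sym (distribˡ a _ x)) (*-congˡ (≈-trans (+-assoc y (- x) x) (≈-trans (+-congˡ (-‿inverseˡ x)) (+-identityʳ y)))))
    (+-monoˡ-< (a *# x) (*-pos 0<a (<-resp (-‿inverseʳ x) ≈-refl (+-monoˡ-< (- x) x<y))))

  module _ (α : Carrier) (k : ℕ) where

    Tr-edges : ∀ {H : Hypergraph n} {es} → EdgeList H es → ∀ {t} → 1 ≤ t →
      Tr k t (Aα k α H) ≈ fromℕ ((k ∸ 1) ^ (n ∸ 1)) *# trace k t (tensorOf α k es)
    Tr-edges {H = H} {es} edges {suc t} _ = ≈-trans (Tr-expansion k t (Aα k α H))
      (*-congˡ (trace-cong k (suc t) {Aα k α H} {tensorOf α k es} (Aα-edgeTensor α k edges)))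

  -- The order `SαLess` bounds d by a quantity involving a power of k - 1; since that power is at
  -- least 1, it suffices that d is smaller than n. At t = 0 the traces depend on n and k only.
  SαLess-edges : ∀ α κ (let k = suc (suc κ)) {G H : Hypergraph n} {gs hs} → EdgeList G gs → EdgeList H hs →
    ∀ d → 1 ≤ d → suc d ≤ n →
    (∀ t → t ℕ.< d → trace k t (tensorOf α k gs) ≈ trace k t (tensorOf α k hs)) →
    trace k d (tensorOf α k gs) < trace k d (tensorOf α k hs) → SαLess k α G H
  SαLess-edges {n} α κ {G} {H} gsᴱ hsᴱ d 1≤d d<n agree differ =
    d , 1≤d , ℕ.∸-monoˡ-≤ 1 (ℕ.≤-trans d<n (ℕ.m≤m*n n (suc κ ^ (n ∸ 1)) {{ℕ.m^n≢0 (suc κ) (n ∸ 1)}})) , equal ,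
    <-resp (≈-sym (Tr-edges α k gsᴱ 1≤d)) (≈-sym (Tr-edges α k hsᴱ 1≤d))
      (*-pos-monoˡ-< (fromℕ-pos (ℕ.m^n>0 (suc κ) (n ∸ 1))) differ)
    where
    k = suc (suc κ)
    equal : ∀ t → t ℕ.< d → Tr k t (Aα k α G) ≈ Tr k t (Aα k α H)
    equal zero    t<d = ≈-refl
    equal (suc t) t<d = ≈-trans (Tr-edges α k gsᴱ (s≤s z≤n)) (≈-trans (*-congˡ (agree (suc t) t<d))
      (≈-sym (Tr-edges α k hsᴱ (s≤s z≤n))))

  module _ (α : Carrier) (0<α : 0# < α) (α<1 : α < 1#) (κ : ℕ) where

    private
      k : ℕ
      k = suc (suc κ)

    -- Both hypergraphs split into one path with hosts attached to its edges
    -- a and b; for the second, the path is read backwards.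
    module _ {n r : ℕ} {f : Fin (suc r) → Subset n} (path : PathSystem k f) (path′ : PathSystem k (f ∘ opposite))
      {A : Set} (as : List A) (g g′ : A → Subset n) (a b : Fin (suc r))
      (attached  : ∀ {q} → q ∈ₗ List.map g as → ∀ {v i} → v ∈ q → v ∈ f i → i ≡ a)
      (attached′ : ∀ {q} → q ∈ₗ List.map g′ as → ∀ {v i} → v ∈ q → v ∈ f (opposite i) → i ≡ b)
      (σ : Permutation′ n)
      (f-to   : ∀ j {v} → v ∈ f (inject₁ j) → (σ ⟨$⟩ʳ v) ∈ f (suc j))
      (f-from : ∀ j {v} → (σ ⟨$⟩ʳ v) ∈ f (suc j) → v ∈ f (inject₁ j))
      (g-to   : ∀ s {v} → v ∈ g′ s → (σ ⟨$⟩ʳ v) ∈ g s)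
      (g-from : ∀ s {v} → (σ ⟨$⟩ʳ v) ∈ g s → v ∈ g′ s)
      where

      private
        module P  = PathTraces α 0<α α<1 κ path (List.map g as) a attached
        module P′ = PathTraces α 0<α α<1 κ path′ (List.map g′ as) b attached′

        tr : ℕ → List (Subset n) → Carrier
        tr t es = trace k t (tensorOf α k es)

        tr-↭ : ∀ t {es es′} → es ↭ es′ → tr t es ≈ tr t es′
        tr-↭ t {es} {es′} p = trace-cong k t {tensorOf α k es} {tensorOf α k es′} λ i γ → ∑-↭ _ p

        edges↭ : P′.edges ↭ P.edges
        edges↭ = ↭-trans (↭-reflexive (List.map-∘ (allFin (suc r)))) (↭.map⁺ f (allFin-permuted Perm.reverse))

        later≡ : P.later ≡ List.map (f ∘ suc) (allFin r)
        later≡ = ≡.trans (cong (List.map f) (≡.sym (List.map-tabulate id suc))) (≡.sym (List.map-∘ (allFin r)))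

        later↭ : P′.later ↭ List.map (f ∘ inject₁) (allFin r)
        -- By computation `opposite (suc i)` is `inject₁ (opposite i)`: dropping the pendant edge of
        -- the reversed path leaves the edges `inject₁ j`.
        later↭ = ↭-trans (↭-reflexive (≡.trans (List.map-tabulate suc (f ∘ opposite))
            (≡.trans (≡.sym (List.map-tabulate id (f ∘ inject₁ ∘ opposite))) (List.map-∘ (allFin r)))))
          (↭.map⁺ (f ∘ inject₁) (allFin-permuted Perm.reverse))

        later-permuted : ∀ x → edgeTensor α k P.later (permuteItem σ x) ≈ edgeTensor α k P′.later x
        later-permuted x = begin
          edgeTensor α k P.later (permuteItem σ x)
            ≡⟨ cong (λ es → edgeTensor α k es (permuteItem σ x)) later≡ ⟩
          edgeTensor α k (List.map (f ∘ suc) (allFin r)) (permuteItem σ x)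
            ≈⟨ edgeTensor-permuted α k σ (allFin r) f-to f-from x ⟩
          edgeTensor α k (List.map (f ∘ inject₁) (allFin r)) x
            ≈⟨ ∑-↭ _ later↭ ⟨
          edgeTensor α k P′.later x ∎

      trace-later : ∀ t → tr t P.later ≈ tr t P′.later
      trace-later t = trace-permuted k σ t {tensorOf α k P.later} {tensorOf α k P′.later} λ i γ → later-permuted (i , γ)

      trace-later-hosts : ∀ t → tr t (P.later ++ List.map g as) ≈ tr t (P′.later ++ List.map g′ as)
      trace-later-hosts t = trace-permuted k σ t
        {tensorOf α k (P.later ++ List.map g as)} {tensorOf α k (P′.later ++ List.map g′ as)} λ i γ → ≈-trans (∑-++ P.later (List.map g as) _) (≈-trans
        (+-cong (later-permuted (i , γ)) (edgeTensor-permuted α k σ as g-to g-from (i , γ)))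
        (≈-sym (∑-++ P′.later (List.map g′ as) _)))

      -- The splittings of the two hypergraphs share all terms except the mixed ones, and below the
      -- threshold belonging to b the mixed term of the second vanishes.
      trace-difference : ∀ t → t ℕ.< toℕ b * k + 2 →
        tr t (List.map f (allFin (suc r)) ++ List.map g as) ≈
        tr t (List.map f (allFin (suc r)) ++ List.map g′ as) +# P.mixedTrace t
      trace-difference t t< = ∙-cancelʳ (tr t P.later) _ _ (begin
        tr t (P.edges ++ List.map g as) +# tr t P.later
          ≈⟨ P.trace-split t ⟩
        (tr t P.edges +# tr t (P.later ++ List.map g as)) +# P.mixedTrace t
          ≈⟨ +-congʳ (+-cong (≈-sym (tr-↭ t edges↭)) (trace-later-hosts t)) ⟩
        (tr t P′.edges +# tr t (P′.later ++ List.map g′ as)) +# P.mixedTrace t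
          -- The vanishing mixed term is inserted so that the splitting of the second hypergraph can
          -- be applied from right to left.
          ≈⟨ +-congʳ (≈-trans (+-congˡ (P′.mixedTrace-short t t<)) (+-identityʳ _)) ⟨
        ((tr t P′.edges +# tr t (P′.later ++ List.map g′ as)) +# P′.mixedTrace t) +# P.mixedTrace t
          ≈⟨ +-congʳ (P′.trace-split t) ⟨
        (tr t (P′.edges ++ List.map g′ as) +# tr t P′.later) +# P.mixedTrace t
          ≈⟨ ≈-trans (+-assoc _ _ _) (≈-trans (+-congˡ (+-comm _ _)) (≈-sym (+-assoc _ _ _))) ⟩
        (tr t (P′.edges ++ List.map g′ as) +# P.mixedTrace t) +# tr t P′.later
          ≈⟨ +-cong (+-congʳ (tr-↭ t (↭.++⁺ʳ _ edges↭))) (≈-sym (trace-later t)) ⟩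
        (tr t (P.edges ++ List.map g′ as) +# P.mixedTrace t) +# tr t P.later ∎)

      module _ (a<b : toℕ a ℕ.< toℕ b) where

        private
          below : ∀ {t} → t ≤ toℕ a * k + 2 → t ℕ.< toℕ b * k + 2
          below t≤ = ℕ.≤-<-trans t≤ (ℕ.+-monoˡ-< 2 (ℕ.*-monoˡ-< k a<b))

        traces-agree : ∀ t → t ℕ.< toℕ a * k + 2 →
          tr t (List.map f (allFin (suc r)) ++ List.map g′ as) ≈ tr t (List.map f (allFin (suc r)) ++ List.map g as)
        traces-agree t t< = ≈-sym (≈-trans (trace-difference t (below (ℕ.<⇒≤ t<)))
          (≈-trans (+-congˡ (P.mixedTrace-short t t<)) (+-identityʳ _)))

        traces-differ : ∀ a′ → a ≡ suc a′ → ∀ {x q} → x ∈ f a → q ∈ₗ List.map g as → x ∈ q →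
          tr (toℕ a * k + 2) (List.map f (allFin (suc r)) ++ List.map g′ as) <
          tr (toℕ a * k + 2) (List.map f (allFin (suc r)) ++ List.map g as)
        traces-differ a′ a≡ x∈ q∈ x∈q = <-resp (+-identityˡ _)
          (≈-trans (+-comm _ _) (≈-sym (trace-difference _ (below ℕ.≤-refl))))
          (+-monoˡ-< _ (P.mixedTrace-first a′ a≡ x∈ q∈ x∈q))

        SαLess-paths : ∀ a′ → a ≡ suc a′ → ∀ {G H : Hypergraph n} →
          EdgeList G (List.map f (allFin (suc r)) ++ List.map g′ as) →
          EdgeList H (List.map f (allFin (suc r)) ++ List.map g as) →
          suc (toℕ a * k + 2) ≤ n → ∀ {x q} → x ∈ f a → q ∈ₗ List.map g as → x ∈ q → SαLess k α G H
        SαLess-paths a′ a≡ gsᴱ hsᴱ d<n x∈ q∈ x∈q = SαLess-edges α κ gsᴱ hsᴱ (toℕ a * k + 2)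
          (ℕ.≤-trans (s≤s z≤n) (ℕ.m≤n+m 2 (toℕ a * k))) d<n traces-agree (traces-differ a′ a≡ x∈ q∈ x∈q)

-- The hyperpath

∈-image⁺ : ∀ (g : Fin n → Fin m) {s u} → u ∈ s → g u ∈ image g s
∈-image⁺ g {s} {u} u∈ = Vec.lookup⇒[]= (g u) _ (≡.trans (Vec.lookup∘tabulate _ (g u))
  (dec-true (Fin.any? λ w → w ∈? s ×-dec g w Fin.≟ g u) (u , u∈ , refl)))

∈-image⁻ : ∀ (g : Fin n → Fin m) {s v} → v ∈ image g s → ∃[ u ] u ∈ s × g u ≡ v
∈-image⁻ g {s} {v} v∈
  with Fin.any? (λ w → w ∈? s ×-dec g w Fin.≟ v)
     | ≡.trans (≡.sym (Vec.lookup∘tabulate (λ v → does (Fin.any? λ w → w ∈? s ×-dec g w Fin.≟ v)) v)) (Vec.[]=⇒lookup v∈)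
... | yes found | _ = found

module _ (g : Fin n → Fin m) (g-injective : ∀ {u v} → g u ≡ g v → u ≡ v) where

  ∈-image-injective : ∀ {s u} → g u ∈ image g s → u ∈ s
  ∈-image-injective {s} gu∈ with w , w∈ , eq ← ∈-image⁻ g gu∈ = subst (_∈ s) (g-injective eq) w∈

  image-injective : ∀ {s t} → image g s ≡ image g t → s ≡ t
  image-injective {s} {t} eq = ⊆-antisym
    (λ {v} v∈ → ∈-image-injective (subst (g v ∈_) eq (∈-image⁺ g v∈)))
    (λ {v} v∈ → ∈-image-injective (subst (g v ∈_) (≡.sym eq) (∈-image⁺ g v∈)))

  PathSystem-image : ∀ {k r} {f : Fin r → Subset n} → PathSystem k f → PathSystem k (image g ∘ f)
  PathSystem-image {k} {f = f} path = record
    { near = λ i j v∈i v∈j → let u , u∈ , eq = ∈-image⁻ g v∈i in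
        near i j u∈ (∈-image-injective (subst (_∈ image g (f j)) (≡.sym eq) v∈j))
    ; joint = λ i j j≡ → let p , p∈i , p∈j , only-p = joint i j j≡ in
        g p , ∈-image⁺ g p∈i , ∈-image⁺ g p∈j , λ v∈i v∈j → let u , u∈ , eq = ∈-image⁻ g v∈i in
          ≡.trans (≡.sym eq) (cong g (only-p u∈ (∈-image-injective (subst (_∈ image g (f j)) (≡.sym eq) v∈j))))
    ; enumerate = λ i → let open Enumeration (enumerate i) in record
        { elements = List.map g elements
        ; unique   = Unique.map⁺ g-injective unique
        ; size     = ≡.trans (List.length-map g elements) size
        ; complete = λ v∈ → let u , u∈ , eq = ∈-image⁻ g v∈ in subst (_∈ₗ _) eq (∈-map⁺ g (complete u∈))
        ; sound    = λ v∈ → let u , u∈ , eq = ∈-map⁻ g v∈ in subst (_∈ _) (≡.sym eq) (∈-image⁺ g (sound u∈))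
        }
    }
    where open PathSystem path

toℕ-opposite : ∀ (i : Fin n) → suc (toℕ i + toℕ (opposite i)) ≡ n
toℕ-opposite {n} i = ≡.trans (cong (λ d → suc (toℕ i + d)) (Fin.opposite-prop i)) (ℕ.m+[n∸m]≡n (Fin.toℕ<n i))

PathSystem-opposite : ∀ {k r} {f : Fin r → Subset n} → PathSystem k f → PathSystem k (f ∘ opposite)
PathSystem-opposite {r = r} path = record
  { near      = λ i j v∈i v∈j → reflect i j (near (opposite j) (opposite i) v∈j v∈i)
  ; joint     = λ i j j≡ →
      let p , p∈j , p∈i , only-p = joint (opposite j) (opposite i) (reflect-suc i j j≡) in
      p , p∈i , p∈j , λ v∈i v∈j → only-p v∈j v∈i
  ; enumerate = enumerate ∘ opposite
  }
  where
  open PathSystem path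
  open ℕ.≤-Reasoning
  sums : ∀ i j → toℕ i + toℕ (opposite i) ≡ toℕ j + toℕ (opposite j)
  sums i j = ℕ.suc-injective (≡.trans (toℕ-opposite i) (≡.sym (toℕ-opposite j)))
  reflect : ∀ (i j : Fin r) → toℕ (opposite j) ≤ suc (toℕ (opposite i)) → toℕ i ≤ suc (toℕ j)
  reflect i j h = ℕ.+-cancelʳ-≤ (toℕ (opposite i)) (toℕ i) (suc (toℕ j)) (begin
    toℕ i + toℕ (opposite i)       ≡⟨ sums i j ⟩
    toℕ j + toℕ (opposite j)       ≤⟨ ℕ.+-monoʳ-≤ (toℕ j) h ⟩
    toℕ j + suc (toℕ (opposite i)) ≡⟨ ℕ.+-suc (toℕ j) _ ⟩
    suc (toℕ j) + toℕ (opposite i) ∎)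
  reflect-suc : ∀ (i j : Fin r) → toℕ j ≡ suc (toℕ i) → toℕ (opposite i) ≡ suc (toℕ (opposite j))
  reflect-suc i j j≡ = ℕ.+-cancelˡ-≡ (toℕ i) _ _ (≡.trans (sums i j)
    (≡.trans (cong (_+ toℕ (opposite j)) j≡) (≡.sym (ℕ.+-suc (toℕ i) _))))

-- Permutations of sums and products, rotations and exchanges

sumPermutation : Permutation′ m → Permutation′ n → Permutation′ (m + n)
sumPermutation π ρ = ↔-trans Fin.+↔⊎ (↔-trans (π ⊎-↔ ρ) (↔-sym Fin.+↔⊎))

module _ (π : Permutation′ m) (ρ : Permutation′ n) where

  sumPermutation-↑ˡ : ∀ i → sumPermutation π ρ ⟨$⟩ʳ (i ↑ˡ n) ≡ (π ⟨$⟩ʳ i) ↑ˡ n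
  sumPermutation-↑ˡ i rewrite Fin.splitAt-↑ˡ m i n = refl

  sumPermutation-↑ʳ : ∀ i → sumPermutation π ρ ⟨$⟩ʳ (m ↑ʳ i) ≡ m ↑ʳ (ρ ⟨$⟩ʳ i)
  sumPermutation-↑ʳ i rewrite Fin.splitAt-↑ʳ m n i = refl

productPermutation : Permutation′ m → Permutation′ n → Permutation′ (m * n)
productPermutation π ρ = ↔-trans Fin.*↔× (↔-trans (π ×-↔ ρ) (↔-sym Fin.*↔×))

productPermutation-combine : ∀ (π : Permutation′ m) (ρ : Permutation′ n) i j →
  productPermutation π ρ ⟨$⟩ʳ Fin.combine i j ≡ Fin.combine (π ⟨$⟩ʳ i) (ρ ⟨$⟩ʳ j)
productPermutation-combine π ρ i j = cong (λ (a , b) → Fin.combine (π ⟨$⟩ʳ a) (ρ ⟨$⟩ʳ b)) (Fin.remQuot-combine i j)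

-- The cyclic shift by one; the last element goes to `zero`.
rotation : ∀ n → Permutation′ (suc n)
rotation n = insert (Fin.fromℕ n) zero Perm.id

rotation-inject₁ : ∀ {n} (i : Fin n) → rotation n ⟨$⟩ʳ inject₁ i ≡ suc i
rotation-inject₁ {n} i = ≡.trans (cong (rotation n ⟨$⟩ʳ_) (≡.sym (punchIn-fromℕ i))) (insert-punchIn (Fin.fromℕ n) zero Perm.id i)
  where
  punchIn-fromℕ : ∀ {n} (i : Fin n) → punchIn (Fin.fromℕ n) i ≡ inject₁ i
  punchIn-fromℕ zero    = refl
  punchIn-fromℕ (suc i) = cong suc (punchIn-fromℕ i)

rotation-suc⁻ : ∀ {n} {v : Fin (suc n)} {i} → rotation n ⟨$⟩ʳ v ≡ suc i → v ≡ inject₁ i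
rotation-suc⁻ {n} {i = i} eq = permuted-injective (rotation n) (≡.trans eq (≡.sym (rotation-inject₁ i)))

module _ {u w : Fin n} {s : Subset n} (u⇒w : u ∈ s → w ∈ s) (w⇒u : w ∈ s → u ∈ s) where

  ∈-transpose⁺ : ∀ {v} → v ∈ s → (transpose u w ⟨$⟩ʳ v) ∈ s
  ∈-transpose⁺ {v} v∈ with v Fin.≟ u
  ... | yes refl = u⇒w v∈
  ... | no _ with v Fin.≟ w
  ...   | yes refl = w⇒u v∈
  ...   | no _     = v∈

  ∈-transpose⁻ : ∀ {v} → (transpose u w ⟨$⟩ʳ v) ∈ s → v ∈ s
  ∈-transpose⁻ {v} v∈ with v Fin.≟ u
  ... | yes refl = w⇒u v∈
  ... | no _ with v Fin.≟ w
  ...   | yes refl = u⇒w v∈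
  ...   | no _     = v∈

transpose-left : ∀ (u w : Fin n) → transpose u w ⟨$⟩ʳ u ≡ w
transpose-left u w with u Fin.≟ u
... | yes _  = refl
... | no u≢u = contradiction refl u≢u

-- The hyperpath as a path system

module Hyperpath (k r : ℕ) where

  spine : Fin (suc r) → Fin (hyperpathSize k r)
  spine a = a ↑ˡ (r * (k ∸ 2))

  core : Fin r → Fin (k ∸ 2) → Fin (hyperpathSize k r)
  core i j = suc r ↑ʳ Fin.combine i j

  data View : Fin (hyperpathSize k r) → Set where
    on-spine : ∀ a → View (spine a)
    in-core  : ∀ i j → View (core i j)

  view : ∀ v → View v
  view v with splitAt (suc r) v in eq
  ... | inj₁ a = subst View (Fin.splitAt⁻¹-↑ˡ eq) (on-spine a)
  ... | inj₂ w = subst View (≡.trans (cong (suc r ↑ʳ_) (Fin.combine-remQuot {r} (k ∸ 2) w)) (Fin.splitAt⁻¹-↑ʳ eq))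
    (in-core (proj₁ (Fin.remQuot {r} (k ∸ 2) w)) (proj₂ (Fin.remQuot {r} (k ∸ 2) w)))

  edge : Fin r → Subset (hyperpathSize k r)
  edge = hyperpathEdge k r

  private
    ends : Fin r → Subset (suc r)
    ends i = ⁅ inject₁ i ⁆ Subset.∪ ⁅ suc i ⁆

    blocks : Fin r → Vec (Subset (k ∸ 2)) r
    blocks i = Vec.replicate r Subset.⊥ Vec.[ i ]≔ Subset.⊤

    lookup-core : ∀ i i′ j → lookup (edge i) (core i′ j) ≡ lookup (lookup (blocks i) i′) j
    lookup-core i i′ j = ≡.trans (Vec.lookup-++ʳ (ends i) (Vec.concat (blocks i)) (Fin.combine i′ j))
      (Vec.lookup-concat (blocks i) i′ j)

  spine∈⁺ : ∀ {i a} → a ≡ inject₁ i ⊎ a ≡ suc i → spine a ∈ edge i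
  spine∈⁺ {i} {a} h = Vec.lookup⇒[]= (spine a) (edge i) (≡.trans (Vec.lookup-++ˡ (ends i) (Vec.concat (blocks i)) a)
    (Vec.[]=⇒lookup (x∈p∪q⁺ (ends∈ h))))
    where
    ends∈ : a ≡ inject₁ i ⊎ a ≡ suc i → a ∈ ⁅ inject₁ i ⁆ ⊎ a ∈ ⁅ suc i ⁆
    ends∈ (inj₁ refl) = inj₁ (x∈⁅x⁆ a)
    ends∈ (inj₂ refl) = inj₂ (x∈⁅x⁆ a)

  spine∈⁻ : ∀ {i a} → spine a ∈ edge i → a ≡ inject₁ i ⊎ a ≡ suc i
  spine∈⁻ {i} {a} a∈ with x∈p∪q⁻ ⁅ inject₁ i ⁆ ⁅ suc i ⁆ (Vec.lookup⇒[]= a (ends i)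
    (≡.trans (≡.sym (Vec.lookup-++ˡ (ends i) (Vec.concat (blocks i)) a)) (Vec.[]=⇒lookup a∈)))
  ... | inj₁ p = inj₁ (x∈⁅y⁆⇒x≡y _ p)
  ... | inj₂ p = inj₂ (x∈⁅y⁆⇒x≡y _ p)

  core∈⁺ : ∀ {i j} → core i j ∈ edge i
  core∈⁺ {i} {j} = Vec.lookup⇒[]= (core i j) (edge i) (≡.trans (lookup-core i i j)
    (≡.trans (cong (λ s → lookup s j) (Vec.lookup∘update i (Vec.replicate r _) _)) (Vec.[]=⇒lookup (∈⊤ {x = j}))))

  core∈⁻ : ∀ {i i′ j} → core i′ j ∈ edge i → i′ ≡ i
  core∈⁻ {i} {i′} {j} c∈ with i′ Fin.≟ i
  ... | yes eq = eq
  ... | no  ≢i = contradiction (Vec.lookup⇒[]= j _ (≡.trans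
    (cong (λ s → lookup s j) (≡.sym (≡.trans (Vec.lookup∘update′ ≢i (Vec.replicate r Subset.⊥) _) (Vec.lookup-replicate i′ _))))
    (≡.trans (≡.sym (lookup-core i i′ j)) (Vec.[]=⇒lookup c∈)))) ∉⊥

  private
    spine-bounds : ∀ {i a} → spine a ∈ edge i → toℕ i ≤ toℕ a × toℕ a ≤ suc (toℕ i)
    spine-bounds {i} a∈ with spine∈⁻ a∈
    ... | inj₁ refl = ℕ.≤-reflexive (≡.sym (Fin.toℕ-inject₁ i)) , ℕ.m≤n⇒m≤1+n (ℕ.≤-reflexive (Fin.toℕ-inject₁ i))
    ... | inj₂ refl = ℕ.n≤1+n _ , ℕ.≤-refl

    spine≢core : ∀ {a i j} → spine a ≢ core i j
    spine≢core {a} {i} {j} eq with () ← ≡.trans (≡.sym (Fin.splitAt-↑ˡ (suc r) a _))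
      (≡.trans (cong (splitAt (suc r)) eq) (Fin.splitAt-↑ʳ (suc r) _ (Fin.combine i j)))

    spine-injective : ∀ {a b} → spine a ≡ spine b → a ≡ b
    spine-injective = Fin.↑ˡ-injective _ _ _

    core-injective : ∀ {i j j′} → core i j ≡ core i j′ → j ≡ j′
    core-injective {i} {j} {j′} eq = Fin.combine-injectiveʳ i j i j′ (Fin.↑ʳ-injective (suc r) _ _ eq)

  inject₁≢suc : ∀ (i : Fin r) → inject₁ i ≢ suc i
  inject₁≢suc i eq = ℕ.1+n≢n (≡.trans (≡.sym (cong toℕ eq)) (Fin.toℕ-inject₁ i))

  hyperpath-path : 2 ≤ k → PathSystem k edge
  hyperpath-path 2≤k = record { near = near ; joint = joint ; enumerate = enumerate }
    where
    near : ∀ i j {v} → v ∈ edge i → v ∈ edge j → toℕ i ≤ suc (toℕ j)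
    near i j {v} v∈i v∈j with view v
    ... | on-spine a = ℕ.≤-trans (proj₁ (spine-bounds v∈i)) (proj₂ (spine-bounds v∈j))
    ... | in-core i′ c with refl ← core∈⁻ {j = c} v∈i | refl ← core∈⁻ {j = c} v∈j = ℕ.n≤1+n _
    joint : ∀ i j → toℕ j ≡ suc (toℕ i) →
      ∃[ p ] p ∈ edge i × p ∈ edge j × (∀ {v} → v ∈ edge i → v ∈ edge j → v ≡ p)
    joint i j j≡ = spine (suc i) , spine∈⁺ (inj₂ refl) ,
      spine∈⁺ (inj₁ (Fin.toℕ-injective (≡.trans (≡.sym j≡) (≡.sym (Fin.toℕ-inject₁ j))))) , unique-joint
      where
      unique-joint : ∀ {v} → v ∈ edge i → v ∈ edge j → v ≡ spine (suc i)
      unique-joint {v} v∈i v∈j with view v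
      ... | on-spine a = cong spine (Fin.toℕ-injective (ℕ.≤-antisym (proj₂ (spine-bounds v∈i))
        (subst (_≤ toℕ a) j≡ (proj₁ (spine-bounds v∈j)))))
      ... | in-core i′ c with refl ← core∈⁻ {j = c} v∈i | refl ← core∈⁻ {j = c} v∈j = contradiction (≡.sym j≡) ℕ.1+n≢n
    enumerate : ∀ i → Enumeration k (edge i)
    enumerate i = record
      { elements = spine (inject₁ i) ∷ spine (suc i) ∷ List.map (core i) (allFin (k ∸ 2))
      ; unique   = ((λ eq → inject₁≢suc i (spine-injective eq)) ∷ spine∉) ∷ spine∉ ∷ Unique.map⁺ core-injective (allFin⁺ (k ∸ 2))
      ; size     = ≡.trans (cong (2 +_) (≡.trans (List.length-map (core i) (allFin (k ∸ 2))) (List.length-tabulate id)))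
          (ℕ.m+[n∸m]≡n 2≤k)
      ; complete = complete
      ; sound    = sound
      }
      where
      spine∉ : ∀ {a} → All (spine a ≢_) (List.map (core i) (allFin (k ∸ 2)))
      spine∉ = All.map⁺ (All.tabulate λ _ → spine≢core)
      complete : ∀ {v} → v ∈ edge i → v ∈ₗ spine (inject₁ i) ∷ spine (suc i) ∷ List.map (core i) (allFin (k ∸ 2))
      complete {v} v∈ with view v
      ... | in-core i′ c with refl ← core∈⁻ {j = c} v∈ = there (there (∈-map⁺ (core i′) (∈-allFin c)))
      ... | on-spine a with spine∈⁻ v∈
      ...   | inj₁ refl = here refl
      ...   | inj₂ refl = there (here refl)
      sound : ∀ {v} → v ∈ₗ spine (inject₁ i) ∷ spine (suc i) ∷ List.map (core i) (allFin (k ∸ 2)) → v ∈ edge i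
      sound (here refl)         = spine∈⁺ (inj₁ refl)
      sound (there (here refl)) = spine∈⁺ (inj₂ refl)
      sound (there (there v∈)) with c , _ , refl ← ∈-map⁻ (core i) v∈ = core∈⁺

  -- For k ≥ 3 each edge owns an inserted vertex that lies on no other edge.
  edge-injective : 3 ≤ k → ∀ {i j} → edge i ≡ edge j → i ≡ j
  edge-injective 3≤k {i} eq = core∈⁻ {j = c} (subst (core i c ∈_) eq core∈⁺)
    where
    c = Fin.fromℕ< {0} (ℕ.∸-monoˡ-≤ 2 3≤k)

  hyperpath-edges : 3 ≤ k → EdgeList (hyperpath k r) (List.map edge (allFin r))
  hyperpath-edges 3≤k = record
    { unique   = Unique.map⁺ (edge-injective 3≤k) (allFin⁺ r)
    ; complete = λ { (i , refl) → ∈-map⁺ edge (∈-allFin i) }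
    ; sound    = λ e∈ → let i , _ , eq = ∈-map⁻ edge e∈ in i , eq
    }

  two-ends : ∀ i → ∃[ u ] ∃[ v ] u ∈ edge i × v ∈ edge i × u ≢ v
  two-ends i = _ , _ , spine∈⁺ (inj₁ refl) , spine∈⁺ (inj₂ refl) , λ eq → inject₁≢suc i (spine-injective eq)

  -- Degree one means that the list of incident edges is a singleton; equality of edges then becomes
  -- equality of indices.
  cored-edge : 3 ≤ k → ∀ {x i j} → degree (hyperpath k r) x ≡ 1 → x ∈ edge i → x ∈ edge j → i ≡ j
  cored-edge 3≤k {x} {i} {j} deg x∈i x∈j = edge-injective 3≤k (singleton _ deg (incident x∈i) (incident x∈j))
    where
    incident : ∀ {i} → x ∈ edge i → edge i ∈ₗ filter (λ e → edge? (hyperpath k r) e ×-dec x ∈? e) (subsets (hyperpathSize k r))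
    incident {i} x∈ = ∈-filter⁺ (λ e → edge? (hyperpath k r) e ×-dec x ∈? e) (∈-subsets (edge i)) ((i , refl) , x∈)
    singleton : ∀ {a} {A : Set a} (xs : List A) → length xs ≡ 1 → ∀ {y z} → y ∈ₗ xs → z ∈ₗ xs → y ≡ z
    singleton (_ ∷ []) refl (here refl) (here refl) = refl

module _ (k r : ℕ) where

  open Hyperpath k (suc r)

  -- Shifts the vertices of the path graph and the blocks of inserted vertices in step, the position
  -- within a block being kept. It is only meant to carry each edge but the last to its successor.
  hyperpath-rotation : Permutation′ (hyperpathSize k (suc r))
  hyperpath-rotation = sumPermutation (rotation (suc r)) (productPermutation (rotation r) Perm.id)

  rotation-spine : ∀ a → hyperpath-rotation ⟨$⟩ʳ spine a ≡ spine (rotation (suc r) ⟨$⟩ʳ a)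
  rotation-spine a = sumPermutation-↑ˡ (rotation (suc r)) (productPermutation (rotation r) Perm.id) a

  rotation-core : ∀ i j → hyperpath-rotation ⟨$⟩ʳ core i j ≡ core (rotation r ⟨$⟩ʳ i) j
  rotation-core i j = ≡.trans (sumPermutation-↑ʳ (rotation (suc r)) (productPermutation (rotation r) Perm.id) (Fin.combine i j))
    (cong (suc (suc r) ↑ʳ_) (productPermutation-combine (rotation r) (Perm.id {k ∸ 2}) i j))

  ∈-rotation⁺ : ∀ i {v} → v ∈ edge (inject₁ i) → (hyperpath-rotation ⟨$⟩ʳ v) ∈ edge (suc i)
  ∈-rotation⁺ i {v} v∈ with view v
  ... | in-core i′ c rewrite rotation-core i′ c with refl ← core∈⁻ {inject₁ i} {i′} {c} v∈ =
    subst (λ l → core l c ∈ edge (suc i)) (≡.sym (rotation-inject₁ i)) (core∈⁺ {suc i} {c})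
  ... | on-spine a rewrite rotation-spine a with spine∈⁻ {inject₁ i} {a} v∈
  ...   | inj₁ refl = spine∈⁺ (inj₁ (rotation-inject₁ (inject₁ i)))
  ...   | inj₂ refl = spine∈⁺ (inj₂ (rotation-inject₁ (suc i)))

  ∈-rotation⁻ : ∀ i {v} → (hyperpath-rotation ⟨$⟩ʳ v) ∈ edge (suc i) → v ∈ edge (inject₁ i)
  ∈-rotation⁻ i {v} v∈ with view v
  ... | in-core i′ c rewrite rotation-core i′ c =
    subst (λ l → core l c ∈ edge (inject₁ i)) (≡.sym (rotation-suc⁻ (core∈⁻ {suc i} {rotation r ⟨$⟩ʳ i′} {c} v∈))) (core∈⁺ {inject₁ i} {c})
  ... | on-spine a rewrite rotation-spine a with spine∈⁻ {suc i} {rotation (suc r) ⟨$⟩ʳ a} v∈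
  ...   | inj₁ eq = spine∈⁺ (inj₁ (rotation-suc⁻ eq))
  ...   | inj₂ eq = spine∈⁺ (inj₂ (rotation-suc⁻ eq))

-- Coalescence and path sliding

↑ˡ≢↑ʳ : ∀ {u : Fin n} {w : Fin m} → u ↑ˡ m ≢ n ↑ʳ w
↑ˡ≢↑ʳ {n} {m} {u} {w} eq with () ← ≡.trans (≡.sym (Fin.splitAt-↑ˡ n u m)) (≡.trans (cong (splitAt n) eq) (Fin.splitAt-↑ʳ n m w))

glueˡ-injective : ∀ {u v : Fin n} → glueˡ {m = m} u ≡ glueˡ v → u ≡ v
glueˡ-injective {m = m} = Fin.↑ˡ-injective m _ _

glueʳ-base : ∀ (x : Fin n) (y : Fin (suc m)) → glueʳ x y y ≡ glueˡ x
glueʳ-base x y with y Fin.≟ y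
... | yes _  = refl
... | no y≢y = contradiction refl y≢y

glueʳ-glueˡ : ∀ (x : Fin n) (y w : Fin (suc m)) {u} → glueʳ x y w ≡ glueˡ u → u ≡ x
glueʳ-glueˡ x y w eq with y Fin.≟ w
... | yes _ = ≡.sym (glueˡ-injective eq)
... | no  _ = contradiction (≡.sym eq) ↑ˡ≢↑ʳ

glueʳ-injective : ∀ (x : Fin n) (y : Fin (suc m)) {v w} → glueʳ x y v ≡ glueʳ x y w → v ≡ w
glueʳ-injective x y {v} {w} eq with y Fin.≟ v | y Fin.≟ w
... | yes refl | yes refl = refl
... | yes _    | no _     = contradiction eq ↑ˡ≢↑ʳ
... | no _     | yes _    = contradiction (≡.sym eq) ↑ˡ≢↑ʳ
... | no y≢v   | no y≢w   = Fin.punchOut-injective y≢v y≢w (Fin.↑ʳ-injective _ _ _ eq)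

-- An edge from H meets the vertices of G at most in x. The assumption that every edge of G has
-- another vertex therefore keeps the two lists disjoint.
coalescence-edges : ∀ {G : Hypergraph n} {H : Hypergraph (suc m)} {gs hs} (x : Fin n) (y : Fin (suc m)) →
  EdgeList G gs → EdgeList H hs → (∀ {s} → Edge G s → ∃[ u ] u ∈ s × u ≢ x) →
  EdgeList (coalescence G x H y) (List.map (image glueˡ) gs ++ List.map (image (glueʳ x y)) hs)
coalescence-edges {m = m} {G = G} {H} {gs} {hs} x y gsᴱ hsᴱ other = record
  { unique   = Unique.++⁺
      (Unique.map⁺ (image-injective glueˡ glueˡ-injective) (EdgeList.unique gsᴱ))
      (Unique.map⁺ (image-injective (glueʳ x y) (glueʳ-injective x y)) (EdgeList.unique hsᴱ))
      disjoint
  ; complete = λ where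
      (inj₁ (s , edge , refl)) → ∈-++⁺ˡ (∈-map⁺ (image glueˡ) (EdgeList.complete gsᴱ edge))
      (inj₂ (s , edge , refl)) → ∈-++⁺ʳ (List.map (image glueˡ) gs) (∈-map⁺ (image (glueʳ x y)) (EdgeList.complete hsᴱ edge))
  ; sound    = λ e∈ → sound (∈-++⁻ (List.map (image glueˡ) gs) e∈)
  }
  where
  disjoint : ∀ {e} → ¬ (e ∈ₗ List.map (image glueˡ) gs × e ∈ₗ List.map (image (glueʳ x y)) hs)
  disjoint (e∈gs , e∈hs)
    with s , s∈ , refl ← ∈-map⁻ (image glueˡ) e∈gs
    with t , t∈ , eq ← ∈-map⁻ (image (glueʳ x y)) e∈hs
    with u , u∈ , u≢x ← other (EdgeList.sound gsᴱ s∈)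
    with w , w∈ , eq′ ← ∈-image⁻ (glueʳ x y) (subst (glueˡ {m = m} u ∈_) eq (∈-image⁺ glueˡ u∈)) =
    u≢x (glueʳ-glueˡ x y w eq′)
  sound : ∀ {e} → e ∈ₗ List.map (image glueˡ) gs ⊎ e ∈ₗ List.map (image (glueʳ x y)) hs → Edge (coalescence G x H y) e
  sound (inj₁ e∈) with s , s∈ , refl ← ∈-map⁻ (image glueˡ) e∈ = inj₁ (s , EdgeList.sound gsᴱ s∈ , refl)
  sound (inj₂ e∈) with s , s∈ , refl ← ∈-map⁻ (image (glueʳ x y)) e∈ = inj₂ (s , EdgeList.sound hsᴱ s∈ , refl)

allEdges : Hypergraph n → List (Subset n)
allEdges {n} H = filter (edge? H) (subsets n)

allEdges-edges : (H : Hypergraph n) → EdgeList H (allEdges H)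
allEdges-edges {n} H = record
  { unique   = Unique.filter⁺ (edge? H) (subsets-unique n)
  ; complete = λ edge → ∈-filter⁺ (edge? H) (∈-subsets _) edge
  ; sound    = λ e∈ → proj₂ (∈-filter⁻ (edge? H) {xs = subsets n} e∈)
  }

incident-edge : ∀ (H : Hypergraph n) v → 1 ≤ degree H v → ∃[ e ] Edge H e × v ∈ e
incident-edge {n} H v 1≤ = nonempty _ 1≤ (λ e∈ → proj₂ (∈-filter⁻ (λ e → edge? H e ×-dec v ∈? e) {xs = subsets n} e∈))
  where
  nonempty : ∀ es → 1 ≤ length es → (∀ {e} → e ∈ₗ es → Edge H e × v ∈ e) → ∃[ e ] Edge H e × v ∈ e
  nonempty (e ∷ _) _ h = e , h (here refl)

module _ (σ : Permutation′ n) (m : ℕ) where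

  extend-glueˡ : ∀ u → sumPermutation σ (Perm.id {m}) ⟨$⟩ʳ glueˡ u ≡ glueˡ (σ ⟨$⟩ʳ u)
  extend-glueˡ = sumPermutation-↑ˡ σ (Perm.id {m})

  -- Both coalescences number the vertices of the host other than v in the same way, so the identity
  -- serves on them and only the glued vertex has to move.
  extend-glueʳ : ∀ {x y} → σ ⟨$⟩ʳ y ≡ x → ∀ v w → sumPermutation σ (Perm.id {m}) ⟨$⟩ʳ glueʳ y v w ≡ glueʳ x v w
  extend-glueʳ {y = y} eq v w with v Fin.≟ w
  ... | yes _  = ≡.trans (extend-glueˡ y) (cong glueˡ eq)
  ... | no v≢w = sumPermutation-↑ʳ σ (Perm.id {m}) (punchOut v≢w)

module _ (σ : Permutation′ n) {g g′ : Fin m → Fin n} {ρ : Fin m → Fin m}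
  (eq : ∀ u → σ ⟨$⟩ʳ g′ u ≡ g (ρ u)) where

  image-permuted⁺ : ∀ {s t} → (∀ {u} → u ∈ s → ρ u ∈ t) → ∀ {v} → v ∈ image g′ s → (σ ⟨$⟩ʳ v) ∈ image g t
  image-permuted⁺ {s} {t} h v∈ with u , u∈ , refl ← ∈-image⁻ g′ v∈ = subst (_∈ image g t) (≡.sym (eq u)) (∈-image⁺ g (h u∈))

  image-permuted⁻ : (∀ w → ∃[ u ] ρ u ≡ w) → ∀ {s t} → (∀ {u} → ρ u ∈ t → u ∈ s) →
    ∀ {v} → (σ ⟨$⟩ʳ v) ∈ image g t → v ∈ image g′ s
  image-permuted⁻ surj {s} {t} h v∈
    with w , w∈ , eq′ ← ∈-image⁻ g v∈
    with u , refl ← surj w =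
    subst (_∈ image g′ s) (permuted-injective σ (≡.trans (eq u) eq′)) (∈-image⁺ g′ (h w∈))

-- Arithmetic of the bound on l

half-bound : ∀ p r → suc (suc p) ≤ ⌈ suc r /2⌉ → suc (suc p) + p ≤ r
half-bound p r (s≤s h) = ℕ.≤-trans (ℕ.≤-reflexive (cong suc (≡.sym (ℕ.+-suc p p)))) (ℕ.≤-trans
  (ℕ.+-mono-≤ h (ℕ.≤-trans h (ℕ.⌊n/2⌋≤⌈n/2⌉ r))) (ℕ.≤-reflexive (ℕ.⌊n/2⌋+⌈n/2⌉≡n r)))

-- With k = 3 + κ, a hyperpath of 2p + 1 edges has 1 + (2p + 1)(k - 1) vertices. This exceeds d = pk
-- + 2 by at least 1, the remaining slack being `p * suc κ + κ`.
size-bound : ∀ p κ r → suc p + p ≤ suc r → suc (p * (3 + κ) + 2) ≤ hyperpathSize (3 + κ) (suc r)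
size-bound p κ r p≤r = begin
  suc (p * (3 + κ) + 2)
    ≡⟨ solve 2 (λ p κ → con 1 :+ (p :* (con 3 :+ κ) :+ con 2) := p :* (con 3 :+ κ) :+ con 3) refl p κ ⟩
  p * (3 + κ) + 3
    ≤⟨ ℕ.m≤m+n (p * (3 + κ) + 3) (p * suc κ + κ) ⟩
  p * (3 + κ) + 3 + (p * suc κ + κ)
    ≡⟨ solve 2 (λ p κ → p :* (con 3 :+ κ) :+ con 3 :+ (p :* (con 1 :+ κ) :+ κ) :=
         con 1 :+ (con 1 :+ p :+ p) :+ (con 1 :+ p :+ p) :* (con 1 :+ κ)) refl p κ ⟩
  suc (suc p + p) + (suc p + p) * suc κ
    ≤⟨ ℕ.+-mono-≤ (s≤s p≤r) (ℕ.*-monoˡ-≤ (suc κ) p≤r) ⟩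
  hyperpathSize (3 + κ) (suc r) ∎
  where
  open ℕ.≤-Reasoning
  open +-*-Solver

module PathSliding {c ℓ₁ ℓ₂ ℓ₃} (F : OrderedField c ℓ₁ ℓ₂ ℓ₃) where
  open OrderedField F using (Carrier; 0#; 1#; _<_)
  open Spectral F using (SαLess)
  open Comparison F

  module _ (α : Carrier) (0<α : 0# < α) (α<1 : α < 1#) (κ : ℕ) where

    private
      k : ℕ
      k = suc (suc κ)

    -- P plays the hyperpath and τ its rotation.
    module _ {n r m : ℕ} {P : Hypergraph n} {edge : Fin (suc r) → Subset n} (path : PathSystem k edge)
      (P-edges : EdgeList P (List.map edge (allFin (suc r))))
      (two-vertices : ∀ i → ∃[ u ] ∃[ v ] u ∈ edge i × v ∈ edge i × u ≢ v)
      (τ : Permutation′ n)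
      (τ-to   : ∀ j {v} → v ∈ edge (inject₁ j) → (τ ⟨$⟩ʳ v) ∈ edge (suc j))
      (τ-from : ∀ j {v} → (τ ⟨$⟩ʳ v) ∈ edge (suc j) → v ∈ edge (inject₁ j))
      (l : Fin r) (l-bound : suc (suc (toℕ l)) ≤ ⌈ suc r /2⌉)
      {x y : Fin n}
      (x∈ : x ∈ edge (suc l)) (x-cored : ∀ {i} → x ∈ edge i → i ≡ suc l)
      (y∈ : y ∈ edge (inject₁ l)) (y-cored : ∀ {i} → y ∈ edge i → i ≡ inject₁ l)
      (H₀ : Hypergraph (suc m)) (v₀ : Fin (suc m)) (v₀-edge : 1 ≤ degree H₀ v₀)
      (d<size : suc (suc (toℕ l) * k + 2) ≤ n + m) where

      private
        inˡ : Fin n → Fin (n + m)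
        inˡ = glueˡ

        glue : Fin n → Fin (suc m) → Fin (n + m)
        glue z = glueʳ z v₀

        f : Fin (suc r) → Subset (n + m)
        f = image inˡ ∘ edge

        hosts : Fin n → Subset (suc m) → Subset (n + m)
        hosts z = image (glue z)

        edgeList : ∀ z → EdgeList (coalescence P z H₀ v₀)
          (List.map f (allFin (suc r)) ++ List.map (hosts z) (allEdges H₀))
        edgeList z = subst (λ es → EdgeList (coalescence P z H₀ v₀) (es ++ List.map (hosts z) (allEdges H₀)))
          (≡.sym (List.map-∘ (allFin (suc r))))
          (coalescence-edges z v₀ P-edges (allEdges-edges H₀) other)
          where
          other : ∀ {s} → Edge P s → ∃[ u ] u ∈ s × u ≢ z
          other s-edge with i , _ , refl ← ∈-map⁻ edge (EdgeList.complete P-edges s-edge)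
            with u , v , u∈ , v∈ , u≢v ← two-vertices i with u Fin.≟ z
          ... | no  u≢z  = u , u∈ , u≢z
          ... | yes refl = v , v∈ , u≢v ∘ ≡.sym

        attach : ∀ {z i} → (∀ {j} → z ∈ edge j → j ≡ i) →
          ∀ {q} → q ∈ₗ List.map (hosts z) (allEdges H₀) → ∀ {v j} → v ∈ q → v ∈ f j → j ≡ i
        attach {z} z-cored q∈ {j = j} v∈q v∈f
          with s , s∈ , refl ← ∈-map⁻ (hosts z) q∈
          with u , u∈ , refl ← ∈-image⁻ inˡ v∈f
          with w , w∈ , eq ← ∈-image⁻ (glue z) v∈q =
          z-cored (subst (_∈ edge j) (glueʳ-glueˡ z v₀ w eq) u∈)

        τy : Fin n
        τy = τ ⟨$⟩ʳ y

        x⇒τy : ∀ j → x ∈ edge (suc j) → τy ∈ edge (suc j)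
        x⇒τy j x∈j with refl ← Fin.suc-injective (x-cored x∈j) = τ-to j y∈

        τy⇒x : ∀ j → τy ∈ edge (suc j) → x ∈ edge (suc j)
        τy⇒x j τy∈ with refl ← Fin.inject₁-injective (y-cored (τ-from j τy∈)) = x∈

        -- τ need not send y to x, but among the edges suc j both x and the
        -- image of y lie on suc l only, so exchanging them is harmless.
        π : Permutation′ n
        π = τ ∘ₚ transpose τy x

        π-to : ∀ j {v} → v ∈ edge (inject₁ j) → (π ⟨$⟩ʳ v) ∈ edge (suc j)
        π-to j v∈ = ∈-transpose⁺ (τy⇒x j) (x⇒τy j) (τ-to j v∈)

        π-from : ∀ j {v} → (π ⟨$⟩ʳ v) ∈ edge (suc j) → v ∈ edge (inject₁ j)
        π-from j v∈ = τ-from j (∈-transpose⁻ (τy⇒x j) (x⇒τy j) v∈)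

        σ : Permutation′ (n + m)
        σ = sumPermutation π (Perm.id {m})

        -- The distances of the glued vertex from the two pendant ends. Since `suc l` is the edge
        -- numbered l from one in the theorem, and the path has `suc r` edges, they are the l - 1
        -- and r - l + 1 of the overview.
        a b : Fin (suc r)
        a = suc l
        b = opposite (inject₁ l)

        a<b : toℕ a ℕ.< toℕ b
        a<b = ℕ.+-cancelʳ-≤ (toℕ l) _ _ (subst (suc (suc (toℕ l)) + toℕ l ≤_)
          (≡.trans (≡.sym (ℕ.suc-injective (toℕ-opposite (inject₁ l))))
            (≡.trans (cong (_+ toℕ b) (Fin.toℕ-inject₁ l)) (ℕ.+-comm (toℕ l) (toℕ b))))
          (half-bound (toℕ l) r l-bound))

        attach′ : ∀ {q} → q ∈ₗ List.map (hosts y) (allEdges H₀) → ∀ {v j} → v ∈ q → v ∈ f (opposite j) → j ≡ b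
        attach′ q∈ {j = j} v∈q v∈f = ≡.trans (≡.sym (Fin.opposite-involutive j))
          (cong opposite (attach {y} {inject₁ l} y-cored q∈ {j = opposite j} v∈q v∈f))

        f-to : ∀ j {v} → v ∈ f (inject₁ j) → (σ ⟨$⟩ʳ v) ∈ f (suc j)
        f-to j = image-permuted⁺ σ {inˡ} {inˡ} {π ⟨$⟩ʳ_} (extend-glueˡ π m) (π-to j)

        f-from : ∀ j {v} → (σ ⟨$⟩ʳ v) ∈ f (suc j) → v ∈ f (inject₁ j)
        f-from j = image-permuted⁻ σ {inˡ} {inˡ} {π ⟨$⟩ʳ_} (extend-glueˡ π m)
          (λ w → π ⟨$⟩ˡ w , inverseʳ π) (π-from j)

        πy≡x : π ⟨$⟩ʳ y ≡ x
        πy≡x = transpose-left τy x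

        g-to : ∀ s {v} → v ∈ hosts y s → (σ ⟨$⟩ʳ v) ∈ hosts x s
        g-to s = image-permuted⁺ σ {glue x} {glue y} {id} (extend-glueʳ π m πy≡x v₀) id

        g-from : ∀ s {v} → (σ ⟨$⟩ʳ v) ∈ hosts x s → v ∈ hosts y s
        g-from s = image-permuted⁻ σ {glue x} {glue y} {id} (extend-glueʳ π m πy≡x v₀) (λ w → w , refl) id

        f-path : PathSystem k f
        f-path = PathSystem-image inˡ glueˡ-injective path

      sliding : SαLess k α (coalescence P y H₀ v₀) (coalescence P x H₀ v₀)
      -- An edge of H₀ at `v₀` contains x after gluing, so the loop at x can be counted as a host
      -- entry.
      sliding with s , s-edge , v₀∈ ← incident-edge H₀ v₀ v₀-edge =
        SαLess-paths α 0<α α<1 κ f-path (PathSystem-opposite f-path) (allEdges H₀) (hosts x) (hosts y) a b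
          (attach x-cored) attach′ σ f-to f-from g-to g-from a<b l refl
          (edgeList y) (edgeList x) d<size (∈-image⁺ inˡ x∈)
          (∈-map⁺ (hosts x) (EdgeList.complete (allEdges-edges H₀) s-edge))
          (subst (_∈ hosts x s) (glueʳ-base x v₀) (∈-image⁺ (glue x) v₀∈))

lemma4p3 : ∀ {c ℓ₁ ℓ₂ ℓ₃} (F : OrderedField c ℓ₁ ℓ₂ ℓ₃) →
    let open OrderedField F
        open Spectral F
    in
    (α : Carrier) → 0# < α → α < 1# →
    (k r : ℕ) → 3 ≤ k → 3 ≤ r →
    (l : Fin r) → 2 ≤ suc (toℕ l) → suc (toℕ l) ≤ ⌈ r /2⌉ →
    (x y : Fin (hyperpathSize k r)) →
    x ∈ hyperpathEdge k r l → degree (hyperpath k r) x ≡ 1 →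
    y ∈ hyperpathEdge k r (pred l) → degree (hyperpath k r) y ≡ 1 →
    (m : ℕ) (H₀ : Hypergraph (suc m)) → Uniform k H₀ →
    (v₀ : Fin (suc m)) → 1 ≤ degree H₀ v₀ →
    SαLess k α
      (coalescence (hyperpath k r) y H₀ v₀)
      (coalescence (hyperpath k r) x H₀ v₀)
-- Index `zero` is the first hyperedge, which 2 ≤ l excludes. For an index `suc l` the predecessor
-- computes to `inject₁ l`, the form in which `sliding` expects the edge of y.
lemma4p3 F α 0<α α<1 (suc (suc (suc κ))) (suc r) _ _ zero (s≤s ()) _
lemma4p3 F α 0<α α<1 k@(suc (suc (suc κ))) (suc r) 3≤k _ (suc l) _ l-bound x y x∈ x-cored y∈ y-cored m H₀ _ v₀ v₀-edge =
  PathSliding.sliding F α 0<α α<1 (suc κ) (hyperpath-path (s≤s (s≤s z≤n))) (hyperpath-edges 3≤k) two-ends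
    (hyperpath-rotation k r) (∈-rotation⁺ k r) (∈-rotation⁻ k r) l l-bound
    x∈ (λ x∈i → cored-edge 3≤k x-cored x∈i x∈) y∈ (λ y∈i → cored-edge 3≤k y-cored y∈i y∈) H₀ v₀ v₀-edge
    (ℕ.≤-trans (size-bound (suc (toℕ l)) κ r
      (s≤s (subst (_≤ r) (≡.sym (ℕ.+-suc (suc (toℕ l)) (toℕ l))) (half-bound (toℕ l) r l-bound)))) (ℕ.m≤m+n _ m))
  where open Hyperpath k (suc r)
lemma4p3 F α 0<α α<1 (suc (suc zero)) _ (s≤s (s≤s ()))
lemma4p3 F α 0<α α<1 (suc zero) _ (s≤s ())
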